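{- Let $N$ be a positive integer, $l\in\{2,\ldots,\frac{N}{2}\}$, and let $\Gamma$ be the $l$-hypercycle on $N$ vertices. Then the eigenvalues of its (signless) normalized Laplacian are $$\lambda_i=1+\frac{\sum_{r=1}^N m(r)\cos\left(\frac{2\pi i r}{N}\right)}{l},\qquad i=1,\ldots,N,$$ where $m:\{0,\ldots,N\}\to\mathbb{Z}$ is defined by $m(r):=l-r$ for $r\in\{1,\ldots,l-1\}$, $m(N-k):=l-k$ for $k\in\{1,\ldots,l-1\}$, and $m:=0$ otherwise.
   Context: A hypergraph $\Gamma=(\mathcal{V},\mathcal{H})$ has a finite vertex set $\mathcal{V}$ and a set $\mathcal{H}$ of nonempty subsets of $\mathcal{V}$ (hyperedges). $\deg(v)$ is the number of hyperedges containing $v$, $D$ the diagonal degree matrix, $A$ the matrix with $A_{ii}=0$ and $A_{ij}=-\#\{h\in\mathcal{H}: v_i,v_j\in h\}$ for $i\ne j$, and the (signless) normalized Laplacian is $L=\mathrm{Id}-D^{ -1}A$. The $l$-hypercycle on $N$ vertices has $\mathcal{V}=\{v_1,\ldots,v_N\}$ and $\mathcal{H}=\{h_1,\ldots,h_N\}$ with $h_i=\{v_i,v_{i+1},\ldots,v_{i+l-1}\}$, indices taken modulo $N$ (i.e. $v_{N+i}:=v_i$). Here the eigenvalues $\lambda_i$ are indexed by the formula, not in increasing order. -}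

module Defs where

open import Algebra.Apartness.Bundles using (HeytingField; HeytingCommutativeRing)
import Algebra.Apartness.Properties.HeytingCommutativeRing as HeytingProperties
open import Algebra.Bundles using (CommutativeRing)
import Algebra.Properties.CommutativeMonoid.Sum as Sum
import Algebra.Properties.Ring as RingProperties
import Algebra.Properties.Semiring.Mult as Mult
import Algebra.Properties.Semiring.Exp as Exp
open import Data.Bool.Base using (if_then_else_)
open import Data.Empty using (⊥-elim)
open import Data.Fin.Base using (Fin; zero; suc; toℕ; punchIn)
open import Data.Fin.Properties using (toℕ-injective; toℕ-fromℕ<; toℕ<n)
  renaming (_≟_ to _≟ᶠ_)
open import Data.Fin.Subset using (Subset; Nonempty; _∈_; ⁅_⁆; ⋃)
open import Data.Fin.Subset.Properties
  using (_∈?_; ∉⊥; x∈⁅x⁆; x∈⁅y⁆⇒x≡y; x∈p∪q⁺; x∈p∪q⁻)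
open import Data.Integer.Base using (ℤ; +_; -[1+_])
  renaming (_-_ to _-ℤ_; -_ to -ℤ_)
open import Data.List.Base using (List; []; _∷_; length; filter; map; upTo; tabulate)
import Data.List.Membership.Propositional as List
open import Data.List.Membership.Propositional.Properties
  using (∈-map⁺; ∈-map⁻; ∈-upTo⁺; ∈-upTo⁻; ∈-tabulate⁺; ∈-filter⁺)
open import Data.List.Relation.Unary.All using (All)
import Data.List.Relation.Unary.All.Properties as All
open import Data.List.Relation.Unary.Any using (here; there)
open import Data.List.Relation.Unary.Unique.Propositional using (Unique)
import Data.List.Relation.Unary.Unique.Propositional.Properties as Unique
open import Data.Nat.Base as ℕ using (ℕ; zero; suc; NonZero; _∸_; _!)
  renaming (_+_ to _+ℕ_; _*_ to _*ℕ_; _<_ to _<ℕ_; _≤_ to _≤ℕ_)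
open import Data.Nat.DivMod
  using (_%_; _/_; _mod_; m%n<n; m%n%n≡m%n; m<n⇒m%n≡m; m≡m%n+[m/n]*n; %-distribˡ-+)
import Data.Nat.Properties as ℕₚ
open import Data.Product.Base using (∃-syntax; Σ-syntax; _×_; _,_; proj₁; proj₂)
open import Data.Sum.Base using (_⊎_; inj₁; inj₂)
open import Function.Bundles using (_⇔_; Equivalence)
open import Level using (_⊔_) renaming (suc to lsuc)
open import Relation.Binary.Core using (Rel)
open import Relation.Binary.Structures using (IsStrictPartialOrder)
open import Relation.Binary.PropositionalEquality
  using (_≡_; refl; sym; trans; cong; subst; module ≡-Reasoning)
open import Relation.Nullary using (¬_; does; _×-dec_)

-- The standard library has no real numbers.  They are axiomatised as an
-- Archimedean, Cauchy-complete ordered field, which determines them up to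
-- isomorphism.  The axioms are phrased so that they also hold for the
-- usual constructive (Cauchy) reals: the order is not assumed decidable,
-- and x # y ("x and y are apart") is the invertibility of x - y.

record OrderedField c ℓ₁ ℓ₂ ℓ₃ : Set (lsuc (c ⊔ ℓ₁ ⊔ ℓ₂ ⊔ ℓ₃)) where
  infix 4 _<_ _ConvergesTo_

  field
    heytingField : HeytingField c ℓ₁ ℓ₂

  open HeytingField heytingField public

  field
    _<_                  : Rel Carrier ℓ₃
    isStrictPartialOrder : IsStrictPartialOrder _≈_ _<_
    #⇔<⊎>                : ∀ {x y} → x # y ⇔ (x < y ⊎ y < x)
    +-monoˡ-<            : ∀ z {x y} → x < y → x + z < y + z
    *-pos                : ∀ {x y} → 0# < x → 0# < y → 0# < x * y

  open HeytingCommutativeRing heytingCommutativeRing public using (commutativeRing)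
  open CommutativeRing commutativeRing public
    using (ring; semiring; +-commutativeMonoid; *-commutativeMonoid)

  fromℕ : ℕ → Carrier
  fromℕ k = Mult._×_ semiring k 1#

  ∣_-_∣<_ : Carrier → Carrier → Carrier → Set ℓ₃
  ∣ x - y ∣< ε = (x - y < ε) × (y - x < ε)

  _ConvergesTo_ : (ℕ → Carrier) → Carrier → Set (c ⊔ ℓ₃)
  s ConvergesTo x = ∀ ε → 0# < ε → ∃[ n ] ∀ k → n ≤ℕ k → ∣ s k - x ∣< ε

  Cauchy : (ℕ → Carrier) → Set (c ⊔ ℓ₃)
  Cauchy s = ∀ ε → 0# < ε → ∃[ n ] ∀ j k → n ≤ℕ j → n ≤ℕ k → ∣ s j - s k ∣< ε

record CompleteOrderedField c ℓ₁ ℓ₂ ℓ₃ : Set (lsuc (c ⊔ ℓ₁ ⊔ ℓ₂ ⊔ ℓ₃)) where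
  field
    orderedField : OrderedField c ℓ₁ ℓ₂ ℓ₃

  open OrderedField orderedField public

  field
    archimedean : ∀ x → ∃[ n ] x < fromℕ n
    complete    : ∀ s → Cauchy s → ∃[ x ] s ConvergesTo x

record Hypergraph : Set where
  field
    n          : ℕ
    hyperedges : List (Subset n)
    nonempty   : All Nonempty hyperedges
    unique     : Unique hyperedges

  deg : Fin n → ℕ
  deg v = length (filter (v ∈?_) hyperedges)

  codeg : Fin n → Fin n → ℕ
  codeg v w = length (filter (λ h → (v ∈? h) ×-dec (w ∈? h)) hyperedges)

  -- The sign is part of the definition of the adjacency matrix.
  adjacency : Fin n → Fin n → ℤ
  adjacency i j = if does (i ≟ᶠ j) then + 0 else -ℤ (+ codeg i j)

  NoIsolatedVertices : Set
  NoIsolatedVertices = ∀ v → NonZero (deg v)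

-- Vertices are numbered from 0, so vertex v_{i+1} is the element i of Fin N.

arc : ∀ N .{{_ : NonZero N}} (l : ℕ) → Fin N → Subset N
arc N l i = ⋃ (map (λ k → ⁅ (toℕ i +ℕ k) mod N ⁆) (upTo l))

module _ {n : ℕ} where

  ∈⋃⁺ : ∀ {x : Fin n} {p ps} → p List.∈ ps → x ∈ p → x ∈ ⋃ ps
  ∈⋃⁺ (here refl)  x∈p = x∈p∪q⁺ (inj₁ x∈p)
  ∈⋃⁺ (there p∈ps) x∈p = x∈p∪q⁺ (inj₂ (∈⋃⁺ p∈ps x∈p))

  ∈⋃⁻ : ∀ {x : Fin n} ps → x ∈ ⋃ ps → ∃[ p ] p List.∈ ps × x ∈ p
  ∈⋃⁻ []       x∈ = ⊥-elim (∉⊥ x∈)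
  ∈⋃⁻ (p ∷ ps) x∈ with x∈p∪q⁻ p (⋃ ps) x∈
  ... | inj₁ x∈p = p , here refl , x∈p
  ... | inj₂ x∈⋃ with ∈⋃⁻ ps x∈⋃
  ...   | q , q∈ps , x∈q = q , there q∈ps , x∈q

module _ {N : ℕ} .{{_ : NonZero N}} {l : ℕ} where

  ∈arc⁺ : ∀ {i v : Fin N} k → k <ℕ l → toℕ v ≡ (toℕ i +ℕ k) % N → v ∈ arc N l i
  ∈arc⁺ {i} {v} k k<l v≡ = ∈⋃⁺ (∈-map⁺ (λ k → ⁅ (toℕ i +ℕ k) mod N ⁆) (∈-upTo⁺ k<l))
    (subst (λ w → v ∈ ⁅ w ⁆)
      (toℕ-injective (trans v≡ (sym (toℕ-fromℕ< (m%n<n (toℕ i +ℕ k) N)))))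
      (x∈⁅x⁆ v))

  ∈arc⁻ : ∀ {i v : Fin N} → v ∈ arc N l i →
          ∃[ k ] k <ℕ l × toℕ v ≡ (toℕ i +ℕ k) % N
  ∈arc⁻ {i} {v} v∈ with ∈⋃⁻ (map (λ k → ⁅ (toℕ i +ℕ k) mod N ⁆) (upTo l)) v∈
  ... | p , p∈ , v∈p with ∈-map⁻ (λ k → ⁅ (toℕ i +ℕ k) mod N ⁆) p∈
  ...   | k , k∈ , refl = k , ∈-upTo⁻ k∈ ,
    trans (cong toℕ (x∈⁅y⁆⇒x≡y _ v∈p)) (toℕ-fromℕ< (m%n<n (toℕ i +ℕ k) N))

  self∈arc : 2 ≤ℕ l → ∀ i → i ∈ arc N l i
  self∈arc 2≤l i = ∈arc⁺ 0 (ℕₚ.<-≤-trans (ℕ.s≤s ℕ.z≤n) 2≤l)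
    (sym (trans (cong (_% N) (ℕₚ.+-identityʳ (toℕ i))) (m<n⇒m%n≡m (toℕ<n i))))

  arc-injective : 2 ≤ℕ l → 2 *ℕ l ≤ℕ N → ∀ {i j : Fin N} →
                  arc N l i ≡ arc N l j → i ≡ j
  arc-injective 2≤l 2l≤N {i} {j} eq
    with ∈arc⁻ (subst (j ∈_) (sym eq) (self∈arc 2≤l j))
       | ∈arc⁻ (subst (i ∈_) eq (self∈arc 2≤l i))
  ... | a , a<l , j≡ | b , b<l , i≡ = toℕ-injective (sym j≡i)
    where
    open ≡-Reasoning

    i≡i+a+b : toℕ i ≡ (toℕ i +ℕ (a +ℕ b)) % N
    i≡i+a+b = begin
      toℕ i                                      ≡⟨ i≡ ⟩
      (toℕ j +ℕ b) % N                           ≡⟨ cong (λ t → (t +ℕ b) % N) j≡ ⟩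
      ((toℕ i +ℕ a) % N +ℕ b) % N                ≡⟨ %-distribˡ-+ _ b N ⟩
      ((toℕ i +ℕ a) % N % N +ℕ b % N) % N        ≡⟨ cong (λ t → (t +ℕ b % N) % N) (m%n%n≡m%n (toℕ i +ℕ a) N) ⟩
      ((toℕ i +ℕ a) % N +ℕ b % N) % N            ≡⟨ %-distribˡ-+ (toℕ i +ℕ a) b N ⟨
      (toℕ i +ℕ a +ℕ b) % N                      ≡⟨ cong (_% N) (ℕₚ.+-assoc (toℕ i) a b) ⟩
      (toℕ i +ℕ (a +ℕ b)) % N                    ∎

    a+b<N : a +ℕ b <ℕ N
    a+b<N = ℕₚ.<-≤-trans (ℕₚ.+-mono-< a<l b<l)
      (subst (_≤ℕ N) (cong (l +ℕ_) (ℕₚ.+-identityʳ l)) 2l≤N)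

    q = (toℕ i +ℕ (a +ℕ b)) / N

    a+b≡qN : a +ℕ b ≡ q *ℕ N
    a+b≡qN = ℕₚ.+-cancelˡ-≡ (toℕ i) _ _ (trans (m≡m%n+[m/n]*n (toℕ i +ℕ (a +ℕ b)) N)
      (cong (_+ℕ q *ℕ N) (sym i≡i+a+b)))

    multiple<N⇒0 : ∀ q → q *ℕ N <ℕ N → q *ℕ N ≡ 0
    multiple<N⇒0 zero    _     = refl
    multiple<N⇒0 (suc q) qN<N = ⊥-elim (ℕₚ.<⇒≱ qN<N (ℕₚ.m≤m+n N (q *ℕ N)))

    a≡0 : a ≡ 0
    a≡0 = ℕₚ.m+n≡0⇒m≡0 a (trans a+b≡qN (multiple<N⇒0 q (subst (_<ℕ N) a+b≡qN a+b<N)))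

    j≡i : toℕ j ≡ toℕ i
    j≡i = begin
      toℕ j             ≡⟨ j≡ ⟩
      (toℕ i +ℕ a) % N  ≡⟨ cong (λ t → (toℕ i +ℕ t) % N) a≡0 ⟩
      (toℕ i +ℕ 0) % N  ≡⟨ cong (_% N) (ℕₚ.+-identityʳ (toℕ i)) ⟩
      toℕ i % N         ≡⟨ m<n⇒m%n≡m (toℕ<n i) ⟩
      toℕ i             ∎

module _ (N : ℕ) .{{_ : NonZero N}} (l : ℕ) (2≤l : 2 ≤ℕ l) (2l≤N : 2 *ℕ l ≤ℕ N) where

  hypercycle : Hypergraph
  hypercycle = record
    { n          = N
    ; hyperedges = tabulate (arc N l)
    ; nonempty   = All.tabulate⁺ (λ i → i , self∈arc 2≤l i)
    ; unique     = Unique.tabulate⁺ (arc-injective 2≤l 2l≤N)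
    }

  hypercycle-noIsolated : Hypergraph.NoIsolatedVertices hypercycle
  hypercycle-noIsolated v = nonZero (∈-filter⁺ (v ∈?_) (∈-tabulate⁺ v) (self∈arc 2≤l v))
    where
    nonZero : ∀ {a} {A : Set a} {x : A} {xs} → x List.∈ xs → NonZero (length xs)
    nonZero (here _)  = _
    nonZero (there _) = _

-- The two nonzero ranges 0 < r < l and 0 < N - r < l are disjoint when 2l ≤ N.
m : ∀ N → ℕ → Fin (suc N) → ℤ
m N l i =
  if does ((0 ℕₚ.<? r) ×-dec (r ℕₚ.<? l)) then + l -ℤ + r else
  if does ((0 ℕₚ.<? k) ×-dec (k ℕₚ.<? l)) then + l -ℤ + k else
  + 0
  where
  r = toℕ i
  k = N ∸ r

module Spectral {c ℓ₁ ℓ₂ ℓ₃} (ℝ : CompleteOrderedField c ℓ₁ ℓ₂ ℓ₃) where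

  open CompleteOrderedField ℝ hiding (refl; zero) renaming (sym to ≈-sym; trans to ≈-trans)
  open IsStrictPartialOrder isStrictPartialOrder
    using (<-respʳ-≈; <-respˡ-≈) renaming (trans to <-trans)
  open Sum +-commutativeMonoid public using (sum-syntax)
  open Sum *-commutativeMonoid public using () renaming (sum to product)
  open Exp semiring public using (_^_)

  fromℤ : ℤ → Carrier
  fromℤ (+ n)    = fromℕ n
  fromℤ -[1+ n ] = - fromℕ (suc n)

  0<1 : 0# < 1#
  0<1 with Equivalence.to #⇔<⊎> 1#0
    where open HeytingProperties heytingCommutativeRing using (1#0)
  ... | inj₂ 0<1 = 0<1
  ... | inj₁ 1<0 = <-respʳ-≈ -1*-1≈1 (*-pos 0<-1 0<-1)
    where
    open RingProperties ring using (-‿involutive; -1*x≈-x)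
    0<-1 : 0# < - 1#
    0<-1 = <-respʳ-≈ (+-identityˡ (- 1#))
      (<-respˡ-≈ (-‿inverseʳ 1#) (+-monoˡ-< (- 1#) 1<0))
    -1*-1≈1 : - 1# * - 1# ≈ 1#
    -1*-1≈1 = ≈-trans (-1*x≈-x (- 1#)) (-‿involutive 1#)

  fromℕ-pos : ∀ n → 0# < fromℕ (suc n)
  fromℕ-pos zero    = <-respʳ-≈ (≈-sym (+-identityʳ 1#)) 0<1
  fromℕ-pos (suc n) = <-trans (fromℕ-pos n)
    (<-respˡ-≈ (+-identityˡ (fromℕ (suc n))) (+-monoˡ-< (fromℕ (suc n)) 0<1))

  -- #⇒invertible inverts fromℕ n - 0#, which is fromℕ n up to ≈.
  recip : (n : ℕ) .{{_ : NonZero n}} → Carrier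
  recip (suc n) = proj₁ (#⇒invertible (Equivalence.from #⇔<⊎> (inj₂ (fromℕ-pos n))))

  infixl 7 _/ℕ_
  _/ℕ_ : Carrier → (n : ℕ) .{{_ : NonZero n}} → Carrier
  x /ℕ n = x * recip n

  cosTerm : Carrier → ℕ → Carrier
  cosTerm x k = _/ℕ_ ((- 1#) ^ k * x ^ (2 *ℕ k)) ((2 *ℕ k) !) {{(2 *ℕ k) ℕₚ.!≢0}}

  IsCos : (Carrier → Carrier) → Set (c ⊔ ℓ₃)
  IsCos cos = ∀ x → (λ n → ∑[ k < n ] cosTerm x (toℕ k)) ConvergesTo cos x

  -- π/2 is the least positive zero of cos.
  record IsPi (cos : Carrier → Carrier) (π : Carrier) : Set (c ⊔ ℓ₁ ⊔ ℓ₃) where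
    field
      π-positive : 0# < π
      cos[π/2]≈0 : cos (π /ℕ 2) ≈ 0#
      π/2-least  : ∀ x → 0# < x → x < π /ℕ 2 → ¬ (cos x ≈ 0#)

  Matrix : ℕ → Set c
  Matrix n = Fin n → Fin n → Carrier

  Id : ∀ {n} → Matrix n
  Id i j = if does (i ≟ᶠ j) then 1# else 0#

  det : ∀ {n} → Matrix n → Carrier
  det {zero}  M = 1#
  det {suc n} M =
    ∑[ j < suc n ] ((- 1#) ^ toℕ j * M zero j * det (λ i k → M (suc i) (punchIn j k)))

  IsEigenvalue : ∀ {n} → Matrix n → Carrier → Set (c ⊔ ℓ₁ ⊔ ℓ₂)
  IsEigenvalue {n} M μ = Σ[ v ∈ (Fin n → Carrier) ] (∃[ i ] v i # 0#) ×
    (∀ i → (∑[ j < n ] (M i j * v j)) ≈ μ * v i)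

  -- λs lists the eigenvalues of M, each repeated according to its multiplicity
  -- as a root of the characteristic polynomial x ↦ det (x Id - M).  Since the
  -- field is infinite, the polynomial identity is stated on values.
  record HasEigenvalues {n} (M : Matrix n) (λs : Fin n → Carrier) : Set (c ⊔ ℓ₁ ⊔ ℓ₂) where
    field
      eigenvalue⇔ : ∀ μ → IsEigenvalue M μ ⇔ (∃[ i ] μ ≈ λs i)
      charPoly    : ∀ x → det (λ i j → x * Id i j - M i j) ≈ product (λ i → x - λs i)

  -- Id - D⁻¹A, where (D⁻¹A)ᵢⱼ = Aᵢⱼ / deg vᵢ as D is diagonal.
  normalizedLaplacian : (Γ : Hypergraph) → Hypergraph.NoIsolatedVertices Γ →
                        Matrix (Hypergraph.n Γ)
  normalizedLaplacian Γ deg≢0 i j =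
    Id i j - _/ℕ_ (fromℤ (adjacency i j)) (deg i) {{deg≢0 i}}
    where open Hypergraph Γ

  module _ (cos : Carrier → Carrier) (π : Carrier) where

    hypercycleEigenvalue : ∀ N .{{_ : NonZero N}} l .{{_ : NonZero l}} → ℕ → Carrier
    hypercycleEigenvalue N l i =
      1# + (∑[ k < N ] (fromℤ (m N l (suc k)) * cos (angle (toℕ (suc k))))) /ℕ l
      where
      angle : ℕ → Carrier
      angle r = fromℕ 2 * π * fromℕ i * fromℕ r /ℕ N

{-# OPTIONS --safe #-}

-- With B the vertex-hyperedge incidence matrix, the normalized Laplacian of the hypercycle is
-- B Bᵀ / l, and B is circulant.  The columns k = 1, …, N of the Hartley matrix
-- cos(2πjk/N) + sin(2πjk/N) are therefore eigenvectors, with eigenvalue |Σ_{a<l} e^{2πika/N}|² / l;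
-- expanding the square gives the Fejér-type sum with weights m(r).  The Hartley matrix H satisfies
-- Hᵀ H = H Hᵀ = N, so the characteristic polynomial follows from the multiplicativity of det, and
-- an eigenvector for μ has a Hartley coefficient apart from 0, which forces μ to be the
-- corresponding eigenvalue.
--
-- Of the trigonometric functions only d'Alembert's equation cos(a+b) + cos(a-b) = 2 cos a cos b
-- has to be derived from the power series: setting sin x = cos(π/2 - x), the addition formulas
-- follow from it and cos(π/2) = 0.  That e^{2πi/N} is a primitive N-th root of unity is likewise
-- algebraic: if a proper divisor g of N had e^{2πig/N} = 1, then i = 1, -1 = 1 or
-- cos(πg/2N) = 0, the last of which contradicts the minimality of π/2.
module Submission where

open import Defs
import Algebra.Apartness.Properties.HeytingCommutativeRing as HeytingProperties
open import Algebra.Bundles using (CommutativeRing)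
import Algebra.Solver.Ring as Solver
open import Algebra.Solver.Ring.AlmostCommutativeRing
  using (_-Raw-AlmostCommutative⟶_; fromCommutativeRing)
open import Data.Bool.Base using (Bool; true; false; if_then_else_; _∧_)
open import Data.Fin.Base using (Fin; zero; suc; toℕ; fromℕ<; punchIn; punchOut; lift)
open import Data.Fin.Properties
  using (punchIn-punchOut; punchIn-injective; punchInᵢ≢i; suc-injective; toℕ-injective; toℕ-fromℕ<; toℕ<n)
  renaming (_≟_ to _≟ᶠ_)
open import Data.Fin.Subset.Properties using (_∈?_)
open import Data.Integer.Base as ℤ using (ℤ; +_; -[1+_]; _⊖_)
import Data.Integer.Properties as ℤₚ
open import Data.List.Base using (length; filter; tabulate)
import Data.Maybe.Base as Maybe
open import Data.Nat.Base as ℕ using (ℕ; zero; suc; NonZero; _∸_; _!)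
open import Data.Nat.DivMod
  using (_%_; _mod_; _/_; m%n<n; m%n%n≡m%n; m<n⇒m%n≡m; m≡m%n+[m/n]*n; %-distribˡ-+; [m+n]%n≡m%n)
open import Data.Nat.Divisibility using (_∣_; divides; _∣?_; ∣m⇒∣m*n)
open import Data.Nat.GCD using (gcd; gcd-GCD; gcd[m,n]∣m; gcd[m,n]∣n; module Bézout)
import Data.Nat.Properties as ℕₚ
open import Data.Nat.Solver using (module +-*-Solver)
open import Data.Product.Base using (∃-syntax; _×_; _,_; proj₁; proj₂)
open import Data.Sum.Base using (_⊎_; inj₁; inj₂)
open import Data.Unit.Polymorphic.Base using (⊤; tt)
open import Data.Vec.Functional using (_∷_; insertAt)
open import Data.Vec.Functional.Properties using (insertAt-lookup; insertAt-punchIn)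
open import Function.Base using (_∘_)
open import Function.Bundles using (Equivalence; mk⇔)
open import Level using (_⊔_)
open import Relation.Binary.PropositionalEquality as ≡ using (_≡_; _≢_)
open import Relation.Binary.Structures using (IsStrictPartialOrder)
open import Relation.Nullary using (¬_; contradiction; yes; no; does; _×-dec_)
open import Relation.Nullary.Decidable using (dec⇒maybe; dec-true; dec-false)
open import Relation.Unary using (Pred; Decidable)

-- The field is only known constructively, and this decides the form of several steps. Minimality of
-- `π/2` gives a negated equation, never an apartness, so `1 - cos (2πd/N)` cannot be inverted; sums
-- over a nontrivial root of unity are shown to vanish by refuting that they are apart from 0. Where
-- a witness is due, as for the index of the eigenvalue of a given eigenvector, invertibility comes
-- from `N` through the orthogonality relations. The Hartley matrix replaces the Fourier matrix in
-- order to stay in the real field. In general neither `B` nor its transpose preserves a Hartley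
-- column, as each mixes it with its reflection; in their product the reflected parts cancel.
-- D'Alembert's equation is exact for partial sums once the product of two of them is cut off along
-- a triangle of indices. Analysis enters only in comparing the triangle with the square, and the
-- geometric bounds for this come from convergence at a doubled argument, with no estimate of
-- factorials.

-- The embedding of the integers and a ring solver with integer coefficients.

module IntegerCoefficients {c ℓ₁ ℓ₂ ℓ₃} (ℝ : CompleteOrderedField c ℓ₁ ℓ₂ ℓ₃) where
  open CompleteOrderedField ℝ hiding (zero)
  open Spectral ℝ
  open import Algebra.Properties.Ring ring
    using (-0#≈0#; -‿involutive; -‿distribˡ-*; -‿distribʳ-*)
  open import Algebra.Properties.AbelianGroup (CommutativeRing.+-abelianGroup commutativeRing)
    using (⁻¹-∙-comm)
  open import Algebra.Properties.Semiring.Mult semiring using (×-homo-+; ×1-homo-*)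
  open import Relation.Binary.Reasoning.Setoid setoid

  fromℕ-+ : ∀ m n → fromℕ (m ℕ.+ n) ≈ fromℕ m + fromℕ n
  fromℕ-+ = ×-homo-+ 1#

  fromℕ-* : ∀ m n → fromℕ (m ℕ.* n) ≈ fromℕ m * fromℕ n
  fromℕ-* = ×1-homo-*

  fromℤ-neg : ∀ i → fromℤ (ℤ.- i) ≈ - fromℤ i
  fromℤ-neg (+ zero)  = sym -0#≈0#
  fromℤ-neg (+ suc n) = refl
  fromℤ-neg -[1+ n ]  = sym (-‿involutive _)

  fromℤ-⊖ : ∀ m n → fromℤ (m ⊖ n) ≈ fromℕ m - fromℕ n
  fromℤ-⊖ m       zero    = sym (trans (+-congˡ -0#≈0#) (+-identityʳ _))
  fromℤ-⊖ zero    (suc n) = sym (+-identityˡ _)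
  fromℤ-⊖ (suc m) (suc n) = begin
    fromℤ (suc m ⊖ suc n)                 ≡⟨ ≡.cong fromℤ (ℤₚ.[1+m]⊖[1+n]≡m⊖n m n) ⟩
    fromℤ (m ⊖ n)                         ≈⟨ fromℤ-⊖ m n ⟩
    fromℕ m - fromℕ n                     ≈⟨ +-congʳ (+-identityʳ _) ⟨
    fromℕ m + 0# - fromℕ n                ≈⟨ +-congʳ (+-congˡ (-‿inverseʳ 1#)) ⟨
    fromℕ m + (1# - 1#) - fromℕ n         ≈⟨ +-congʳ (+-assoc _ _ _) ⟨
    fromℕ m + 1# - 1# - fromℕ n           ≈⟨ +-congʳ (+-congʳ (+-comm _ _)) ⟩
    1# + fromℕ m - 1# - fromℕ n           ≈⟨ +-assoc _ _ _ ⟩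
    1# + fromℕ m + (- 1# - fromℕ n)       ≈⟨ +-congˡ (⁻¹-∙-comm 1# (fromℕ n)) ⟩
    1# + fromℕ m - (1# + fromℕ n)         ∎

  fromℤ-+ : ∀ i j → fromℤ (i ℤ.+ j) ≈ fromℤ i + fromℤ j
  fromℤ-+ (+ m)    (+ n)    = fromℕ-+ m n
  fromℤ-+ (+ m)    -[1+ n ] = fromℤ-⊖ m (suc n)
  fromℤ-+ -[1+ m ] (+ n)    = trans (fromℤ-⊖ n (suc m)) (+-comm _ _)
  fromℤ-+ -[1+ m ] -[1+ n ] = begin
    - fromℕ (suc (suc (m ℕ.+ n)))      ≡⟨ ≡.cong (λ k → - fromℕ (suc k)) (≡.sym (ℕₚ.+-suc m n)) ⟩
    - fromℕ (suc m ℕ.+ suc n)          ≈⟨ -‿cong (fromℕ-+ (suc m) (suc n)) ⟩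
    - (fromℕ (suc m) + fromℕ (suc n))  ≈⟨ ⁻¹-∙-comm _ _ ⟨
    - fromℕ (suc m) - fromℕ (suc n)    ∎

  fromℤ-*⁺ : ∀ i n → fromℤ (i ℤ.* + n) ≈ fromℤ i * fromℕ n
  fromℤ-*⁺ (+ m)    n = trans (reflexive (≡.cong fromℤ (≡.sym (ℤₚ.pos-* m n)))) (fromℕ-* m n)
  fromℤ-*⁺ -[1+ m ] n = begin
    fromℤ (-[1+ m ] ℤ.* + n)        ≡⟨ ≡.cong fromℤ (≡.sym (ℤₚ.neg-distribˡ-* (+ suc m) (+ n))) ⟩
    fromℤ (ℤ.- (+ suc m ℤ.* + n))   ≈⟨ fromℤ-neg (+ suc m ℤ.* + n) ⟩
    - fromℤ (+ suc m ℤ.* + n)       ≈⟨ -‿cong (fromℤ-*⁺ (+ suc m) n) ⟩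
    - (fromℕ (suc m) * fromℕ n)     ≈⟨ -‿distribˡ-* _ _ ⟩
    - fromℕ (suc m) * fromℕ n       ∎

  fromℤ-* : ∀ i j → fromℤ (i ℤ.* j) ≈ fromℤ i * fromℤ j
  fromℤ-* i (+ n)    = fromℤ-*⁺ i n
  fromℤ-* i -[1+ n ] = begin
    fromℤ (i ℤ.* -[1+ n ])          ≡⟨ ≡.cong fromℤ (≡.sym (ℤₚ.neg-distribʳ-* i (+ suc n))) ⟩
    fromℤ (ℤ.- (i ℤ.* + suc n))     ≈⟨ fromℤ-neg (i ℤ.* + suc n) ⟩
    - fromℤ (i ℤ.* + suc n)         ≈⟨ -‿cong (fromℤ-*⁺ i (suc n)) ⟩
    - (fromℤ i * fromℕ (suc n))     ≈⟨ -‿distribʳ-* _ _ ⟩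
    fromℤ i * - fromℕ (suc n)       ∎

  -- Unlike fromℤ (+ 1), which is 1# + 0#, this makes con (+ 1) denote 1#.
  ⟦_⟧ : ℤ → Carrier
  ⟦ + 1 ⟧ = 1#
  ⟦ i ⟧   = fromℤ i

  ⟦⟧≈fromℤ : ∀ i → ⟦ i ⟧ ≈ fromℤ i
  ⟦⟧≈fromℤ (+ 0)           = refl
  ⟦⟧≈fromℤ (+ 1)           = sym (+-identityʳ 1#)
  ⟦⟧≈fromℤ (+ suc (suc n)) = refl
  ⟦⟧≈fromℤ -[1+ n ]        = refl

  homomorphism : ℤ.+-*-rawRing -Raw-AlmostCommutative⟶ fromCommutativeRing commutativeRing
  homomorphism = record
    { ⟦_⟧    = ⟦_⟧
    ; +-homo = λ i j → trans (⟦⟧≈fromℤ (i ℤ.+ j))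
        (trans (fromℤ-+ i j) (sym (+-cong (⟦⟧≈fromℤ i) (⟦⟧≈fromℤ j))))
    ; *-homo = λ i j → trans (⟦⟧≈fromℤ (i ℤ.* j))
        (trans (fromℤ-* i j) (sym (*-cong (⟦⟧≈fromℤ i) (⟦⟧≈fromℤ j))))
    ; -‿homo = λ i → trans (⟦⟧≈fromℤ (ℤ.- i))
        (trans (fromℤ-neg i) (-‿cong (sym (⟦⟧≈fromℤ i))))
    ; 0-homo = refl
    ; 1-homo = refl
    }

  open Solver ℤ.+-*-rawRing (fromCommutativeRing commutativeRing) homomorphism
    (λ i j → Maybe.map (λ i≡j → reflexive (≡.cong ⟦_⟧ i≡j)) (dec⇒maybe (i ℤₚ.≟ j)))
    public using (solve; _:=_; _:+_; _:*_; _:-_; :-_; con)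

-- Determinants as alternating multilinear forms, and their multiplicativity.

punchIn-elim : ∀ {p n} {P : Fin (suc n) → Set p} (j : Fin (suc n)) →
               P j → (∀ k → P (punchIn j k)) → ∀ i → P i
punchIn-elim {P = P} j Pj P↑ i with j ≟ᶠ i
... | yes ≡.refl = Pj
... | no  j≢i    = ≡.subst P (punchIn-punchOut j≢i) (P↑ (punchOut j≢i))

module Determinant {c ℓ₁ ℓ₂ ℓ₃} (ℝ : CompleteOrderedField c ℓ₁ ℓ₂ ℓ₃) where
  open CompleteOrderedField ℝ hiding (zero)
  open Spectral ℝ
  open IntegerCoefficients ℝ
  open import Algebra.Properties.Semiring.Sum semiring
    using (sum-cong-≋; ∑-distrib-+; *-distribˡ-sum; *-distribʳ-sum; sum-replicate-zero)
  open import Relation.Binary.Reasoning.Setoid setoid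

  Row : ℕ → Set c
  Row n = Fin n → Carrier

  infix 4 _≋_
  _≋_ : ∀ {n} → Row n → Row n → Set ℓ₁
  u ≋ v = ∀ i → u i ≈ v i

  Form : ℕ → ℕ → Set c
  Form k n = (Fin k → Row n) → Carrier

  -- Rows are functions compared pointwise up to `≈`, so respect for this relation is made part of
  -- the notion of a form.
  Congruent : ∀ {k n} → Form k n → Set (c ⊔ ℓ₁)
  Congruent f = ∀ {M M′} → (∀ i → M i ≋ M′ i) → f M ≈ f M′

  -- Only the head row is mentioned; linearity in later rows enters through the recursion of
  -- `Alternating` on the forms with frozen head. The single law covers both additivity and scaling.
  Linear : ∀ {k n} → Form (suc k) n → Set (c ⊔ ℓ₁)
  Linear f = ∀ a u v M → f ((λ j → a * u j + v j) ∷ M) ≈ a * f (u ∷ M) + f (v ∷ M)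

  VanishesOnEqualHeads : ∀ k {n} → Form (suc k) n → Set (c ⊔ ℓ₁)
  VanishesOnEqualHeads zero    f = ⊤
  VanishesOnEqualHeads (suc k) f = ∀ u M → f (u ∷ u ∷ M) ≈ 0#

  -- Vanishing is only required for adjacent equal rows.
  Alternating : ∀ k {n} → Form k n → Set (c ⊔ ℓ₁)
  Alternating zero    f = Congruent f
  Alternating (suc k) f =
    Congruent f × Linear f × VanishesOnEqualHeads k f × (∀ u → Alternating k (f ∘ (u ∷_)))

  alternating⇒congruent : ∀ k {n} {f : Form k n} → Alternating k f → Congruent f
  alternating⇒congruent zero    f-cong       = f-cong
  alternating⇒congruent (suc k) (f-cong , _) = f-cong

  ∷-cong : ∀ {k n} {u v : Row n} {M M′ : Fin k → Row n} → u ≋ v → (∀ i → M i ≋ M′ i) →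
           ∀ i → (u ∷ M) i ≋ (v ∷ M′) i
  ∷-cong u≋v M≋M′ zero    = u≋v
  ∷-cong u≋v M≋M′ (suc i) = M≋M′ i

  ∷-η : ∀ {k n} (M : Fin (suc k) → Row n) → ∀ i → M i ≋ (M zero ∷ M ∘ suc) i
  ∷-η M zero    j = refl
  ∷-η M (suc i) j = refl

  alternating-resp : ∀ k {n} {f g : Form k n} → (∀ M → f M ≈ g M) → Alternating k f → Alternating k g
  alternating-resp zero    f≈g f-cong M≋ = trans (sym (f≈g _)) (trans (f-cong M≋) (f≈g _))
  alternating-resp (suc k) {f = f} {g} f≈g (f-cong , f-lin , f-eq , f-tail) =
      (λ M≋ → trans (sym (f≈g _)) (trans (f-cong M≋) (f≈g _)))
    , (λ a u v M → trans (sym (f≈g _)) (trans (f-lin a u v M) (+-cong (*-congˡ (f≈g _)) (f≈g _))))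
    , heads k f≈g f-eq
    , (λ u → alternating-resp k (λ M → f≈g (u ∷ M)) (f-tail u))
    where
    heads : ∀ k {f g : Form (suc k) _} → (∀ M → f M ≈ g M) →
            VanishesOnEqualHeads k f → VanishesOnEqualHeads k g
    heads zero    _   _    = tt
    heads (suc k) f≈g f-eq u M = trans (sym (f≈g _)) (f-eq u M)

  alternating-combination : ∀ k {m n} (a : Fin m → Carrier) {f : Fin m → Form k n} →
    (∀ j → Alternating k (f j)) → Alternating k (λ M → ∑[ j < m ] (a j * f j M))
  alternating-combination zero    a f-alt M≋ = sum-cong-≋ (λ j → *-congˡ (f-alt j M≋))
  alternating-combination (suc k) {m} a {f} f-alt =
      (λ M≋ → sum-cong-≋ (λ j → *-congˡ (proj₁ (f-alt j) M≋)))
    , (λ b u v M → begin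
        ∑[ j < m ] (a j * f j ((λ i → b * u i + v i) ∷ M))
          ≈⟨ sum-cong-≋ (λ j → trans (*-congˡ (proj₁ (proj₂ (f-alt j)) b u v M))
               (solve 4 (λ a b x y → a :* (b :* x :+ y) := b :* (a :* x) :+ a :* y) refl
                  (a j) b (f j (u ∷ M)) (f j (v ∷ M)))) ⟩
        ∑[ j < m ] (b * (a j * f j (u ∷ M)) + a j * f j (v ∷ M))
          ≈⟨ ∑-distrib-+ _ (λ j → a j * f j (v ∷ M)) ⟩
        ∑[ j < m ] (b * (a j * f j (u ∷ M))) + ∑[ j < m ] (a j * f j (v ∷ M))
          ≈⟨ +-congʳ (*-distribˡ-sum b (λ j → a j * f j (u ∷ M))) ⟨
        b * (∑[ j < m ] (a j * f j (u ∷ M))) + ∑[ j < m ] (a j * f j (v ∷ M)) ∎)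
    , heads k (λ j → proj₁ (proj₂ (proj₂ (f-alt j))))
    , (λ u → alternating-combination k a (λ j → proj₂ (proj₂ (proj₂ (f-alt j))) u))
    where
    heads : ∀ k {f : Fin m → Form (suc k) _} → (∀ j → VanishesOnEqualHeads k (f j)) →
            VanishesOnEqualHeads k (λ M → ∑[ j < m ] (a j * f j M))
    heads zero    _    = tt
    heads (suc k) f-eq u M =
      trans (sum-cong-≋ (λ j → trans (*-congˡ (f-eq j u M)) (zeroʳ (a j)))) (sum-replicate-zero m)

  record IsLinearMap {n n′} (φ : Row n → Row n′) : Set (c ⊔ ℓ₁) where
    field
      map-cong : ∀ {u v} → u ≋ v → φ u ≋ φ v
      map-lin  : ∀ a u v → φ (λ j → a * u j + v j) ≋ (λ i → a * φ u i + φ v i)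

  -- Applied to three maps of rows: insertion of a zero entry, deletion of a column, and right
  -- multiplication by a matrix.
  alternating-∘ : ∀ k {n n′} {f : Form k n′} {φ : Row n → Row n′} → IsLinearMap φ →
                  Alternating k f → Alternating k (λ M → f (φ ∘ M))
  alternating-∘ zero    φ-lin f-cong M≋ = f-cong (λ i → IsLinearMap.map-cong φ-lin (M≋ i))
  alternating-∘ (suc k) {f = f} {φ} φ-lin (f-cong , f-lin , f-eq , f-tail) =
      (λ M≋ → f-cong (λ i → map-cong (M≋ i)))
    , (λ a u v M → begin
        f (φ ∘ ((λ j → a * u j + v j) ∷ M))
          ≈⟨ f-cong (λ { zero → map-lin a u v ; (suc i) j → refl }) ⟩
        f ((λ i → a * φ u i + φ v i) ∷ φ ∘ M)
          ≈⟨ f-lin a (φ u) (φ v) (φ ∘ M) ⟩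
        a * f (φ u ∷ φ ∘ M) + f (φ v ∷ φ ∘ M)
          ≈⟨ +-cong (*-congˡ (φ-∷ u M)) (φ-∷ v M) ⟩
        a * f (φ ∘ (u ∷ M)) + f (φ ∘ (v ∷ M)) ∎)
    , heads k f-cong f-eq
    , (λ u → alternating-resp k (φ-∷ u) (alternating-∘ k φ-lin (f-tail (φ u))))
    where
    open IsLinearMap φ-lin
    φ-∷ : ∀ u M → f (φ u ∷ φ ∘ M) ≈ f (φ ∘ (u ∷ M))
    φ-∷ u M = f-cong (λ { zero j → refl ; (suc i) j → refl })
    heads : ∀ k {f : Form (suc k) _} → Congruent f →
            VanishesOnEqualHeads k f → VanishesOnEqualHeads k (λ M → f (φ ∘ M))
    heads zero    _      _    = tt
    heads (suc k) f-cong f-eq u M =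
      trans (f-cong (λ { zero j → refl ; (suc zero) j → refl ; (suc (suc i)) j → refl }))
            (f-eq (φ u) (φ ∘ M))

  module _ {k n} {f : Form (suc k) n} (f-alt : Alternating (suc k) f) where
    private
      f-cong = proj₁ f-alt
      f-lin  = proj₁ (proj₂ f-alt)

    -- Linearity applied to `0 = (-1) · 0 + 0` turns the value into its own negative plus itself.
    linear-0 : ∀ M → f ((λ _ → 0#) ∷ M) ≈ 0#
    linear-0 M = begin
      f ((λ _ → 0#) ∷ M)
        ≈⟨ f-cong (∷-cong (λ _ → solve 0 (con (+ 0) := (:- con (+ 1)) :* con (+ 0) :+ con (+ 0)) refl) (λ _ _ → refl)) ⟩
      f ((λ _ → - 1# * 0# + 0#) ∷ M)
        ≈⟨ f-lin (- 1#) _ _ M ⟩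
      - 1# * f ((λ _ → 0#) ∷ M) + f ((λ _ → 0#) ∷ M)
        ≈⟨ solve 1 (λ x → (:- con (+ 1)) :* x :+ x := con (+ 0)) refl _ ⟩
      0# ∎

    linear-+ : ∀ u v M → f ((λ j → u j + v j) ∷ M) ≈ f (u ∷ M) + f (v ∷ M)
    linear-+ u v M = begin
      f ((λ j → u j + v j) ∷ M)
        ≈⟨ f-cong (∷-cong (λ j → +-congʳ (sym (*-identityˡ (u j)))) (λ _ _ → refl)) ⟩
      f ((λ j → 1# * u j + v j) ∷ M)
        ≈⟨ f-lin 1# u v M ⟩
      1# * f (u ∷ M) + f (v ∷ M)
        ≈⟨ +-congʳ (*-identityˡ _) ⟩
      f (u ∷ M) + f (v ∷ M) ∎

    linear-∑ : ∀ {m} (a : Fin m → Carrier) (u : Fin m → Row n) M →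
               f ((λ k → ∑[ j < m ] (a j * u j k)) ∷ M) ≈ ∑[ j < m ] (a j * f (u j ∷ M))
    linear-∑ {zero}  a u M = linear-0 M
    linear-∑ {suc m} a u M = trans (f-lin (a zero) (u zero) _ M)
      (+-congˡ (linear-∑ (a ∘ suc) (u ∘ suc) M))

  -- Polarization: expanding the vanishing value at the equal heads `u + v`, `u + v` leaves the two
  -- mixed terms.
  swap-heads : ∀ {k n} {f : Form (suc (suc k)) n} → Alternating (suc (suc k)) f →
               ∀ u v M → f (u ∷ v ∷ M) ≈ - f (v ∷ u ∷ M)
  swap-heads {f = f} f-alt@(f-cong , f-lin , f-eq , f-tail) u v M = begin
    f (u ∷ v ∷ M)
      ≈⟨ solve 4 (λ a b c d → b := a :+ b :+ (c :+ d) :- a :- d :- c) refl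
           (f (u ∷ u ∷ M)) (f (u ∷ v ∷ M)) (f (v ∷ u ∷ M)) (f (v ∷ v ∷ M)) ⟩
    f (u ∷ u ∷ M) + f (u ∷ v ∷ M) + (f (v ∷ u ∷ M) + f (v ∷ v ∷ M))
      - f (u ∷ u ∷ M) - f (v ∷ v ∷ M) - f (v ∷ u ∷ M)
      ≈⟨ +-congʳ (+-cong (+-cong total (-‿cong (f-eq u M))) (-‿cong (f-eq v M))) ⟩
    0# - 0# - 0# - f (v ∷ u ∷ M)
      ≈⟨ solve 1 (λ x → con (+ 0) :- con (+ 0) :- con (+ 0) :- x := :- x) refl _ ⟩
    - f (v ∷ u ∷ M) ∎
    where
    w : Row _
    w j = u j + v j
    total : f (u ∷ u ∷ M) + f (u ∷ v ∷ M) + (f (v ∷ u ∷ M) + f (v ∷ v ∷ M)) ≈ 0#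
    total = begin
      f (u ∷ u ∷ M) + f (u ∷ v ∷ M) + (f (v ∷ u ∷ M) + f (v ∷ v ∷ M))
        ≈⟨ +-cong (linear-+ (f-tail u) u v M) (linear-+ (f-tail v) u v M) ⟨
      f (u ∷ w ∷ M) + f (v ∷ w ∷ M)
        ≈⟨ linear-+ f-alt u v (w ∷ M) ⟨
      f (w ∷ w ∷ M)
        ≈⟨ f-eq w M ⟩
      0# ∎

  -- Row `j` passes `j` others, one sign each: induction in the tail form with frozen head does all
  -- exchanges but the last.
  move-to-head : ∀ {k n} {f : Form (suc k) n} → Alternating (suc k) f → ∀ R j →
                 f R ≈ (- 1#) ^ toℕ j * f (R j ∷ R ∘ punchIn j)
  move-to-head {f = f} (f-cong , _) R zero = trans (f-cong (∷-η R)) (sym (*-identityˡ _))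
  move-to-head {suc k} {f = f} f-alt@(f-cong , _ , _ , f-tail) R (suc j) = begin
    f R
      ≈⟨ f-cong (∷-η R) ⟩
    f (R zero ∷ R ∘ suc)
      ≈⟨ move-to-head (f-tail (R zero)) (R ∘ suc) j ⟩
    (- 1#) ^ toℕ j * f (R zero ∷ R (suc j) ∷ R ∘ suc ∘ punchIn j)
      ≈⟨ *-congˡ (swap-heads f-alt (R zero) (R (suc j)) _) ⟩
    (- 1#) ^ toℕ j * - f (R (suc j) ∷ R zero ∷ R ∘ suc ∘ punchIn j)
      ≈⟨ solve 2 (λ s x → s :* (:- x) := (:- con (+ 1)) :* s :* x) refl _ _ ⟩
    (- 1#) ^ toℕ (suc j) * f (R (suc j) ∷ R zero ∷ R ∘ suc ∘ punchIn j)
      ≈⟨ *-congˡ (f-cong (∷-cong (λ _ → refl) λ { zero j → refl ; (suc i) j → refl })) ⟩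
    (- 1#) ^ toℕ (suc j) * f (R (suc j) ∷ R ∘ punchIn (suc j)) ∎

  -- Vanishing is known only for adjacent rows, so the row equal to `e` is first brought next to the
  -- head; the sign acquired then multiplies 0.
  repeated-head : ∀ {k n} {f : Form (suc k) n} → Alternating (suc k) f → ∀ e N i → N i ≋ e →
                  f (e ∷ N) ≈ 0#
  repeated-head {suc k} {f = f} (f-cong , _ , f-eq , f-tail) e N i Ni≋e = begin
    f (e ∷ N)                                          ≈⟨ move-to-head (f-tail e) N i ⟩
    (- 1#) ^ toℕ i * f (e ∷ N i ∷ N ∘ punchIn i)        ≈⟨ *-congˡ (f-cong (∷-cong (λ _ → refl) (∷-cong Ni≋e (λ _ _ → refl)))) ⟩
    (- 1#) ^ toℕ i * f (e ∷ e ∷ N ∘ punchIn i)          ≈⟨ *-congˡ (f-eq e _) ⟩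
    (- 1#) ^ toℕ i * 0#                                ≈⟨ zeroʳ _ ⟩
    0#                                                 ∎

  add-multiples : ∀ k {n} {h : Form k n} → Alternating k h → (e : Row n) →
                  (∀ N i → N i ≋ e → h N ≈ 0#) → (a : Fin k → Carrier) → ∀ N N′ →
                  (∀ i → N i ≋ λ j → a i * e j + N′ i j) → h N ≈ h N′
  add-multiples zero    h-cong e kills a N N′ N≋ = h-cong (λ ())
  add-multiples (suc k) {h = h} (h-cong , h-lin , _ , h-tail) e kills a N N′ N≋ = begin
    h N
      ≈⟨ h-cong (λ { zero → N≋ zero ; (suc i) j → refl }) ⟩
    h ((λ j → a zero * e j + N′ zero j) ∷ N ∘ suc)
      ≈⟨ h-lin (a zero) e (N′ zero) (N ∘ suc) ⟩
    a zero * h (e ∷ N ∘ suc) + h (N′ zero ∷ N ∘ suc)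
      ≈⟨ +-congʳ (trans (*-congˡ (kills _ zero (λ _ → refl))) (zeroʳ _)) ⟩
    0# + h (N′ zero ∷ N ∘ suc)
      ≈⟨ +-identityˡ _ ⟩
    h (N′ zero ∷ N ∘ suc)
      ≈⟨ add-multiples k (h-tail (N′ zero)) e (λ M i → kills (N′ zero ∷ M) (suc i))
           (a ∘ suc) (N ∘ suc) (N′ ∘ suc) (N≋ ∘ suc) ⟩
    h (N′ zero ∷ N′ ∘ suc)
      ≈⟨ h-cong (∷-η N′) ⟨
    h N′ ∎

  Id-diag : ∀ {n} (i : Fin n) → Id i i ≡ 1#
  Id-diag i rewrite dec-true (i ≟ᶠ i) ≡.refl = ≡.refl

  Id-off : ∀ {n} {i j : Fin n} → i ≢ j → Id i j ≡ 0#
  Id-off {i = i} {j} i≢j rewrite dec-false (i ≟ᶠ j) i≢j = ≡.refl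

  ∑-Id : ∀ {n} (u : Row n) i → ∑[ j < n ] (u j * Id j i) ≈ u i
  ∑-Id {suc n} u zero = begin
    u zero * 1# + ∑[ j < n ] (u (suc j) * Id (suc j) zero)
      ≈⟨ +-cong (*-identityʳ _) (trans (sum-cong-≋ {n} (λ j → zeroʳ _)) (sum-replicate-zero n)) ⟩
    u zero + 0#
      ≈⟨ +-identityʳ _ ⟩
    u zero ∎
  ∑-Id {suc n} u (suc i) = begin
    u zero * 0# + ∑[ j < n ] (u (suc j) * Id (suc j) (suc i))
      ≈⟨ +-cong (zeroʳ _) (sum-cong-≋ (λ j → *-congˡ (reflexive (Id-suc j)))) ⟩
    0# + ∑[ j < n ] (u (suc j) * Id j i)
      ≈⟨ +-identityˡ _ ⟩
    ∑[ j < n ] (u (suc j) * Id j i)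
      ≈⟨ ∑-Id (u ∘ suc) i ⟩
    u (suc i) ∎
    where
    Id-suc : ∀ j → Id (suc j) (suc i) ≡ Id j i
    Id-suc j with j ≟ᶠ i
    ... | yes _ = ≡.refl
    ... | no  _ = ≡.refl

  insert0 : ∀ {n} → Fin (suc n) → Row n → Row (suc n)
  insert0 j u = insertAt u j 0#

  insert0-linear : ∀ {n} (j : Fin (suc n)) → IsLinearMap (insert0 j)
  insert0-linear j = record
    { map-cong = λ {u} {v} u≋v → punchIn-elim j
        (trans (at u) (sym (at v)))
        (λ k → trans (off u k) (trans (u≋v k) (sym (off v k))))
    ; map-lin = λ a u v → punchIn-elim j
        (trans (at _) (trans (solve 1 (λ a → con (+ 0) := a :* con (+ 0) :+ con (+ 0)) refl a)
          (sym (+-cong (*-congˡ (at u)) (at v)))))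
        (λ k → trans (off _ k) (sym (+-cong (*-congˡ (off u k)) (off v k))))
    }
    where
    at : ∀ u → insert0 j u j ≈ 0#
    at u = reflexive (insertAt-lookup u j 0#)
    off : ∀ u k → insert0 j u (punchIn j k) ≈ u k
    off u k = reflexive (insertAt-punchIn u j 0# k)

  insert0-Id : ∀ {n} (j : Fin (suc n)) k → insert0 j (Id k) ≋ Id (punchIn j k)
  insert0-Id j k = punchIn-elim j
    (reflexive (≡.trans (insertAt-lookup (Id k) j 0#) (≡.sym (Id-off (punchInᵢ≢i j k)))))
    (λ k′ → reflexive (≡.trans (insertAt-punchIn (Id k) j 0# k′) (punch k′)))
    where
    punch : ∀ k′ → Id k k′ ≡ Id (punchIn j k) (punchIn j k′)
    punch k′ with k ≟ᶠ k′
    ... | yes ≡.refl = ≡.sym (Id-diag (punchIn j k))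
    ... | no  k≢k′   = ≡.sym (Id-off (k≢k′ ∘ punchIn-injective j k k′))

  -- Expanding a form along its first row reproduces the recursion defining det.
  alternating≈det : ∀ n {f : Form n n} → Alternating n f → ∀ M → f M ≈ det M * f Id
  alternating≈det zero    f-cong M = trans (f-cong (λ ())) (sym (*-identityˡ _))
  alternating≈det (suc n) {f} f-alt@(f-cong , _ , _ , f-tail) M = begin
    f M
      ≈⟨ f-cong (λ { zero i → sym (∑-Id (M zero) i) ; (suc i) j → refl }) ⟩
    f ((λ i → ∑[ j < suc n ] (M zero j * Id j i)) ∷ M ∘ suc)
      ≈⟨ linear-∑ f-alt (M zero) Id (M ∘ suc) ⟩
    ∑[ j < suc n ] (M zero j * f (Id j ∷ M ∘ suc))
      ≈⟨ sum-cong-≋ (λ j → trans (*-congˡ (expand j))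
           (solve 4 (λ m d s x → m :* (d :* (s :* x)) := s :* m :* d :* x) refl
             (M zero j) (det (minor j)) ((- 1#) ^ toℕ j) (f Id))) ⟩
    ∑[ j < suc n ] ((- 1#) ^ toℕ j * M zero j * det (minor j) * f Id)
      ≈⟨ *-distribʳ-sum (f Id) (λ j → (- 1#) ^ toℕ j * M zero j * det (minor j)) ⟨
    det M * f Id ∎
    where
    minor : Fin (suc n) → Fin n → Row n
    minor j i k = M (suc i) (punchIn j k)

    ±-involutive : ∀ k x → (- 1#) ^ k * ((- 1#) ^ k * x) ≈ x
    ±-involutive zero    x = trans (*-identityˡ _) (*-identityˡ _)
    ±-involutive (suc k) x = trans
      (solve 2 (λ s x → (:- con (+ 1)) :* s :* ((:- con (+ 1)) :* s :* x) := s :* (s :* x)) refl _ _)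
      (±-involutive k x)

    -- Multiples of the unit row `Id j` clear column `j` below it, leaving the minor with a zero
    -- column inserted, to which the induction applies. What remains is `Id` with row `j` moved to
    -- the top, whence the sign.
    expand : ∀ j → f (Id j ∷ M ∘ suc) ≈ det (minor j) * ((- 1#) ^ toℕ j * f Id)
    expand j = begin
      f (Id j ∷ M ∘ suc)
        ≈⟨ add-multiples n (f-tail (Id j)) (Id j) (repeated-head f-alt (Id j)) (λ i → M (suc i) j) _ _
             (λ i → punchIn-elim j
               (sym (trans (+-cong (trans (*-congˡ (reflexive (Id-diag j))) (*-identityʳ _))
                 (reflexive (insertAt-lookup (minor j i) j 0#))) (+-identityʳ _)))
               (λ k → sym (trans (+-cong (trans (*-congˡ (reflexive (Id-off (punchInᵢ≢i j k ∘ ≡.sym)))) (zeroʳ _))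
                 (reflexive (insertAt-punchIn (minor j i) j 0# k))) (+-identityˡ _)))) ⟩
      f (Id j ∷ insert0 j ∘ minor j)
        ≈⟨ alternating≈det n (alternating-∘ n (insert0-linear j) (f-tail (Id j))) (minor j) ⟩
      det (minor j) * f (Id j ∷ insert0 j ∘ Id)
        ≈⟨ *-congˡ (f-cong (∷-cong (λ _ → refl) (insert0-Id j))) ⟩
      det (minor j) * f (Id j ∷ Id ∘ punchIn j)
        ≈⟨ *-congˡ (±-involutive (toℕ j) _) ⟨
      det (minor j) * ((- 1#) ^ toℕ j * ((- 1#) ^ toℕ j * f (Id j ∷ Id ∘ punchIn j)))
        ≈⟨ *-congˡ (*-congˡ (move-to-head f-alt Id j)) ⟨
      det (minor j) * ((- 1#) ^ toℕ j * f Id) ∎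

  -- The Laplace expansion along two equal rows `a`; `φ` stands for the minor of the other rows as a
  -- function of the columns selected. It is abstract so that the recursion can restrict it to
  -- selections that keep column 0.
  doubleExpansion : ∀ n → Row (suc (suc n)) → ((Fin n → Fin (suc (suc n))) → Carrier) → Carrier
  doubleExpansion n a φ = ∑[ j < suc (suc n) ] ((- 1#) ^ toℕ j * a j *
    (∑[ k < suc n ] ((- 1#) ^ toℕ k * a (punchIn j k) * φ (punchIn j ∘ punchIn k))))

  -- The column pairs (0 , k + 1) and (k + 1 , 0) cancel, and the others form the sum for n - 1.
  doubleExpansion≈0 : ∀ n a φ → (∀ σ τ → (∀ i → σ i ≡ τ i) → φ σ ≈ φ τ) →
                      doubleExpansion n a φ ≈ 0#
  doubleExpansion≈0 n a φ φ-cong = begin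
    1# * a zero * A + ∑[ j < suc n ] (- 1# * (- 1#) ^ toℕ j * a (suc j) * (1# * a zero * ψ j + rest j))
      ≈⟨ +-congˡ (sum-cong-≋ (λ j →
           solve 5 (λ s x y p r → (:- con (+ 1)) :* s :* x :* (con (+ 1) :* y :* p :+ r)
                               := (:- y) :* (s :* x :* p) :+ (:- con (+ 1)) :* s :* x :* r) refl
             ((- 1#) ^ toℕ j) (a (suc j)) (a zero) (ψ j) (rest j))) ⟩
    1# * a zero * A + ∑[ j < suc n ] (- a zero * ((- 1#) ^ toℕ j * a (suc j) * ψ j)
                                      + - 1# * (- 1#) ^ toℕ j * a (suc j) * rest j)
      ≈⟨ +-congˡ (∑-distrib-+ (λ j → - a zero * ((- 1#) ^ toℕ j * a (suc j) * ψ j)) (λ j → - 1# * (- 1#) ^ toℕ j * a (suc j) * rest j)) ⟩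
    1# * a zero * A + ((∑[ j < suc n ] (- a zero * ((- 1#) ^ toℕ j * a (suc j) * ψ j)))
      + ∑[ j < suc n ] (- 1# * (- 1#) ^ toℕ j * a (suc j) * rest j))
      ≈⟨ +-congˡ (+-cong (sym (*-distribˡ-sum (- a zero) (λ j → (- 1#) ^ toℕ j * a (suc j) * ψ j)))
           (remaining n a φ φ-cong)) ⟩
    1# * a zero * A + (- a zero * A + 0#)
      ≈⟨ solve 2 (λ x y → con (+ 1) :* x :* y :+ ((:- x) :* y :+ con (+ 0)) := con (+ 0)) refl _ _ ⟩
    0# ∎
    where
    ψ : Fin (suc n) → Carrier
    ψ k = φ (suc ∘ punchIn k)
    A = ∑[ k < suc n ] ((- 1#) ^ toℕ k * a (suc k) * ψ k)

    rest : Fin (suc n) → Carrier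
    rest j = ∑[ k < n ] (- 1# * (- 1#) ^ toℕ k * a (suc (punchIn j k)) * φ (punchIn (suc j) ∘ punchIn (suc k)))

    -- When neither deleted column is 0, column 0 survives and the selection has the form `lift 1`.
    -- The signs of the two shifted indices cancel.
    remaining : ∀ n (a : Row (suc (suc n))) (φ : (Fin n → Fin (suc (suc n))) → Carrier) →
      (∀ σ τ → (∀ i → σ i ≡ τ i) → φ σ ≈ φ τ) →
      ∑[ j < suc n ] (- 1# * (- 1#) ^ toℕ j * a (suc j) *
        (∑[ k < n ] (- 1# * (- 1#) ^ toℕ k * a (suc (punchIn j k)) * φ (punchIn (suc j) ∘ punchIn (suc k))))) ≈ 0#
    remaining zero    a φ _      = trans (+-identityʳ _) (zeroʳ _)
    remaining (suc n) a φ φ-cong = trans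
      (sum-cong-≋ λ j → begin
        - 1# * (- 1#) ^ toℕ j * a (suc j) * _
          ≈⟨ *-congˡ (sum-cong-≋ λ k → trans
               (*-congˡ (φ-cong (punchIn (suc j) ∘ punchIn (suc k)) (lift 1 (punchIn j ∘ punchIn k)) λ { zero → ≡.refl ; (suc i) → ≡.refl }))
               (solve 3 (λ s x y → (:- con (+ 1)) :* s :* x :* y := (:- con (+ 1)) :* (s :* x :* y)) refl
                 ((- 1#) ^ toℕ k) (a (suc (punchIn j k))) (φ (lift 1 (punchIn j ∘ punchIn k))))) ⟩
        - 1# * (- 1#) ^ toℕ j * a (suc j) * (∑[ k < suc n ] (- 1# * inner j k))
          ≈⟨ *-congˡ (*-distribˡ-sum (- 1#) (inner j)) ⟨
        - 1# * (- 1#) ^ toℕ j * a (suc j) * (- 1# * (∑[ k < suc n ] inner j k))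
          ≈⟨ solve 3 (λ s x y → (:- con (+ 1)) :* s :* x :* ((:- con (+ 1)) :* y) := s :* x :* y) refl
               ((- 1#) ^ toℕ j) (a (suc j)) (∑[ k < suc n ] inner j k) ⟩
        (- 1#) ^ toℕ j * a (suc j) * (∑[ k < suc n ] inner j k) ∎)
      (doubleExpansion≈0 n (a ∘ suc) (φ ∘ lift 1)
        (λ σ τ σ≡τ → φ-cong (lift 1 σ) (lift 1 τ) λ { zero → ≡.refl ; (suc i) → ≡.cong suc (σ≡τ i) }))
      where
      inner : Fin (suc (suc n)) → Fin (suc n) → Carrier
      inner j k = (- 1#) ^ toℕ k * a (suc (punchIn j k)) * φ (lift 1 (punchIn j ∘ punchIn k))

  -- Linearity in the head can be read off the expansion, and each tail is a combination of smaller
  -- determinants after deletion of a column. Equal heads are the case that needs the double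
  -- expansion.
  det-alternating : ∀ n → Alternating n (det {n})
  det-alternating zero    _ = refl
  det-alternating (suc n) =
      (λ M≋ → sum-cong-≋ (λ j → *-cong (*-congˡ {(- 1#) ^ toℕ j} (M≋ zero j)) (det-cong (λ i k → M≋ (suc i) (punchIn j k)))))
    , (λ a u v M → begin
        ∑[ j < suc n ] ((- 1#) ^ toℕ j * (a * u j + v j) * minor M j)
          ≈⟨ sum-cong-≋ (λ j → solve 5 (λ s a u v d → s :* (a :* u :+ v) :* d := a :* (s :* u :* d) :+ s :* v :* d)
               refl ((- 1#) ^ toℕ j) a (u j) (v j) (minor M j)) ⟩
        ∑[ j < suc n ] (a * ((- 1#) ^ toℕ j * u j * minor M j) + (- 1#) ^ toℕ j * v j * minor M j)
          ≈⟨ ∑-distrib-+ (λ j → a * ((- 1#) ^ toℕ j * u j * minor M j)) (λ j → (- 1#) ^ toℕ j * v j * minor M j) ⟩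
        (∑[ j < suc n ] (a * ((- 1#) ^ toℕ j * u j * minor M j))) + det (v ∷ M)
          ≈⟨ +-congʳ (*-distribˡ-sum a (λ j → (- 1#) ^ toℕ j * u j * minor M j)) ⟨
        a * det (u ∷ M) + det (v ∷ M) ∎)
    , heads n
    , (λ u → alternating-combination n (λ j → (- 1#) ^ toℕ j * u j)
        (λ j → alternating-∘ n (record { map-cong = λ u≋v k → u≋v (punchIn j k) ; map-lin = λ _ _ _ _ → refl })
          (det-alternating n)))
    where
    det-cong : Congruent (det {n})
    det-cong = alternating⇒congruent n (det-alternating n)

    minor : (Fin n → Row (suc n)) → Fin (suc n) → Carrier
    minor M j = det (λ i k → M i (punchIn j k))

    heads : ∀ n → VanishesOnEqualHeads n (det {suc n})
    heads zero    = tt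
    heads (suc n) u M = doubleExpansion≈0 n u (λ σ → det (λ i l → M i (σ l)))
      (λ σ τ σ≡τ → alternating⇒congruent n (det-alternating n) (λ i l → reflexive (≡.cong (M i) (σ≡τ l))))

  det-cong : ∀ {n} → Congruent (det {n})
  det-cong {n} = alternating⇒congruent n (det-alternating n)

  infixl 7 _⊗_
  _⊗_ : ∀ {n} → Matrix n → Matrix n → Matrix n
  _⊗_ {n} A B i k = ∑[ j < n ] (A i j * B j k)

  ∑-Idˡ : ∀ {n} (u : Row n) i → ∑[ j < n ] (Id i j * u j) ≈ u i
  ∑-Idˡ {n} u i = trans (sum-cong-≋ (λ j → trans (*-comm _ _) (*-congˡ (reflexive (Id-sym i j))))) (∑-Id u i)
    where
    Id-sym : ∀ {n} (i j : Fin n) → Id i j ≡ Id j i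
    Id-sym i j with i ≟ᶠ j
    ... | yes ≡.refl = ≡.sym (Id-diag i)
    ... | no  i≢j    = ≡.sym (Id-off (i≢j ∘ ≡.sym))

  -- As a form in the rows of `A`, `det (A ⊗ B)` is alternating, hence `det A` times its value at
  -- `Id`.
  det-⊗ : ∀ {n} (A B : Matrix n) → det (A ⊗ B) ≈ det A * det B
  det-⊗ {n} A B = trans
    (alternating≈det n {λ A → det (A ⊗ B)} (alternating-∘ n ⊗B-linear (det-alternating n)) A)
    (*-congˡ (det-cong {n} (λ i k → ∑-Idˡ (λ j → B j k) i)))
    where
    ⊗B-linear : IsLinearMap (λ u k → ∑[ j < n ] (u j * B j k))
    ⊗B-linear = record
      { map-cong = λ u≋v k → sum-cong-≋ (λ j → *-congʳ (u≋v j))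
      ; map-lin  = λ a u v k → begin
          ∑[ j < n ] ((a * u j + v j) * B j k)
            ≈⟨ sum-cong-≋ {n} (λ j → trans (distribʳ _ _ _) (+-congʳ (*-assoc _ _ _))) ⟩
          ∑[ j < n ] (a * (u j * B j k) + v j * B j k)
            ≈⟨ ∑-distrib-+ (λ j → a * (u j * B j k)) _ ⟩
          (∑[ j < n ] (a * (u j * B j k))) + ∑[ j < n ] (v j * B j k)
            ≈⟨ +-congʳ (*-distribˡ-sum a (λ j → u j * B j k)) ⟨
          a * (∑[ j < n ] (u j * B j k)) + ∑[ j < n ] (v j * B j k) ∎
      }

  det-diagonal : ∀ {n} (D : Matrix n) → (∀ {i j} → i ≢ j → D i j ≈ 0#) → det D ≈ product (λ i → D i i)
  det-diagonal {zero}  D off = refl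
  det-diagonal {suc n} D off = begin
    1# * D zero zero * det (λ i k → D (suc i) (suc k)) + ∑[ j < n ] _
      ≈⟨ +-cong (*-cong (*-identityˡ _) (det-diagonal _ (λ i≢j → off (i≢j ∘ suc-injective))))
           (trans (sum-cong-≋ {n} (λ j → trans (*-congʳ (trans (*-congˡ (off {zero} {suc j} (λ ()))) (zeroʳ _))) (zeroˡ _)))
             (sum-replicate-zero n)) ⟩
    D zero zero * product (λ i → D (suc i) (suc i)) + 0#
      ≈⟨ +-identityʳ _ ⟩
    product (λ i → D i i) ∎

-- The ordered field: positivity, inverses and apartness.

module Order {c ℓ₁ ℓ₂ ℓ₃} (ℝ : CompleteOrderedField c ℓ₁ ℓ₂ ℓ₃) where
  open CompleteOrderedField ℝ hiding (zero)
  open Spectral ℝ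
  open IntegerCoefficients ℝ
  open HeytingProperties heytingCommutativeRing public
    using (x-0≈x; 1#0; x#0y#0→xy#0; #-congʳ; invertibleˡ⇒#)
  open IsStrictPartialOrder isStrictPartialOrder public
    using (<-respʳ-≈; <-respˡ-≈)
    renaming (irrefl to <-irrefl; trans to <-trans)
  open import Relation.Binary.Reasoning.Setoid setoid

  <-resp : ∀ {x x′ y y′} → x ≈ x′ → y ≈ y′ → x < y → x′ < y′
  <-resp x≈ y≈ x<y = <-respˡ-≈ x≈ (<-respʳ-≈ y≈ x<y)

  +-monoʳ-< : ∀ z {x y} → x < y → z + x < z + y
  +-monoʳ-< z x<y = <-resp (+-comm _ _) (+-comm _ _) (+-monoˡ-< z x<y)

  +-mono-< : ∀ {x y u v} → x < y → u < v → x + u < y + v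
  +-mono-< x<y u<v = <-trans (+-monoˡ-< _ x<y) (+-monoʳ-< _ u<v)

  +-pos : ∀ {x y} → 0# < x → 0# < y → 0# < x + y
  +-pos 0<x 0<y = <-respˡ-≈ (+-identityˡ 0#) (+-mono-< 0<x 0<y)

  x<y⇒0<y-x : ∀ {x y} → x < y → 0# < y - x
  x<y⇒0<y-x {x} x<y = <-respˡ-≈ (-‿inverseʳ x) (+-monoˡ-< (- x) x<y)

  0<y-x⇒x<y : ∀ {x y} → 0# < y - x → x < y
  0<y-x⇒x<y {x} {y} 0<y-x = <-resp (+-identityˡ x)
    (solve 2 (λ x y → y :- x :+ x := y) refl x y) (+-monoˡ-< x 0<y-x)

  pos⇒# : ∀ {x} → 0# < x → x # 0#
  pos⇒# 0<x = Equivalence.from #⇔<⊎> (inj₂ 0<x)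

  #⇒pos⊎neg : ∀ {x} → x # 0# → 0# < x ⊎ 0# < - x
  #⇒pos⊎neg {x} x#0 with Equivalence.to #⇔<⊎> x#0
  ... | inj₂ 0<x = inj₁ 0<x
  ... | inj₁ x<0 = inj₂ (<-respʳ-≈ (+-identityˡ (- x)) (x<y⇒0<y-x x<0))

  ¬0<0 : ¬ (0# < 0#)
  ¬0<0 = <-irrefl refl

  #⇒inverse : ∀ {x} → x # 0# → ∃[ r ] r * x ≈ 1#
  #⇒inverse x#0 with #⇒invertible x#0
  ... | r , r*x , _ = r , trans (*-congˡ (sym (x-0≈x _))) r*x

  inverse⇒# : ∀ {x} r → r * x ≈ 1# → x # 0#
  inverse⇒# r r*x = invertibleˡ⇒# (r , trans (*-congˡ (x-0≈x _)) r*x)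

  -- The order is not decidable, so the sign of `x` must come from apartness: an inverse of `a * x`
  -- yields one of `x`, hence a dichotomy, whose negative branch is refuted.
  *-cancelˡ-pos : ∀ {a x} → 0# < a → 0# < a * x → 0# < x
  *-cancelˡ-pos {a} {x} 0<a 0<ax with #⇒inverse (pos⇒# 0<ax)
  ... | r , rax≈1 with #⇒pos⊎neg (inverse⇒# {x} (r * a) (trans (*-assoc _ _ _) rax≈1))
  ...   | inj₁ 0<x  = 0<x
  ...   | inj₂ 0<-x = contradiction (<-respʳ-≈
          (solve 2 (λ a x → a :* x :+ a :* (:- x) := con (+ 0)) refl a x)
          (+-pos 0<ax (*-pos 0<a 0<-x))) ¬0<0

  *-monoˡ-< : ∀ {z x y} → 0# < z → x < y → z * x < z * y
  *-monoˡ-< {z} {x} {y} 0<z x<y = 0<y-x⇒x<y (<-respʳ-≈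
    (solve 3 (λ z x y → z :* (y :- x) := z :* y :- z :* x) refl z x y) (*-pos 0<z (x<y⇒0<y-x x<y)))

  *-cancelˡ-< : ∀ {z x y} → 0# < z → z * x < z * y → x < y
  *-cancelˡ-< {z} {x} {y} 0<z zx<zy = 0<y-x⇒x<y (*-cancelˡ-pos 0<z (<-respʳ-≈
    (solve 3 (λ z x y → z :* y :- z :* x := z :* (y :- x)) refl z x y) (x<y⇒0<y-x zx<zy)))

  inverse-pos : ∀ {a r} → 0# < a → r * a ≈ 1# → 0# < r
  inverse-pos 0<a ra≈1 = *-cancelˡ-pos 0<a (<-respʳ-≈ (sym (trans (*-comm _ _) ra≈1)) 0<1)

  *-cancelˡ-# : ∀ {a x y} → a # 0# → a * x ≈ a * y → x ≈ y
  *-cancelˡ-# {a} {x} {y} a#0 ax≈ay with #⇒inverse a#0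
  ... | r , ra≈1 = begin
    x            ≈⟨ *-identityˡ x ⟨
    1# * x       ≈⟨ *-congʳ ra≈1 ⟨
    r * a * x    ≈⟨ *-assoc r a x ⟩
    r * (a * x)  ≈⟨ *-congˡ ax≈ay ⟩
    r * (a * y)  ≈⟨ *-assoc r a y ⟨
    r * a * y    ≈⟨ *-congʳ ra≈1 ⟩
    1# * y       ≈⟨ *-identityˡ y ⟩
    y            ∎

  -- Tightness: an equation may be proved by contradiction although neither equality nor order is
  -- decided.
  ¬#0⇒≈0 : ∀ {x} → ¬ (x # 0#) → x ≈ 0#
  ¬#0⇒≈0 = proj₁ (tight _ _)

  ≈0⇒¬#0 : ∀ {x} → x ≈ 0# → ¬ (x # 0#)
  ≈0⇒¬#0 = proj₂ (tight _ _)

  fromℕ-pos′ : ∀ n → .{{NonZero n}} → 0# < fromℕ n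
  fromℕ-pos′ (suc n) = fromℕ-pos n

  recip-inverse : ∀ n .{{_ : NonZero n}} → recip n * fromℕ n ≈ 1#
  recip-inverse (suc n) with #⇒invertible (Equivalence.from #⇔<⊎> (inj₂ (fromℕ-pos n)))
  ... | r , r*n , _ = trans (*-congˡ (sym (x-0≈x _))) r*n

  recip-pos : ∀ n .{{_ : NonZero n}} → 0# < recip n
  recip-pos n = inverse-pos (fromℕ-pos′ n) (recip-inverse n)

  fromℕ-mono-< : ∀ {m n} → m ℕ.< n → fromℕ m < fromℕ n
  fromℕ-mono-< {m} m<n with ℕₚ.m≤n⇒∃[o]m+o≡n m<n
  ... | k , ≡.refl = 0<y-x⇒x<y (<-respʳ-≈ (begin
      fromℕ (suc k)                     ≈⟨ solve 2 (λ m k → k := m :+ k :- m) refl _ _ ⟩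
      fromℕ m + fromℕ (suc k) - fromℕ m ≈⟨ +-congʳ (fromℕ-+ m (suc k)) ⟨
      fromℕ (m ℕ.+ suc k) - fromℕ m     ≡⟨ ≡.cong (λ t → fromℕ t - fromℕ m) (ℕₚ.+-suc m k) ⟩
      fromℕ (suc m ℕ.+ k) - fromℕ m ∎) (fromℕ-pos k))

-- Null sequences and uniqueness of limits.

module NullSequences {c ℓ₁ ℓ₂ ℓ₃} (ℝ : CompleteOrderedField c ℓ₁ ℓ₂ ℓ₃) where
  open CompleteOrderedField ℝ hiding (zero)
  open Spectral ℝ
  open IntegerCoefficients ℝ
  open Order ℝ
  open import Relation.Binary.Reasoning.Setoid setoid

  infix 4 _≺_
  -- ∣ x ∣ < e
  _≺_ : Carrier → Carrier → Set ℓ₃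
  x ≺ e = (x < e) × (- x < e)

  ≺-resp : ∀ {x x′ e e′} → x ≈ x′ → e ≈ e′ → x ≺ e → x′ ≺ e′
  ≺-resp x≈ e≈ (x<e , -x<e) = <-resp x≈ e≈ x<e , <-resp (-‿cong x≈) e≈ -x<e

  ≺-<-trans : ∀ {x d e} → x ≺ d → d < e → x ≺ e
  ≺-<-trans (x<d , -x<d) d<e = <-trans x<d d<e , <-trans -x<d d<e

  ≺-+ : ∀ {x y d e} → x ≺ d → y ≺ e → x + y ≺ d + e
  ≺-+ {x} {y} (x<d , -x<d) (y<e , -y<e) = +-mono-< x<d y<e ,
    <-respˡ-≈ (solve 2 (λ x y → :- x :- y := :- (x :+ y)) refl x y) (+-mono-< -x<d -y<e)

  0<2 : 0# < fromℕ 2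
  0<2 = fromℕ-pos 1

  ≺⇒pos : ∀ {x e} → x ≺ e → 0# < e
  ≺⇒pos {x} {e} (x<e , -x<e) = *-cancelˡ-pos 0<2
    (<-resp (-‿inverseʳ x) (solve 1 (λ e → e :+ e := con (+ 2) :* e) refl e) (+-mono-< x<e -x<e))

  pos⇒0≺ : ∀ {e} → 0# < e → 0# ≺ e
  pos⇒0≺ 0<e = 0<e , <-respˡ-≈ (solve 0 (con (+ 0) := :- con (+ 0)) refl) 0<e

  pos⇒≺ : ∀ {x e} → 0# < x → x < e → x ≺ e
  pos⇒≺ {x} 0<x x<e = x<e , <-trans
    (<-resp (+-identityʳ _) (-‿inverseˡ x) (+-monoʳ-< (- x) 0<x)) (<-trans 0<x x<e)

  -- 2(de ∓ xy) = (d ∓ x)(e + y) + (d ± x)(e - y)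
  ≺-* : ∀ {x y d e} → x ≺ d → y ≺ e → x * y ≺ d * e
  ≺-* {x} {y} {d} {e} (x<d , -x<d) (y<e , -y<e) =
      0<y-x⇒x<y (*-cancelˡ-pos 0<2 (<-respʳ-≈
        (solve 4 (λ x y d e → (d :- x) :* (e :- (:- y)) :+ (d :- (:- x)) :* (e :- y) := con (+ 2) :* (d :* e :- x :* y)) refl x y d e)
        (+-pos (*-pos (x<y⇒0<y-x x<d) (x<y⇒0<y-x -y<e)) (*-pos (x<y⇒0<y-x -x<d) (x<y⇒0<y-x y<e)))))
    , 0<y-x⇒x<y (*-cancelˡ-pos 0<2 (<-respʳ-≈
        (solve 4 (λ x y d e → (d :- x) :* (e :- y) :+ (d :- (:- x)) :* (e :- (:- y)) := con (+ 2) :* (d :* e :- (:- (x :* y)))) refl x y d e)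
        (+-pos (*-pos (x<y⇒0<y-x x<d) (x<y⇒0<y-x y<e)) (*-pos (x<y⇒0<y-x -x<d) (x<y⇒0<y-x -y<e)))))

  bound : ∀ x → ∃[ e ] x ≺ e
  bound x with archimedean x | archimedean (- x)
  -- A sum stands in for the maximum of the two bounds; the successors make both summands positive.
  ... | m , x<m | n , -x<n = fromℕ (suc m) + fromℕ (suc n)
    , <-resp (+-identityʳ x) refl (+-mono-< (<-trans x<m (fromℕ-mono-< (ℕₚ.n<1+n m))) (fromℕ-pos n))
    , <-resp (+-identityˡ _) refl (+-mono-< (fromℕ-pos m) (<-trans -x<n (fromℕ-mono-< (ℕₚ.n<1+n n))))

  Null : (ℕ → Carrier) → Set (c ⊔ ℓ₃)
  Null s = ∀ ε → 0# < ε → ∃[ n ] ∀ k → n ℕ.≤ k → s k ≺ ε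

  null-resp : ∀ {s t} → (∀ k → s k ≈ t k) → Null s → Null t
  null-resp s≈t s-null ε 0<ε = let n , s≺ = s-null ε 0<ε in n , λ k n≤k → ≺-resp (s≈t k) refl (s≺ k n≤k)

  divide : ∀ {a ε} → 0# < a → 0# < ε → ∃[ δ ] 0# < δ × a * δ ≈ ε
  divide {a} {ε} 0<a 0<ε with #⇒inverse (pos⇒# 0<a)
  ... | r , ra≈1 = r * ε , *-pos (inverse-pos 0<a ra≈1) 0<ε , (begin
    a * (r * ε)   ≈⟨ solve 3 (λ a r ε → a :* (r :* ε) := r :* a :* ε) refl a r ε ⟩
    r * a * ε     ≈⟨ *-congʳ ra≈1 ⟩
    1# * ε        ≈⟨ *-identityˡ ε ⟩
    ε             ∎)

  null-+ : ∀ {s t} → Null s → Null t → Null (λ k → s k + t k)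
  null-+ s-null t-null ε 0<ε =
    let δ , 0<δ , 2δ≈ε = divide 0<2 0<ε
        m , s≺ = s-null δ 0<δ
        n , t≺ = t-null δ 0<δ
    in m ℕ.+ n , λ k m+n≤k → ≺-resp refl
      (trans (solve 1 (λ δ → δ :+ δ := con (+ 2) :* δ) refl δ) 2δ≈ε)
      (≺-+ (s≺ k (ℕₚ.≤-trans (ℕₚ.m≤m+n m n) m+n≤k)) (t≺ k (ℕₚ.≤-trans (ℕₚ.m≤n+m n m) m+n≤k)))

  bounded*null : ∀ {s t : ℕ → Carrier} B → (∀ k → s k ≺ B) → Null t → Null (λ k → s k * t k)
  bounded*null B s≺B t-null ε 0<ε =
    let δ , 0<δ , Bδ≈ε = divide (≺⇒pos (s≺B 0)) 0<ε
        n , t≺ = t-null δ 0<δ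
    in n , λ k n≤k → ≺-resp refl Bδ≈ε (≺-* (s≺B k) (t≺ k n≤k))

  const*null : ∀ a {s} → Null s → Null (λ k → a * s k)
  const*null a = bounded*null {λ _ → a} (proj₁ (bound a)) (λ _ → proj₂ (bound a))

  null-neg : ∀ {s} → Null s → Null (λ k → - s k)
  null-neg s-null ε 0<ε = let n , s≺ = s-null ε 0<ε in n , λ k n≤k →
    let s<ε , -s<ε = s≺ k n≤k in -s<ε , <-respˡ-≈ (solve 1 (λ x → x := :- (:- x)) refl _) s<ε

  null-suc : ∀ {s} → Null s → Null (s ∘ suc)
  null-suc s-null ε 0<ε = let n , s≺ = s-null ε 0<ε in n , λ k n≤k → s≺ (suc k) (ℕₚ.m≤n⇒m≤1+n n≤k)

  null-bounded : ∀ {s} → Null s → ∃[ B ] ∀ k → s k ≺ B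
  null-bounded {s} s-null with s-null 1# 0<1
  ... | n , s≺1 = from n 1# s s≺1
    where
    -- The terms before the tail are peeled off one at a time, each adding its own bound instead of
    -- taking a maximum.
    from : ∀ n e (s : ℕ → Carrier) → (∀ k → n ℕ.≤ k → s k ≺ e) → ∃[ B ] ∀ k → s k ≺ B
    from zero    e s s≺ = e , λ k → s≺ k ℕ.z≤n
    from (suc n) e s s≺ with from n e (s ∘ suc) (λ k n≤k → s≺ (suc k) (ℕ.s≤s n≤k)) | bound (s 0)
    ... | B , s≺B | b , s0≺b = B + b , λ
      { zero    → ≺-<-trans s0≺b (<-respˡ-≈ (+-identityˡ b) (+-monoˡ-< b (≺⇒pos (s≺B 0))))
      ; (suc k) → ≺-<-trans (s≺B k) (<-respˡ-≈ (+-identityʳ B) (+-monoʳ-< B (≺⇒pos s0≺b))) }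

  null-* : ∀ {s t} → Null s → Null t → Null (λ k → s k * t k)
  null-* {s} s-null t-null = let B , s≺B = null-bounded s-null in bounded*null {s} B s≺B t-null

  const-null⇒≈0 : ∀ {a} → Null (λ _ → a) → a ≈ 0#
  const-null⇒≈0 {a} a-null = ¬#0⇒≈0 λ a#0 → case (#⇒pos⊎neg a#0)
    where
    case : ¬ (0# < a ⊎ 0# < - a)
    case (inj₁ 0<a)  = let n , a≺ = a-null a 0<a in <-irrefl refl (proj₁ (a≺ n ℕₚ.≤-refl))
    case (inj₂ 0<-a) = let n , a≺ = a-null (- a) 0<-a in <-irrefl refl (proj₂ (a≺ n ℕₚ.≤-refl))

  converges⇒null : ∀ {s x} → s ConvergesTo x → Null (λ k → s k - x)
  converges⇒null s→x ε 0<ε = let n , s≺ = s→x ε 0<ε in n , λ k n≤k →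
    let s-x<ε , x-s<ε = s≺ k n≤k in s-x<ε , <-respˡ-≈ (solve 2 (λ x s → x :- s := :- (s :- x)) refl _ _) x-s<ε

  limit-unique : ∀ {s t x y} → s ConvergesTo x → t ConvergesTo y → Null (λ k → s k - t k) → x ≈ y
  limit-unique {s} {t} {x} {y} s→x t→y s-t-null = begin
    x          ≈⟨ solve 2 (λ x y → x := x :- y :+ y) refl x y ⟩
    x - y + y  ≈⟨ +-congʳ (const-null⇒≈0 (null-resp
                    (λ k → solve 4 (λ s t x y → s :- t :+ (:- (s :- x) :+ (t :- y)) := x :- y) refl (s k) (t k) x y)
                    (null-+ s-t-null (null-+ (null-neg (converges⇒null s→x)) (converges⇒null t→y))))) ⟩
    0# + y     ≈⟨ +-identityˡ y ⟩
    y          ∎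

  abstract
    half : Carrier
    half = recip 2

    half*2 : half * fromℕ 2 ≈ 1#
    half*2 = recip-inverse 2

    half-pos : 0# < half
    half-pos = recip-pos 2

  half+half : half + half ≈ 1#
  half+half = trans (solve 1 (λ h → h :+ h := h :* con (+ 2)) refl half) half*2

  half^n-pos : ∀ n → 0# < half ^ n
  half^n-pos zero    = 0<1
  half^n-pos (suc n) = *-pos half-pos (half^n-pos n)

  half<1 : half < 1#
  half<1 = <-resp (+-identityʳ half) half+half (+-monoʳ-< half half-pos)

  half^1+n<1 : ∀ n → half ^ suc n < 1#
  half^1+n<1 zero    = <-respˡ-≈ (sym (*-identityʳ half)) half<1
  half^1+n<1 (suc n) = <-trans (*-monoˡ-< half-pos (half^1+n<1 n)) (<-respˡ-≈ (sym (*-identityʳ half)) half<1)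

  -- Multiplying by `half` and adding `half ^ suc n < 1` preserves the bound, since
  -- `half · 2 + 1 = 2`. It serves twice: to show that `half ^ n` tends to 0, and to absorb a linear
  -- factor.
  1+n*half^n<2 : ∀ n → fromℕ (suc n) * half ^ n < fromℕ 2
  1+n*half^n<2 zero    = <-resp (sym (*-identityʳ _)) refl (fromℕ-mono-< {1} {2} ℕₚ.≤-refl)
  1+n*half^n<2 (suc n) = <-resp
    (solve 3 (λ m h p → h :* (m :* p) :+ h :* p := (con (+ 1) :+ m) :* (h :* p)) refl (fromℕ (suc n)) half (half ^ n))
    (trans (+-congʳ half*2) (+-congˡ (sym (+-identityʳ 1#))))
    (+-mono-< (*-monoˡ-< half-pos (1+n*half^n<2 n)) (half^1+n<1 n))

  1+n*half^n≺2 : ∀ n → fromℕ (suc n) * half ^ n ≺ fromℕ 2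
  1+n*half^n≺2 n = pos⇒≺ (*-pos (fromℕ-pos n) (half^n-pos n)) (1+n*half^n<2 n)

  half^n-null : Null (half ^_)
  half^n-null ε 0<ε =
    -- `δ` is `2/ε`. Beyond an `m` above it, `(k + 1) half^k < 2 = ε δ < (k + 1) ε`, and `k + 1`
    -- cancels.
    let δ , _ , εδ≈2 = divide 0<ε 0<2
        m , δ<m = archimedean δ
        small : ∀ k → m ℕ.≤ k → half ^ k < ε
        small k m≤k = *-cancelˡ-< (fromℕ-pos k) (<-trans (1+n*half^n<2 k)
          (<-resp εδ≈2 (*-comm _ _) (*-monoˡ-< 0<ε (<-trans δ<m (fromℕ-mono-< (ℕ.s≤s m≤k))))))
    in m , λ k m≤k → pos⇒≺ (half^n-pos k) (small k m≤k)

-- Finite sums and Cauchy products of sequences.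

module SequenceSums {c ℓ₁ ℓ₂ ℓ₃} (ℝ : CompleteOrderedField c ℓ₁ ℓ₂ ℓ₃) where
  open CompleteOrderedField ℝ hiding (zero)
  open Spectral ℝ
  open IntegerCoefficients ℝ
  open import Algebra.Properties.Semiring.Sum semiring
    using (sum-cong-≋)
  open import Relation.Binary.Reasoning.Setoid setoid

  Σ< : ℕ → (ℕ → Carrier) → Carrier
  Σ< n f = ∑[ k < n ] f (toℕ k)

  Σ<-cong : ∀ n {f g} → (∀ k → f k ≈ g k) → Σ< n f ≈ Σ< n g
  Σ<-cong n f≈g = sum-cong-≋ {n} (λ k → f≈g (toℕ k))

  Σ<-last : ∀ n f → Σ< (suc n) f ≈ Σ< n f + f n
  Σ<-last zero    f = +-comm _ _
  Σ<-last (suc n) f = trans (+-congˡ (Σ<-last n (f ∘ suc))) (sym (+-assoc _ _ _))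

  Σ<-split : ∀ m n f → Σ< (m ℕ.+ n) f ≈ Σ< m f + Σ< n (λ k → f (m ℕ.+ k))
  Σ<-split zero    n f = sym (+-identityˡ _)
  Σ<-split (suc m) n f = trans (+-congˡ (Σ<-split m n (f ∘ suc))) (sym (+-assoc _ _ _))

  -- The Cauchy product: the sum of `f i * g j` over `i + j = n`.
  conv : (ℕ → Carrier) → (ℕ → Carrier) → ℕ → Carrier
  conv f g zero    = f 0 * g 0
  conv f g (suc n) = f 0 * g (suc n) + conv (f ∘ suc) g n

  conv-cong : ∀ n {f f′ g g′} → (∀ k → f k ≈ f′ k) → (∀ k → g k ≈ g′ k) → conv f g n ≈ conv f′ g′ n
  conv-cong zero    f≈ g≈ = *-cong (f≈ 0) (g≈ 0)
  conv-cong (suc n) f≈ g≈ = +-cong (*-cong (f≈ 0) (g≈ (suc n))) (conv-cong n (f≈ ∘ suc) g≈)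

  conv-linearˡ : ∀ n a f f′ g → conv (λ k → a * f k + f′ k) g n ≈ a * conv f g n + conv f′ g n
  conv-linearˡ zero    a f f′ g =
    solve 4 (λ a x y z → (a :* x :+ y) :* z := a :* (x :* z) :+ y :* z) refl a (f 0) (f′ 0) (g 0)
  conv-linearˡ (suc n) a f f′ g = trans (+-congˡ (conv-linearˡ n a (f ∘ suc) (f′ ∘ suc) g))
    (solve 6 (λ a x y z p q → (a :* x :+ y) :* z :+ (a :* p :+ q) := a :* (x :* z :+ p) :+ (y :* z :+ q)) refl
      a (f 0) (f′ 0) (g (suc n)) _ _)

  conv-linearʳ : ∀ n a f g g′ → conv f (λ k → a * g k + g′ k) n ≈ a * conv f g n + conv f g′ n
  conv-linearʳ zero    a f g g′ =
    solve 4 (λ a x y z → z :* (a :* x :+ y) := a :* (z :* x) :+ z :* y) refl a (g 0) (g′ 0) (f 0)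
  conv-linearʳ (suc n) a f g g′ = trans (+-congˡ (conv-linearʳ n a (f ∘ suc) g g′))
    (solve 6 (λ a x y z p q → z :* (a :* x :+ y) :+ (a :* p :+ q) := a :* (z :* x :+ p) :+ (z :* y :+ q)) refl
      a (g (suc n)) (g′ (suc n)) (f 0) _ _)

  conv-*ˡ : ∀ n a f g → conv (λ k → a * f k) g n ≈ a * conv f g n
  conv-*ˡ zero    a f g = *-assoc _ _ _
  conv-*ˡ (suc n) a f g = trans (+-cong (*-assoc _ _ _) (conv-*ˡ n a (f ∘ suc) g)) (sym (distribˡ _ _ _))

  conv-*ʳ : ∀ n a f g → conv f (λ k → a * g k) n ≈ a * conv f g n
  conv-*ʳ zero    a f g = solve 3 (λ a x y → x :* (a :* y) := a :* (x :* y)) refl a _ _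
  conv-*ʳ (suc n) a f g = trans (+-congˡ (conv-*ʳ n a (f ∘ suc) g))
    (solve 4 (λ a x y z → x :* (a :* y) :+ a :* z := a :* (x :* y :+ z)) refl a _ _ _)

  conv-last : ∀ n f g → conv f g (suc n) ≈ conv f (g ∘ suc) n + f (suc n) * g 0
  conv-last zero    f g = refl
  conv-last (suc n) f g = trans (+-congˡ (conv-last n (f ∘ suc) g)) (sym (+-assoc _ _ _))

  conv-^ : ∀ n a f g → conv (λ k → a ^ k * f k) (λ k → a ^ k * g k) n ≈ a ^ n * conv f g n
  conv-^ zero    a f g = solve 2 (λ x y → con (+ 1) :* x :* (con (+ 1) :* y) := con (+ 1) :* (x :* y)) refl _ _
  conv-^ (suc n) a f g = begin
    1# * f 0 * (a * a ^ n * g (suc n)) + conv (λ k → a * a ^ k * f (suc k)) (λ k → a ^ k * g k) n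
      ≈⟨ +-congˡ (trans (conv-cong n {g = λ k → a ^ k * g k} (λ k → *-assoc a (a ^ k) (f (suc k))) (λ _ → refl))
           (conv-*ˡ n a (λ k → a ^ k * f (suc k)) (λ k → a ^ k * g k))) ⟩
    1# * f 0 * (a * a ^ n * g (suc n)) + a * conv (λ k → a ^ k * f (suc k)) (λ k → a ^ k * g k) n
      ≈⟨ +-congˡ (*-congˡ (conv-^ n a (f ∘ suc) g)) ⟩
    1# * f 0 * (a * a ^ n * g (suc n)) + a * (a ^ n * conv (f ∘ suc) g n)
      ≈⟨ solve 5 (λ a p x y z → con (+ 1) :* x :* (a :* p :* y) :+ a :* (p :* z) := a :* p :* (x :* y :+ z)) refl
           a (a ^ n) (f 0) (g (suc n)) _ ⟩
    a * a ^ n * (f 0 * g (suc n) + conv (f ∘ suc) g n) ∎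

  -- The operator `x d/dx` on the coefficients of a power series.
  weighted : (ℕ → Carrier) → ℕ → Carrier
  weighted f k = fromℕ k * f k

  -- The Leibniz rule for `x d/dx`: in a term with indices `i` and `j`, the factor `n` splits as
  -- `i + j`.
  conv-leibniz : ∀ n f g → fromℕ n * conv f g n ≈ conv (weighted f) g n + conv f (weighted g) n
  conv-leibniz zero    f g =
    solve 2 (λ x y → con (+ 0) :* (x :* y) := con (+ 0) :* x :* y :+ x :* (con (+ 0) :* y)) refl (f 0) (g 0)
  conv-leibniz (suc n) f g = begin
    (1# + fromℕ n) * (f 0 * g (suc n) + X)
      ≈⟨ solve 4 (λ m x y X → (con (+ 1) :+ m) :* (x :* y :+ X) := x :* ((con (+ 1) :+ m) :* y) :+ X :+ m :* X) refl
           (fromℕ n) (f 0) (g (suc n)) X ⟩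
    f 0 * ((1# + fromℕ n) * g (suc n)) + X + fromℕ n * X
      ≈⟨ +-congˡ (conv-leibniz n (f ∘ suc) g) ⟩
    f 0 * ((1# + fromℕ n) * g (suc n)) + X + (conv (weighted (f ∘ suc)) g n + Q)
      ≈⟨ solve 6 (λ x y X P Q z → x :* y :+ X :+ (P :+ Q) := con (+ 0) :* x :* z :+ (con (+ 1) :* X :+ P) :+ (x :* y :+ Q)) refl
           (f 0) ((1# + fromℕ n) * g (suc n)) X _ Q (g (suc n)) ⟩
    0# * f 0 * g (suc n) + (1# * X + conv (weighted (f ∘ suc)) g n) + (f 0 * ((1# + fromℕ n) * g (suc n)) + Q)
      ≈⟨ +-congʳ (+-congˡ (conv-linearˡ n 1# (f ∘ suc) (weighted (f ∘ suc)) g)) ⟨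
    0# * f 0 * g (suc n) + conv (λ k → 1# * f (suc k) + fromℕ k * f (suc k)) g n + (f 0 * ((1# + fromℕ n) * g (suc n)) + Q)
      ≈⟨ +-congʳ (+-congˡ (conv-cong n {g = g} (λ k → distribʳ (f (suc k)) 1# (fromℕ k)) (λ _ → refl))) ⟨
    0# * f 0 * g (suc n) + conv (weighted f ∘ suc) g n + (f 0 * ((1# + fromℕ n) * g (suc n)) + Q) ∎
    where
    X = conv (f ∘ suc) g n
    Q = conv (f ∘ suc) (weighted g) n

  double : ℕ → ℕ
  double zero    = zero
  double (suc k) = suc (suc (double k))

  double≡2* : ∀ k → double k ≡ 2 ℕ.* k
  double≡2* zero    = ≡.refl
  double≡2* (suc k) = ≡.cong suc (≡.trans (≡.cong suc (double≡2* k)) (≡.sym (ℕₚ.+-suc k (k ℕ.+ 0))))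

  -- In even degree the two indices have equal parity, so the vanishing of `g` at odd indices
  -- removes every odd pair.
  conv-even : ∀ k f g → (∀ j → g (suc (double j)) ≈ 0#) →
              conv f g (double k) ≈ conv (f ∘ double) (g ∘ double) k
  conv-even zero    f g odd≈0 = refl
  conv-even (suc k) f g odd≈0 = +-congˡ (begin
    f 1 * g (suc (double k)) + conv (λ j → f (suc (suc j))) g (double k)
      ≈⟨ +-cong (trans (*-congˡ (odd≈0 k)) (zeroʳ _)) (conv-even k (λ j → f (suc (suc j))) g odd≈0) ⟩
    0# + conv (f ∘ double ∘ suc) (g ∘ double) k
      ≈⟨ +-identityˡ _ ⟩
    conv (f ∘ double ∘ suc) (g ∘ double) k ∎)

  -- Σ_{i < n} f(i) Σ_{j < n - i} g(j)
  triangle : (ℕ → Carrier) → (ℕ → Carrier) → ℕ → Carrier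
  triangle f g zero    = 0#
  triangle f g (suc n) = f 0 * Σ< (suc n) g + triangle (f ∘ suc) g n

  -- The triangle grows by one antidiagonal, so it is the partial sum of the Cauchy product series.
  triangle-suc : ∀ n f g → triangle f g (suc n) ≈ triangle f g n + conv f g n
  triangle-suc zero    f g = solve 2 (λ x y → x :* (y :+ con (+ 0)) :+ con (+ 0) := con (+ 0) :+ x :* y) refl _ _
  triangle-suc (suc n) f g = begin
    f 0 * Σ< (suc (suc n)) g + triangle (f ∘ suc) g (suc n)
      ≈⟨ +-cong (*-congˡ (Σ<-last (suc n) g)) (triangle-suc n (f ∘ suc) g) ⟩
    f 0 * (Σ< (suc n) g + g (suc n)) + (triangle (f ∘ suc) g n + conv (f ∘ suc) g n)
      ≈⟨ solve 5 (λ x S y t z → x :* (S :+ y) :+ (t :+ z) := x :* S :+ t :+ (x :* y :+ z)) refl _ _ _ _ _ ⟩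
    triangle f g (suc n) + conv f g (suc n) ∎

-- The terms of the exponential and cosine series.

module CosineSeries {c ℓ₁ ℓ₂ ℓ₃} (ℝ : CompleteOrderedField c ℓ₁ ℓ₂ ℓ₃) where
  open CompleteOrderedField ℝ hiding (zero)
  open Spectral ℝ
  open IntegerCoefficients ℝ
  open Order ℝ
  open SequenceSums ℝ
  open import Relation.Binary.Reasoning.Setoid setoid

  recip! : ℕ → Carrier
  recip! k = recip (k !) {{k ℕₚ.!≢0}}

  recip!-suc : ∀ k → fromℕ (suc k) * recip! (suc k) ≈ recip! k
  recip!-suc k = *-cancelˡ-# (pos⇒# (fromℕ-pos′ (k !) {{k ℕₚ.!≢0}})) (begin
    fromℕ (k !) * (fromℕ (suc k) * recip! (suc k))
      ≈⟨ solve 3 (λ x y z → x :* (y :* z) := z :* (y :* x)) refl (fromℕ (k !)) (fromℕ (suc k)) _ ⟩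
    recip! (suc k) * (fromℕ (suc k) * fromℕ (k !))
      ≈⟨ *-congˡ (fromℕ-* (suc k) (k !)) ⟨
    recip! (suc k) * fromℕ (suc k !)
      ≈⟨ recip-inverse (suc k !) {{suc k ℕₚ.!≢0}} ⟩
    1#
      ≈⟨ recip-inverse (k !) {{k ℕₚ.!≢0}} ⟨
    recip! k * fromℕ (k !)
      ≈⟨ *-comm _ _ ⟩
    fromℕ (k !) * recip! k ∎)

  expTerm : Carrier → ℕ → Carrier
  expTerm x k = x ^ k * recip! k

  weighted-expTerm : ∀ x k → weighted (expTerm x) (suc k) ≈ x * expTerm x k
  weighted-expTerm x k = trans
    (solve 4 (λ m x p r → m :* (x :* p :* r) := x :* (p :* (m :* r))) refl (fromℕ (suc k)) x (x ^ k) (recip! (suc k)))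
    (*-congˡ (*-congˡ (recip!-suc k)))

  -- Both sides satisfy `(n + 1) t(n + 1) = (a + b) t(n)`, the left one by the Leibniz rule, since
  -- `weighted` turns `expTerm a` into `a` times its shift. This avoids binomial coefficients.
  expTerm-+ : ∀ a b n → conv (expTerm a) (expTerm b) n ≈ expTerm (a + b) n
  expTerm-+ a b zero    = trans (*-congˡ (trans (*-congˡ r≈1) (*-identityʳ _))) (*-identityʳ _)
    where
    r≈1 : recip! 0 ≈ 1#
    r≈1 = trans (solve 1 (λ r → r := r :* (con (+ 1) :+ con (+ 0))) refl (recip! 0)) (recip-inverse 1)
  expTerm-+ a b (suc n) = *-cancelˡ-# (pos⇒# (fromℕ-pos n)) (begin
    fromℕ (suc n) * conv A B (suc n)
      ≈⟨ conv-leibniz (suc n) A B ⟩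
    0# * A 0 * B (suc n) + conv (weighted A ∘ suc) B n + conv A (weighted B) (suc n)
      ≈⟨ +-cong
           (+-congˡ (trans (conv-cong n {g = B} (weighted-expTerm a) (λ _ → refl)) (conv-*ˡ n a A B)))
           (trans (conv-last n A (weighted B))
             (+-congʳ (trans (conv-cong n {f = A} (λ _ → refl) (weighted-expTerm b)) (conv-*ʳ n b A B)))) ⟩
    0# * A 0 * B (suc n) + a * conv A B n + (b * conv A B n + A (suc n) * (0# * B 0))
      ≈⟨ solve 7 (λ x y a z b u v → con (+ 0) :* x :* y :+ a :* z :+ (b :* z :+ u :* (con (+ 0) :* v)) := (a :+ b) :* z) refl
           (A 0) (B (suc n)) a (conv A B n) b (A (suc n)) (B 0) ⟩
    (a + b) * conv A B n
      ≈⟨ *-congˡ (expTerm-+ a b n) ⟩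
    (a + b) * expTerm (a + b) n
      ≈⟨ weighted-expTerm (a + b) n ⟨
    fromℕ (suc n) * expTerm (a + b) (suc n) ∎)
    where
    A = expTerm a
    B = expTerm b

  cosTerm≈ : ∀ x k → cosTerm x k ≈ (- 1#) ^ k * expTerm x (double k)
  cosTerm≈ x k = trans (*-assoc _ _ _) (*-congˡ (reflexive (≡.cong (expTerm x) (≡.sym (double≡2* k)))))

  -‿^-double : ∀ x k → (- x) ^ double k ≈ x ^ double k
  -‿^-double x zero    = refl
  -‿^-double x (suc k) = trans (*-congˡ (*-congˡ (-‿^-double x k)))
    (solve 2 (λ x p → (:- x) :* ((:- x) :* p) := x :* (x :* p)) refl x _)

  -- The sum of `expTerm b` and `expTerm (- b)` has only even terms, so in even degree its product
  -- with `expTerm a` reduces to the even terms of both factors.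
  cosTerm-dAlembert : ∀ a b k →
    cosTerm (a + b) k + cosTerm (a - b) k ≈ fromℕ 2 * conv (cosTerm a) (cosTerm b) k
  cosTerm-dAlembert a b k = begin
    cosTerm (a + b) k + cosTerm (a - b) k
      ≈⟨ +-cong (cosTerm≈ (a + b) k) (cosTerm≈ (a - b) k) ⟩
    σ * expTerm (a + b) (double k) + σ * expTerm (a - b) (double k)
      ≈⟨ +-cong (*-congˡ (expTerm-+ a b (double k))) (*-congˡ (expTerm-+ a (- b) (double k))) ⟨
    σ * conv A B (double k) + σ * conv A B⁻ (double k)
      ≈⟨ solve 3 (λ s x y → s :* x :+ s :* y := s :* (con (+ 1) :* x :+ y)) refl σ _ _ ⟩
    σ * (1# * conv A B (double k) + conv A B⁻ (double k))
      ≈⟨ *-congˡ (conv-linearʳ (double k) 1# A B B⁻) ⟨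
    σ * conv A (λ j → 1# * B j + B⁻ j) (double k)
      ≈⟨ *-congˡ (conv-even k A (λ j → 1# * B j + B⁻ j) odd) ⟩
    σ * conv (A ∘ double) (λ j → 1# * B (double j) + B⁻ (double j)) k
      ≈⟨ *-congˡ (trans (conv-cong k {f = A ∘ double} (λ _ → refl) even) (conv-*ʳ k (fromℕ 2) _ (B ∘ double))) ⟩
    σ * (fromℕ 2 * conv (A ∘ double) (B ∘ double) k)
      ≈⟨ solve 3 (λ s t x → s :* (t :* x) := t :* (s :* x)) refl σ (fromℕ 2) _ ⟩
    fromℕ 2 * (σ * conv (A ∘ double) (B ∘ double) k)
      ≈⟨ *-congˡ (conv-^ k (- 1#) (A ∘ double) (B ∘ double)) ⟨
    fromℕ 2 * conv (λ j → (- 1#) ^ j * A (double j)) (λ j → (- 1#) ^ j * B (double j)) k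
      ≈⟨ *-congˡ (conv-cong k (cosTerm≈ a) (cosTerm≈ b)) ⟨
    fromℕ 2 * conv (cosTerm a) (cosTerm b) k ∎
    where
    σ  = (- 1#) ^ k
    A  = expTerm a
    B  = expTerm b
    B⁻ = expTerm (- b)
    odd : ∀ j → 1# * B (suc (double j)) + B⁻ (suc (double j)) ≈ 0#
    odd j = trans (+-congˡ (*-congʳ (*-congˡ (-‿^-double b j))))
      (solve 3 (λ b p r → con (+ 1) :* (b :* p :* r) :+ (:- b) :* p :* r := con (+ 0)) refl b _ _)
    even : ∀ j → 1# * B (double j) + B⁻ (double j) ≈ fromℕ 2 * B (double j)
    even j = trans (+-congˡ (*-congʳ (-‿^-double b j)))
      (solve 1 (λ x → con (+ 1) :* x :+ x := con (+ 2) :* x) refl _)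

  cosSum : Carrier → ℕ → Carrier
  cosSum x n = Σ< n (cosTerm x)

  -- Exact before any limit, but with the triangular partial product in place of the product of the
  -- two partial sums; the discrepancy is estimated separately.
  cosSum-dAlembert : ∀ a b n →
    cosSum (a + b) n + cosSum (a - b) n ≈ fromℕ 2 * triangle (cosTerm a) (cosTerm b) n
  cosSum-dAlembert a b zero    = solve 0 (con (+ 0) :+ con (+ 0) := con (+ 2) :* con (+ 0)) refl
  cosSum-dAlembert a b (suc n) = begin
    cosSum (a + b) (suc n) + cosSum (a - b) (suc n)
      ≈⟨ +-cong (Σ<-last n (cosTerm (a + b))) (Σ<-last n (cosTerm (a - b))) ⟩
    cosSum (a + b) n + cosTerm (a + b) n + (cosSum (a - b) n + cosTerm (a - b) n)
      ≈⟨ solve 4 (λ x y z w → x :+ y :+ (z :+ w) := x :+ z :+ (y :+ w)) refl _ _ _ _ ⟩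
    cosSum (a + b) n + cosSum (a - b) n + (cosTerm (a + b) n + cosTerm (a - b) n)
      ≈⟨ +-cong (cosSum-dAlembert a b n) (cosTerm-dAlembert a b n) ⟩
    fromℕ 2 * triangle (cosTerm a) (cosTerm b) n + fromℕ 2 * conv (cosTerm a) (cosTerm b) n
      ≈⟨ distribˡ _ _ _ ⟨
    fromℕ 2 * (triangle (cosTerm a) (cosTerm b) n + conv (cosTerm a) (cosTerm b) n)
      ≈⟨ *-congˡ (triangle-suc n (cosTerm a) (cosTerm b)) ⟨
    fromℕ 2 * triangle (cosTerm a) (cosTerm b) (suc n) ∎

-- Geometric bounds on the difference between square and triangular partial products.

module GeometricBounds {c ℓ₁ ℓ₂ ℓ₃} (ℝ : CompleteOrderedField c ℓ₁ ℓ₂ ℓ₃) where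
  open CompleteOrderedField ℝ hiding (zero)
  open Spectral ℝ
  open IntegerCoefficients ℝ
  open Order ℝ
  open NullSequences ℝ
  open SequenceSums ℝ
  open import Algebra.Properties.Semiring.Exp semiring using (^-homo-*)
  open import Relation.Binary.Reasoning.Setoid setoid

  -- The ratio is the square of `half` because the cosine series has only even powers: halving the
  -- argument scales the `k`-th term by `half ^ 2k`.
  q : Carrier
  q = half * half

  q*4 : q * fromℕ 4 ≈ 1#
  q*4 = trans (solve 1 (λ h → h :* h :* con (+ 4) := (h :* con (+ 2)) :* (h :* con (+ 2))) refl half)
    (trans (*-cong half*2 half*2) (*-identityˡ 1#))

  q-pos : 0# < q
  q-pos = *-pos half-pos half-pos

  q^n-pos : ∀ n → 0# < q ^ n
  q^n-pos zero    = 0<1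
  q^n-pos (suc n) = *-pos q-pos (q^n-pos n)

  q^n≈half^n*half^n : ∀ n → q ^ n ≈ half ^ n * half ^ n
  q^n≈half^n*half^n zero    = sym (*-identityˡ 1#)
  q^n≈half^n*half^n (suc n) = trans (*-congˡ (q^n≈half^n*half^n n))
    (solve 2 (λ h p → h :* h :* (p :* p) := h :* p :* (h :* p)) refl half (half ^ n))

  abstract
    -- Σ_k 4⁻ᵏ = 4 / 3
    4/3 : Carrier
    4/3 = proj₁ (divide (fromℕ-pos 2) (fromℕ-pos 3))

    4/3-pos : 0# < 4/3
    4/3-pos = proj₁ (proj₂ (divide (fromℕ-pos 2) (fromℕ-pos 3)))

    3*4/3 : fromℕ 3 * 4/3 ≈ fromℕ 4
    3*4/3 = proj₂ (proj₂ (divide (fromℕ-pos 2) (fromℕ-pos 3)))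

  1+q*4/3 : 1# + q * 4/3 ≈ 4/3
  1+q*4/3 = begin
    1# + q * 4/3               ≈⟨ +-congʳ q*4 ⟨
    q * fromℕ 4 + q * 4/3      ≈⟨ +-congʳ (*-congˡ 3*4/3) ⟨
    q * (fromℕ 3 * 4/3) + q * 4/3  ≈⟨ solve 2 (λ q r → q :* (con (+ 3) :* r) :+ q :* r := q :* con (+ 4) :* r) refl q 4/3 ⟩
    q * fromℕ 4 * 4/3          ≈⟨ *-congʳ q*4 ⟩
    1# * 4/3                   ≈⟨ *-identityˡ 4/3 ⟩
    4/3                        ∎

  geometric⇒pos : ∀ {B} {f : ℕ → Carrier} → (∀ k → f k ≺ B * q ^ k) → 0# < B
  geometric⇒pos f≺ = <-respʳ-≈ (*-identityʳ _) (≺⇒pos (f≺ 0))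

  geometric-shift : ∀ {B} {f : ℕ → Carrier} k → (∀ j → f j ≺ B * q ^ j) →
                    ∀ j → f (k ℕ.+ j) ≺ B * q ^ k * q ^ j
  geometric-shift k f≺ j = ≺-resp refl
    (trans (*-congˡ (^-homo-* q k j)) (sym (*-assoc _ _ _))) (f≺ (k ℕ.+ j))

  geometric-suc : ∀ {B} {f : ℕ → Carrier} → (∀ j → f j ≺ B * q ^ j) →
                  ∀ j → f (suc j) ≺ B * q * q ^ j
  geometric-suc f≺ j = ≺-resp refl (sym (*-assoc _ _ _)) (f≺ (suc j))

  geometric-Σ< : ∀ n B f → (∀ k → f k ≺ B * q ^ k) → Σ< n f ≺ B * 4/3
  geometric-Σ< zero    B f f≺ = pos⇒0≺ (*-pos (geometric⇒pos f≺) 4/3-pos)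
  geometric-Σ< (suc n) B f f≺ = ≺-resp refl (begin
    B * 1# + B * q * 4/3   ≈⟨ solve 3 (λ B q r → B :* con (+ 1) :+ B :* q :* r := B :* (con (+ 1) :+ q :* r)) refl B q 4/3 ⟩
    B * (1# + q * 4/3)     ≈⟨ *-congˡ 1+q*4/3 ⟩
    B * 4/3                ∎)
    (≺-+ (f≺ 0) (geometric-Σ< n (B * q) (f ∘ suc) (geometric-suc f≺)))

  geometric-tail : ∀ {m n} B f → (∀ k → f k ≺ B * q ^ k) → m ℕ.≤ n →
                   Σ< n f - Σ< m f ≺ B * 4/3 * q ^ m
  geometric-tail {m} B f f≺ m≤n with ℕₚ.m≤n⇒∃[o]m+o≡n m≤n
  ... | p , ≡.refl = ≺-resp
    (sym (trans (+-congʳ (Σ<-split m p f)) (solve 2 (λ x y → x :+ y :- x := y) refl _ _)))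
    (solve 3 (λ B p r → B :* p :* r := B :* r :* p) refl B (q ^ m) 4/3)
    (geometric-Σ< p (B * q ^ m) (λ j → f (m ℕ.+ j)) (geometric-shift m f≺))

  -- The difference is the sum over `i < n` of `f i` times the remainder `G - Σ< (n - i) g`, and
  -- each summand is below `A q^i · C q^(n - i)`. There are `n` summands; the extra one in `suc n`
  -- keeps the bound strict for the empty sum.
  square-triangle : ∀ n A C f g G → (∀ k → f k ≺ A * q ^ k) →
    (∀ k → k ℕ.≤ n → G - Σ< k g ≺ C * q ^ k) →
    Σ< n f * G - triangle f g n ≺ fromℕ (suc n) * (A * C * q ^ n)
  square-triangle zero    A C f g G f≺ G≺ = ≺-resp
    (solve 1 (λ x → con (+ 0) := con (+ 0) :* x :- con (+ 0)) refl G)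
    (solve 1 (λ x → x := (con (+ 1) :+ con (+ 0)) :* (x :* con (+ 1))) refl (A * C))
    (pos⇒0≺ (*-pos (geometric⇒pos f≺) (<-respʳ-≈ (*-identityʳ C) (≺⇒pos (G≺ 0 ℕ.z≤n)))))
  square-triangle (suc n) A C f g G f≺ G≺ = ≺-resp
    (solve 5 (λ x G S y t → x :* (G :- S) :+ (y :* G :- t) := (x :+ y) :* G :- (x :* S :+ t)) refl (f 0) G _ _ _)
    (solve 5 (λ A C q p m → A :* con (+ 1) :* (C :* (q :* p)) :+ m :* (A :* q :* C :* p)
                         := (con (+ 1) :+ m) :* (A :* C :* (q :* p))) refl A C q (q ^ n) (fromℕ (suc n)))
    (≺-+ (≺-* (f≺ 0) (G≺ (suc n) ℕₚ.≤-refl))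
      (square-triangle n (A * q) C (f ∘ suc) g G (geometric-suc f≺) (λ k k≤n → G≺ k (ℕₚ.m≤n⇒m≤1+n k≤n))))

  -- Of the two factors in `q ^ n = half ^ n * half ^ n`, one absorbs `n + 1` and the other tends to
  -- 0.
  square-triangle-null : ∀ A B f g → (∀ k → f k ≺ A * q ^ k) → (∀ k → g k ≺ B * q ^ k) →
                         Null (λ n → Σ< n f * Σ< n g - triangle f g n)
  square-triangle-null A B f g f≺ g≺ = null-≺
    (λ n → square-triangle n A (B * 4/3) f g (Σ< n g) f≺ (λ k k≤n → geometric-tail B g g≺ k≤n))
    (null-resp
      (λ n → trans (solve 3 (λ K m h → K :* (m :* h :* h) := m :* (K :* (h :* h))) refl
                     (A * (B * 4/3)) (fromℕ (suc n)) (half ^ n))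
                   (*-congˡ (*-congˡ (sym (q^n≈half^n*half^n n)))))
      (const*null (A * (B * 4/3)) (bounded*null (fromℕ 2) 1+n*half^n≺2 half^n-null)))
    where
    null-≺ : ∀ {s u : ℕ → Carrier} → (∀ n → s n ≺ u n) → Null u → Null s
    null-≺ s≺u u-null ε 0<ε = let n , u≺ = u-null ε 0<ε in
      n , λ k n≤k → ≺-<-trans (s≺u k) (proj₁ (u≺ k n≤k))

-- The cosine function and d'Alembert's equation.

module Cosine {c ℓ₁ ℓ₂ ℓ₃} (ℝ : CompleteOrderedField c ℓ₁ ℓ₂ ℓ₃)
  (cos : CompleteOrderedField.Carrier ℝ → CompleteOrderedField.Carrier ℝ)
  (isCos : Spectral.IsCos ℝ cos) where
  open CompleteOrderedField ℝ hiding (zero)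
  open Spectral ℝ
  open IntegerCoefficients ℝ
  open Order ℝ
  open NullSequences ℝ
  open SequenceSums ℝ
  open CosineSeries ℝ
  open GeometricBounds ℝ
  open import Algebra.Properties.Semiring.Exp semiring using (^-congˡ)
  open import Relation.Binary.Reasoning.Setoid setoid

  cosTerm-cong : ∀ {x y} → x ≈ y → ∀ k → cosTerm x k ≈ cosTerm y k
  cosTerm-cong x≈y k = *-congʳ (*-congˡ (^-congˡ (2 ℕ.* k) x≈y))

  cosSum-null : ∀ x → Null (λ n → cosSum x n - cos x)
  cosSum-null x = converges⇒null {cosSum x} (isCos x)

  null-0 : ∀ {s : ℕ → Carrier} → (∀ k → s k ≈ 0#) → Null s
  null-0 s≈0 ε 0<ε = 0 , λ k _ → ≺-resp (sym (s≈0 k)) refl (pos⇒0≺ 0<ε)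

  -- `cos` is an arbitrary function satisfying `IsCos`; its compatibility with `≈` follows because
  -- equal arguments have equal partial sums and limits are unique.
  cos-cong : ∀ {x y} → x ≈ y → cos x ≈ cos y
  cos-cong {x} {y} x≈y = limit-unique (isCos x) (isCos y)
    (null-0 λ n → trans (+-congʳ (Σ<-cong n (cosTerm-cong x≈y))) (-‿inverseʳ _))

  cos-0 : cos 0# ≈ 1#
  cos-0 = limit-unique (isCos 0#) const→1 (null-0-suc λ n → begin
    cosTerm 0# 0 + Σ< n (cosTerm 0# ∘ suc) - 1#
      ≈⟨ +-congʳ (+-cong
           (trans (solve 1 (λ r → con (+ 1) :* con (+ 1) :* r := r :* (con (+ 1) :+ con (+ 0))) refl (recip 1)) (recip-inverse 1))
           (trans (Σ<-cong n {cosTerm 0# ∘ suc} {λ _ → 0#} cosTerm-0) (Σ<-0 n))) ⟩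
    1# + 0# - 1#
      ≈⟨ solve 0 (con (+ 1) :+ con (+ 0) :- con (+ 1) := con (+ 0)) refl ⟩
    0# ∎)
    where
    const→1 : (λ _ → 1#) ConvergesTo 1#
    const→1 ε 0<ε = 0 , λ _ _ → let 1-1<ε = <-respˡ-≈ (sym (-‿inverseʳ 1#)) 0<ε in 1-1<ε , 1-1<ε
    null-0-suc : ∀ {s : ℕ → Carrier} → (∀ k → s (suc k) ≈ 0#) → Null s
    -- The threshold is 1, since the empty partial sum is 0 and not 1.
    null-0-suc s≈0 ε 0<ε = 1 , λ { (suc k) _ → ≺-resp (sym (s≈0 k)) refl (pos⇒0≺ 0<ε) }
    cosTerm-0 : ∀ k → cosTerm 0# (suc k) ≈ 0#
    cosTerm-0 k = trans (*-congʳ (trans (*-congˡ (zeroˡ (0# ^ (k ℕ.+ 1 ℕ.* suc k)))) (zeroʳ ((- 1#) ^ suc k)))) (zeroˡ (recip! (2 ℕ.* suc k)))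
    Σ<-0 : ∀ n → Σ< n (λ _ → 0#) ≈ 0#
    Σ<-0 zero    = refl
    Σ<-0 (suc n) = trans (+-identityˡ _) (Σ<-0 n)

  cosTerm-null : ∀ x → Null (cosTerm x)
  cosTerm-null x = null-resp
    (λ n → begin
      cosSum x (suc n) - cos x + - (cosSum x n - cos x)
        ≈⟨ +-congʳ (+-congʳ (Σ<-last n (cosTerm x))) ⟩
      cosSum x n + cosTerm x n - cos x + - (cosSum x n - cos x)
        ≈⟨ solve 3 (λ S t y → S :+ t :- y :- (S :- y) := t) refl (cosSum x n) (cosTerm x n) (cos x) ⟩
      cosTerm x n ∎)
    (null-+ (null-suc (cosSum-null x)) (null-neg (cosSum-null x)))

  cosTerm-half : ∀ x k → cosTerm (half * x) k ≈ q ^ k * cosTerm x k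
  cosTerm-half x k = begin
    cosTerm (half * x) k
      ≈⟨ cosTerm≈ (half * x) k ⟩
    (- 1#) ^ k * ((half * x) ^ double k * recip! (double k))
      ≈⟨ *-congˡ (*-congʳ (half^double k)) ⟩
    (- 1#) ^ k * (q ^ k * x ^ double k * recip! (double k))
      ≈⟨ solve 4 (λ s q x r → s :* (q :* x :* r) := q :* (s :* (x :* r))) refl _ (q ^ k) _ _ ⟩
    q ^ k * ((- 1#) ^ k * expTerm x (double k))
      ≈⟨ *-congˡ (cosTerm≈ x k) ⟨
    q ^ k * cosTerm x k ∎
    where
    half^double : ∀ k → (half * x) ^ double k ≈ q ^ k * x ^ double k
    half^double zero    = sym (*-identityˡ 1#)
    half^double (suc k) = trans (*-congˡ (*-congˡ (half^double k)))
      (solve 4 (λ h x p y → h :* x :* (h :* x :* (p :* y)) := h :* h :* p :* (x :* (x :* y))) refl half x _ _)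

  -- The terms at 2x tend to 0, being differences of partial sums, so they are bounded.
  cosTerm-geometric : ∀ x → ∃[ B ] ∀ k → cosTerm x k ≺ B * q ^ k
  cosTerm-geometric x = let B , t≺B = null-bounded (cosTerm-null (x + x)) in
    B , λ k → ≺-resp
      (sym (trans (cosTerm-cong x≈ k) (cosTerm-half (x + x) k)))
      (*-comm _ _)
      (≺-scale (q^n-pos k) (t≺B k))
    where
    x≈ : x ≈ half * (x + x)
    x≈ = trans (trans (sym (*-identityˡ x)) (*-congʳ (sym half+half)))
      (solve 2 (λ h x → (h :+ h) :* x := h :* (x :+ x)) refl half x)
    ≺-scale : ∀ {a y e} → 0# < a → y ≺ e → a * y ≺ a * e
    ≺-scale 0<a (y<e , -y<e) = *-monoˡ-< 0<a y<e ,
      <-respˡ-≈ (solve 2 (λ a y → a :* (:- y) := :- (a :* y)) refl _ _) (*-monoˡ-< 0<a -y<e)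

  -- The defect is a constant exhibited as a sum of null sequences: the errors of the two partial
  -- cosine sums and that of the triangular product.
  dAlembert : ∀ a b → cos (a + b) + cos (a - b) ≈ fromℕ 2 * (cos a * cos b)
  dAlembert a b = begin
    cos (a + b) + cos (a - b)
      ≈⟨ solve 2 (λ x y → x := x :- y :+ y) refl _ (fromℕ 2 * (cos a * cos b)) ⟩
    cos (a + b) + cos (a - b) - fromℕ 2 * (cos a * cos b) + fromℕ 2 * (cos a * cos b)
      ≈⟨ +-congʳ (const-null⇒≈0 difference-null) ⟩
    0# + fromℕ 2 * (cos a * cos b)
      ≈⟨ +-identityˡ _ ⟩
    fromℕ 2 * (cos a * cos b) ∎
    where
    x = cos a
    y = cos b

    product-null : Null (λ n → cosSum a n * cosSum b n - x * y)
    product-null = null-resp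
      (λ n → solve 4 (λ s t x y → (s :- x) :* (t :- y) :+ (x :* (t :- y) :+ y :* (s :- x)) := s :* t :- x :* y) refl
               (cosSum a n) (cosSum b n) x y)
      (null-+ (null-* (cosSum-null a) (cosSum-null b))
        (null-+ (const*null x (cosSum-null b)) (const*null y (cosSum-null a))))

    triangle-null : Null (λ n → x * y - triangle (cosTerm a) (cosTerm b) n)
    triangle-null = null-resp
      (λ n → solve 3 (λ u v t → u :- t :- (u :- v) := v :- t) refl (cosSum a n * cosSum b n) (x * y) _)
      (null-+
        (let A , a≺ = cosTerm-geometric a
             B , b≺ = cosTerm-geometric b
         in square-triangle-null A B (cosTerm a) (cosTerm b) a≺ b≺)
        (null-neg product-null))

    difference-null : Null (λ _ → cos (a + b) + cos (a - b) - fromℕ 2 * (x * y))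
    difference-null = null-resp
      (λ n → begin
        - (cosSum (a + b) n - cos (a + b)) + (- (cosSum (a - b) n - cos (a - b)) + - (fromℕ 2 * (x * y - T n)))
          ≈⟨ solve 7 (λ t u v S R w T → :- (S :- u) :+ (:- (R :- v) :+ :- (t :* (w :- T))) := u :+ v :- t :* w :+ (t :* T :- (S :+ R))) refl
               (fromℕ 2) (cos (a + b)) (cos (a - b)) (cosSum (a + b) n) (cosSum (a - b) n) (x * y) (T n) ⟩
        cos (a + b) + cos (a - b) - fromℕ 2 * (x * y) + (fromℕ 2 * T n - (cosSum (a + b) n + cosSum (a - b) n))
          ≈⟨ +-congˡ (trans (+-congˡ (-‿cong (cosSum-dAlembert a b n))) (-‿inverseʳ _)) ⟩
        cos (a + b) + cos (a - b) - fromℕ 2 * (x * y) + 0#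
          ≈⟨ +-identityʳ _ ⟩
        cos (a + b) + cos (a - b) - fromℕ 2 * (x * y) ∎)
      (null-+ (null-neg (cosSum-null (a + b)))
        (null-+ (null-neg (cosSum-null (a - b))) (null-neg (const*null (fromℕ 2) triangle-null))))
      where
      T = triangle (cosTerm a) (cosTerm b)

-- Powers of a unit complex number and their periods.

module Rotations {c ℓ₁ ℓ₂ ℓ₃} (ℝ : CompleteOrderedField c ℓ₁ ℓ₂ ℓ₃) where
  open CompleteOrderedField ℝ hiding (zero)
  open Spectral ℝ
  open IntegerCoefficients ℝ
  open Order ℝ
  open NullSequences ℝ using (0<2)
  open import Relation.Binary.Reasoning.Setoid setoid

  -- C k + i S k is the k-th power of a complex number of modulus 1.
  record IsRotation (C S : ℕ → Carrier) : Set (c ⊔ ℓ₁) where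
    field
      C-0   : C 0 ≈ 1#
      S-0   : S 0 ≈ 0#
      C-+   : ∀ a b → C (a ℕ.+ b) ≈ C a * C b - S a * S b
      S-+   : ∀ a b → S (a ℕ.+ b) ≈ S a * C b + C a * S b
      C²+S² : ∀ a → C a * C a + S a * S a ≈ 1#

    IsPeriod : ℕ → Set ℓ₁
    IsPeriod p = C p ≈ 1# × S p ≈ 0#

    C-period : ∀ {p} → IsPeriod p → ∀ a → C (p ℕ.+ a) ≈ C a
    C-period {p} (Cp , Sp) a = begin
      C (p ℕ.+ a)              ≈⟨ C-+ p a ⟩
      C p * C a - S p * S a    ≈⟨ +-cong (*-congʳ Cp) (-‿cong (*-congʳ Sp)) ⟩
      1# * C a - 0# * S a      ≈⟨ solve 2 (λ x y → con (+ 1) :* x :- con (+ 0) :* y := x) refl _ _ ⟩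
      C a                      ∎

    S-period : ∀ {p} → IsPeriod p → ∀ a → S (p ℕ.+ a) ≈ S a
    S-period {p} (Cp , Sp) a = begin
      S (p ℕ.+ a)              ≈⟨ S-+ p a ⟩
      S p * C a + C p * S a    ≈⟨ +-cong (*-congʳ Sp) (*-congʳ Cp) ⟩
      0# * C a + 1# * S a      ≈⟨ solve 2 (λ x y → con (+ 0) :* x :+ con (+ 1) :* y := y) refl _ _ ⟩
      S a                      ∎

    period-0 : IsPeriod 0
    period-0 = C-0 , S-0

    period-+ : ∀ {p r} → IsPeriod p → IsPeriod r → IsPeriod (p ℕ.+ r)
    period-+ p-period (Cr , Sr) = trans (C-period p-period _) Cr , trans (S-period p-period _) Sr

    period-∸ : ∀ {p r} → IsPeriod p → IsPeriod (p ℕ.+ r) → IsPeriod r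
    period-∸ p-period (Cpr , Spr) =
      trans (sym (C-period p-period _)) Cpr , trans (sym (S-period p-period _)) Spr

    period-* : ∀ m {p} → IsPeriod p → IsPeriod (m ℕ.* p)
    period-* zero    p-period = period-0
    period-* (suc m) p-period = period-+ p-period (period-* m p-period)

    -- `S p` squares to 0 by `C²+S²`; were it apart from 0, so would be its square.
    C≈1⇒period : ∀ {p} → C p ≈ 1# → IsPeriod p
    C≈1⇒period {p} Cp = Cp , ¬#0⇒≈0 λ Sp#0 → ≈0⇒¬#0 S²≈0 (x#0y#0→xy#0 Sp#0 Sp#0)
      where
      S²≈0 : S p * S p ≈ 0#
      S²≈0 = begin
        S p * S p                            ≈⟨ solve 2 (λ c s → s :* s := c :* c :+ s :* s :- c :* c) refl (C p) (S p) ⟩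
        C p * C p + S p * S p - C p * C p    ≈⟨ +-cong (C²+S² p) (-‿cong (*-cong Cp Cp)) ⟩
        1# - 1# * 1#                         ≈⟨ solve 0 (con (+ 1) :- con (+ 1) :* con (+ 1) := con (+ 0)) refl ⟩
        0#                                   ∎

    -- Bézout's identity over ℕ presents one multiple as the gcd plus another, and periods can be
    -- subtracted.
    period-gcd : ∀ {d N} → IsPeriod d → IsPeriod N → IsPeriod (gcd d N)
    period-gcd {d} {N} d-period N-period with Bézout.identity (gcd-GCD d N)
    ... | Bézout.+- x y g+yN≡xd = period-∸ (period-* y N-period)
      (≡.subst IsPeriod (≡.trans (≡.sym g+yN≡xd) (ℕₚ.+-comm (gcd d N) (y ℕ.* N))) (period-* x d-period))
    ... | Bézout.-+ x y g+xd≡yN = period-∸ (period-* x d-period)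
      (≡.subst IsPeriod (≡.trans (≡.sym g+xd≡yN) (ℕₚ.+-comm (gcd d N) (x ℕ.* d))) (period-* y N-period))

  rotation-multiple : ∀ {C S} m → IsRotation C S → IsRotation (C ∘ (m ℕ.*_)) (S ∘ (m ℕ.*_))
  rotation-multiple {C} {S} m rot = record
    { C-0   = trans (reflexive (≡.cong C (ℕₚ.*-zeroʳ m))) C-0
    ; S-0   = trans (reflexive (≡.cong S (ℕₚ.*-zeroʳ m))) S-0
    ; C-+   = λ a b → trans (reflexive (≡.cong C (ℕₚ.*-distribˡ-+ m a b))) (C-+ (m ℕ.* a) (m ℕ.* b))
    ; S-+   = λ a b → trans (reflexive (≡.cong S (ℕₚ.*-distribˡ-+ m a b))) (S-+ (m ℕ.* a) (m ℕ.* b))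
    ; C²+S² = λ a → C²+S² (m ℕ.* a)
    }
    where open IsRotation rot

  -- c N + i s N = i, so the rotation by 1 is through an N-th part of a quarter turn.
  module QuarterTurn {c s} (rot : IsRotation c s) (N : ℕ) .{{_ : NonZero N}}
    (cN≈0 : c N ≈ 0#) (sN≈1 : s N ≈ 1#) (c≉0 : ∀ g → 0 ℕ.< g → g ℕ.< N → ¬ (c g ≈ 0#)) where
    open IsRotation rot

    c-N+ : ∀ a → c (N ℕ.+ a) ≈ - s a
    c-N+ a = trans (C-+ N a) (trans (+-cong (*-congʳ cN≈0) (-‿cong (*-congʳ sN≈1)))
      (solve 2 (λ x y → con (+ 0) :* x :- con (+ 1) :* y := :- y) refl _ _))

    s-N+ : ∀ a → s (N ℕ.+ a) ≈ c a
    s-N+ a = trans (S-+ N a) (trans (+-cong (*-congʳ sN≈1) (*-congʳ cN≈0))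
      (solve 2 (λ x y → con (+ 1) :* x :+ con (+ 0) :* y := x) refl _ _))

    period-4N : IsPeriod (4 ℕ.* N)
    period-4N =
        trans (c-N+ _) (trans (-‿cong (trans (s-N+ _) (trans (c-N+ _) (-‿cong (trans (s-N+ 0) C-0)))))
          (solve 0 (:- (:- con (+ 1)) := con (+ 1)) refl))
      , trans (s-N+ _) (trans (c-N+ _) (trans (-‿cong (trans (s-N+ _) (trans (c-N+ 0) (-‿cong S-0))))
          (solve 0 (:- (:- con (+ 0)) := con (+ 0)) refl)))

    ¬period-N : ¬ IsPeriod N
    ¬period-N (cN≈1 , _) = ≈0⇒¬#0 (trans (sym cN≈1) cN≈0) 1#0

    ¬period-2N : ¬ IsPeriod (N ℕ.+ N)
    ¬period-2N (c2N≈1 , _) = ≈0⇒¬#0 (begin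
      fromℕ 2   ≈⟨ solve 0 (con (+ 2) := con (+ 1) :+ con (+ 1)) refl ⟩
      1# + 1#   ≈⟨ +-cong c2N≈1 sN≈1 ⟨
      c (N ℕ.+ N) + s N  ≈⟨ +-congʳ (c-N+ N) ⟩
      - s N + s N        ≈⟨ -‿inverseˡ _ ⟩
      0#                 ∎) (pos⇒# 0<2)

    open +-*-Solver using () renaming (solve to ℕ-solve; _:=_ to _≔_; _:+_ to _⊕_; _:*_ to _⊛_; con to κ)

    ¬proper-period : ∀ q g → N ≡ q ℕ.* g → q ≢ 1 → ¬ IsPeriod (4 ℕ.* g)
    ¬proper-period q g N≡qg q≢1 4g-period = by-mod q 0 (≡.sym (ℕₚ.+-identityʳ q))
      where
      multiple : ∀ m {k} → k ≡ m ℕ.* (4 ℕ.* g) → IsPeriod k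
      multiple m k≡ = ≡.subst IsPeriod (≡.sym k≡) (period-* m 4g-period)

      0<g<N : 0 ℕ.< g × g ℕ.< N
      0<g<N = go q g N≡qg q≢1 (ℕ.≢-nonZero⁻¹ N)
        where
        go : ∀ q g → N ≡ q ℕ.* g → q ≢ 1 → N ≢ 0 → 0 ℕ.< g × g ℕ.< N
        go zero          g       N≡ q≢1 N≢0 = contradiction N≡ N≢0
        go (suc zero)    g       N≡ q≢1 N≢0 = contradiction ≡.refl q≢1
        go (suc (suc q)) zero    N≡ q≢1 N≢0 = contradiction (≡.trans N≡ (ℕₚ.*-zeroʳ q)) N≢0
        go (suc (suc q)) (suc g) ≡.refl q≢1 N≢0 = ℕ.s≤s ℕ.z≤n ,
          ℕₚ.m<m+n (suc g) (ℕ.s≤s ℕ.z≤n)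

      cg≉0 : ¬ (c g ≈ 0#)
      cg≉0 = c≉0 g (proj₁ 0<g<N) (proj₂ 0<g<N)

      -- Cases on `q` modulo 4, with `r` shedding fours into `m`. The period `4g` then divides `N`,
      -- `N - g`, `2N` or `N + g`; in the second and fourth case `c g` equals `c N` or `s (N + g)`,
      -- which is 0.
      by-mod : ∀ r m → q ≢ r ℕ.+ m ℕ.* 4
      by-mod 0 m q≡ = ¬period-N (multiple m (≡.trans N≡qg (≡.trans (≡.cong (ℕ._* g) q≡) (ℕₚ.*-assoc m 4 g))))
      by-mod 1 m q≡ = cg≉0 (begin
        c g                          ≈⟨ C-period (multiple m ≡.refl) g ⟨
        c (m ℕ.* (4 ℕ.* g) ℕ.+ g)    ≡⟨ ≡.cong c (≡.trans (ℕ-solve 2 (λ m g → m ⊛ (κ 4 ⊛ g) ⊕ g ≔ (κ 1 ⊕ m ⊛ κ 4) ⊛ g) ≡.refl m g)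
                                          (≡.trans (≡.cong (ℕ._* g) (≡.sym q≡)) (≡.sym N≡qg))) ⟩
        c N                          ≈⟨ cN≈0 ⟩
        0#                           ∎)
      by-mod 2 m q≡ = ¬period-2N (multiple (1 ℕ.+ m ℕ.+ m)
        (≡.trans (≡.cong (λ n → n ℕ.+ n) (≡.trans N≡qg (≡.cong (ℕ._* g) q≡)))
          (ℕ-solve 2 (λ m g → (κ 2 ⊕ m ⊛ κ 4) ⊛ g ⊕ (κ 2 ⊕ m ⊛ κ 4) ⊛ g ≔ (κ 1 ⊕ m ⊕ m) ⊛ (κ 4 ⊛ g)) ≡.refl m g)))
      by-mod 3 m q≡ = cg≉0 (trans (sym (s-N+ g)) (proj₂ (multiple (suc m)
        (≡.trans (≡.cong (ℕ._+ g) (≡.trans N≡qg (≡.cong (ℕ._* g) q≡)))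
          (ℕ-solve 2 (λ m g → (κ 3 ⊕ m ⊛ κ 4) ⊛ g ⊕ g ≔ (κ 1 ⊕ m) ⊛ (κ 4 ⊛ g)) ≡.refl m g)))))
      by-mod (suc (suc (suc (suc r)))) m q≡ = by-mod r (suc m)
        (≡.trans q≡ (ℕ-solve 2 (λ r m → κ 4 ⊕ r ⊕ m ⊛ κ 4 ≔ r ⊕ (κ 4 ⊕ m ⊛ κ 4)) ≡.refl r m))

    -- Otherwise `4 gcd d N` would be a period too, and `gcd d N` is a proper divisor of `N` because
    -- `N` does not divide `d`.
    non-period : ∀ d → ¬ (N ∣ d) → ¬ (c (4 ℕ.* d) ≈ 1#)
    non-period d N∤d c≈1 with gcd[m,n]∣n d N
    ... | divides q N≡qg = ¬proper-period q (gcd d N) N≡qg q≢1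
      (period-gcd₄ (C≈1⇒period c≈1) period-4N)
      where
      period-gcd₄ : IsPeriod (4 ℕ.* d) → IsPeriod (4 ℕ.* N) → IsPeriod (4 ℕ.* gcd d N)
      period-gcd₄ = IsRotation.period-gcd (rotation-multiple 4 rot) {d} {N}
      q≢1 : q ≢ 1
      q≢1 ≡.refl = N∤d (≡.subst (_∣ d) (≡.sym (≡.trans N≡qg (ℕₚ.+-identityʳ _))) (gcd[m,n]∣m d N))

-- Addition formulas, and a primitive root of unity.

module Trigonometry {c ℓ₁ ℓ₂ ℓ₃} (ℝ : CompleteOrderedField c ℓ₁ ℓ₂ ℓ₃)
  (cos : CompleteOrderedField.Carrier ℝ → CompleteOrderedField.Carrier ℝ)
  (isCos : Spectral.IsCos ℝ cos)
  (π : CompleteOrderedField.Carrier ℝ) (isPi : Spectral.IsPi ℝ cos π) where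
  open CompleteOrderedField ℝ hiding (zero)
  open Spectral ℝ
  open IntegerCoefficients ℝ
  open Order ℝ
  open NullSequences ℝ using (0<2)
  open Cosine ℝ cos isCos using (cos-cong; cos-0; dAlembert)
  open Rotations ℝ
  open IsPi isPi
  open import Relation.Binary.Reasoning.Setoid setoid

  abstract
    h : Carrier
    h = π /ℕ 2

    h-pos : 0# < h
    h-pos = *-pos π-positive (recip-pos 2)

    2h : fromℕ 2 * h ≈ π
    2h = trans (solve 3 (λ p r t → t :* (p :* r) := p :* (r :* t)) refl π (recip 2) (fromℕ 2))
      (trans (*-congˡ (recip-inverse 2)) (*-identityʳ π))

    cos-h : cos h ≈ 0#
    cos-h = cos[π/2]≈0

    h-least : ∀ x → 0# < x → x < h → ¬ (cos x ≈ 0#)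
    h-least = π/2-least

  sin : Carrier → Carrier
  sin x = cos (h - x)

  sin-cong : ∀ {x y} → x ≈ y → sin x ≈ sin y
  sin-cong x≈y = cos-cong (+-congˡ (-‿cong x≈y))

  cos-neg : ∀ x → cos (- x) ≈ cos x
  cos-neg x = begin
    cos (- x)                      ≈⟨ cos-cong (solve 1 (λ x → :- x := con (+ 0) :- x) refl x) ⟩
    cos (0# - x)                   ≈⟨ solve 2 (λ u v → v := u :+ v :- u) refl (cos (0# + x)) _ ⟩
    cos (0# + x) + cos (0# - x) - cos (0# + x)
      ≈⟨ +-cong (trans (dAlembert 0# x) (*-congˡ (*-congʳ cos-0))) (-‿cong (cos-cong (+-identityˡ x))) ⟩
    fromℕ 2 * (1# * cos x) - cos x ≈⟨ solve 1 (λ u → con (+ 2) :* (con (+ 1) :* u) :- u := u) refl (cos x) ⟩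
    cos x                          ∎

  cos-h+ : ∀ x → cos (h + x) ≈ - sin x
  cos-h+ x = begin
    cos (h + x)                          ≈⟨ solve 2 (λ u v → u := u :+ v :- v) refl _ (sin x) ⟩
    cos (h + x) + cos (h - x) - sin x    ≈⟨ +-congʳ (trans (dAlembert h x) (*-congˡ (*-congʳ cos-h))) ⟩
    fromℕ 2 * (0# * cos x) - sin x       ≈⟨ solve 2 (λ u v → con (+ 2) :* (con (+ 0) :* u) :- v := :- v) refl _ _ ⟩
    - sin x                              ∎

  sin-neg : ∀ x → sin (- x) ≈ - sin x
  sin-neg x = trans (cos-cong (solve 2 (λ h x → h :- (:- x) := h :+ x) refl h x)) (cos-h+ x)

  -- Complementary angles turn the sine product into a cosine product; their sum is `h` plus a
  -- complementary angle, whence the sign of `cos (a + b)`.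
  2sin*sin : ∀ a b → fromℕ 2 * (sin a * sin b) ≈ cos (a - b) - cos (a + b)
  2sin*sin a b = begin
    fromℕ 2 * (sin a * sin b)
      ≈⟨ dAlembert (h - a) (h - b) ⟨
    cos (h - a + (h - b)) + cos (h - a - (h - b))
      ≈⟨ +-cong
           (cos-cong (solve 3 (λ h a b → h :- a :+ (h :- b) := h :+ (h :- (a :+ b))) refl h a b))
           (cos-cong (solve 3 (λ h a b → h :- a :- (h :- b) := :- (a :- b)) refl h a b)) ⟩
    cos (h + (h - (a + b))) + cos (- (a - b))
      ≈⟨ +-cong (cos-h+ _) (cos-neg _) ⟩
    - sin (h - (a + b)) + cos (a - b)
      ≈⟨ +-congʳ (-‿cong (cos-cong (solve 2 (λ h x → h :- (h :- x) := x) refl h (a + b)))) ⟩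
    - cos (a + b) + cos (a - b)
      ≈⟨ +-comm _ _ ⟩
    cos (a - b) - cos (a + b) ∎

  2cos*sin : ∀ a b → fromℕ 2 * (cos a * sin b) ≈ sin (a + b) - sin (a - b)
  2cos*sin a b = begin
    fromℕ 2 * (cos a * sin b)
      ≈⟨ dAlembert a (h - b) ⟨
    cos (a + (h - b)) + cos (a - (h - b))
      ≈⟨ +-cong
           (cos-cong (solve 3 (λ h a b → a :+ (h :- b) := h :- (:- (a :- b))) refl h a b))
           (cos-cong (solve 3 (λ h a b → a :- (h :- b) := :- (h :- (a :+ b))) refl h a b)) ⟩
    sin (- (a - b)) + cos (- (h - (a + b)))
      ≈⟨ +-cong (sin-neg _) (cos-neg _) ⟩
    - sin (a - b) + sin (a + b)
      ≈⟨ +-comm _ _ ⟩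
    sin (a + b) - sin (a - b) ∎

  cancel-2 : ∀ {x y} → fromℕ 2 * x ≈ fromℕ 2 * y → x ≈ y
  cancel-2 = *-cancelˡ-# (pos⇒# 0<2)

  cos-+ : ∀ a b → cos (a + b) ≈ cos a * cos b - sin a * sin b
  cos-+ a b = cancel-2 (begin
    fromℕ 2 * cos (a + b)
      ≈⟨ solve 2 (λ u v → con (+ 2) :* u := u :+ v :- (v :- u)) refl _ (cos (a - b)) ⟩
    cos (a + b) + cos (a - b) - (cos (a - b) - cos (a + b))
      ≈⟨ +-cong (dAlembert a b) (-‿cong (sym (2sin*sin a b))) ⟩
    fromℕ 2 * (cos a * cos b) - fromℕ 2 * (sin a * sin b)
      ≈⟨ solve 3 (λ t x y → t :* x :- t :* y := t :* (x :- y)) refl _ _ _ ⟩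
    fromℕ 2 * (cos a * cos b - sin a * sin b) ∎)

  sin-+ : ∀ a b → sin (a + b) ≈ sin a * cos b + cos a * sin b
  sin-+ a b = cancel-2 (begin
    fromℕ 2 * sin (a + b)
      ≈⟨ solve 2 (λ u v → con (+ 2) :* u := u :- (:- v) :+ (u :- v)) refl _ (sin (a - b)) ⟩
    sin (a + b) - - sin (a - b) + (sin (a + b) - sin (a - b))
      ≈⟨ +-congʳ (+-cong (sin-cong (+-comm a b)) (-‿cong (trans (sym (sin-neg _))
           (sin-cong (solve 2 (λ a b → :- (a :- b) := b :- a) refl a b))))) ⟩
    sin (b + a) - sin (b - a) + (sin (a + b) - sin (a - b))
      ≈⟨ +-cong (2cos*sin b a) (2cos*sin a b) ⟨
    fromℕ 2 * (cos b * sin a) + fromℕ 2 * (cos a * sin b)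
      ≈⟨ solve 4 (λ t x y z → t :* (x :* y) :+ t :* z := t :* (y :* x :+ z)) refl _ _ _ _ ⟩
    fromℕ 2 * (sin a * cos b + cos a * sin b) ∎)

  cos²+sin² : ∀ a → cos a * cos a + sin a * sin a ≈ 1#
  cos²+sin² a = cancel-2 (begin
    fromℕ 2 * (cos a * cos a + sin a * sin a)
      ≈⟨ distribˡ _ _ _ ⟩
    fromℕ 2 * (cos a * cos a) + fromℕ 2 * (sin a * sin a)
      ≈⟨ +-cong (sym (dAlembert a a)) (2sin*sin a a) ⟩
    cos (a + a) + cos (a - a) + (cos (a - a) - cos (a + a))
      ≈⟨ solve 2 (λ u v → u :+ v :+ (v :- u) := con (+ 2) :* v) refl _ _ ⟩
    fromℕ 2 * cos (a - a)
      ≈⟨ *-congˡ (trans (cos-cong (-‿inverseʳ a)) cos-0) ⟩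
    fromℕ 2 * 1# ∎)

  module RootsOfUnity (N : ℕ) .{{_ : NonZero N}} where

    -- A quarter of `2π/N`. In this finer grid `N` steps make a quarter turn, where cosine and sine
    -- are known to be 0 and 1.
    η : Carrier
    η = h /ℕ N

    ηN≈h : η * fromℕ N ≈ h
    ηN≈h = trans (*-assoc _ _ _) (trans (*-congˡ (recip-inverse N)) (*-identityʳ h))

    η-pos : 0# < η
    η-pos = *-pos h-pos (recip-pos N)

    c₄ s₄ : ℕ → Carrier
    c₄ k = cos (η * fromℕ k)
    s₄ k = sin (η * fromℕ k)

    η-+ : ∀ a b → η * fromℕ (a ℕ.+ b) ≈ η * fromℕ a + η * fromℕ b
    η-+ a b = trans (*-congˡ (fromℕ-+ a b)) (distribˡ _ _ _)

    rotation : IsRotation c₄ s₄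
    rotation = record
      { C-0   = trans (cos-cong (zeroʳ η)) cos-0
      ; S-0   = trans (cos-cong (solve 2 (λ h e → h :- e :* con (+ 0) := h) refl h η)) cos-h
      ; C-+   = λ a b → trans (cos-cong (η-+ a b)) (cos-+ _ _)
      ; S-+   = λ a b → trans (sin-cong (η-+ a b)) (sin-+ _ _)
      ; C²+S² = λ a → cos²+sin² _
      }

    c₄-N : c₄ N ≈ 0#
    c₄-N = trans (cos-cong ηN≈h) cos-h

    s₄-N : s₄ N ≈ 1#
    s₄-N = trans (cos-cong (trans (+-congˡ (-‿cong ηN≈h)) (-‿inverseʳ h))) cos-0

    -- Here the minimality of `π/2` enters: fewer than `N` steps of size `h/N` stay below `h`.
    c₄≉0 : ∀ g → 0 ℕ.< g → g ℕ.< N → ¬ (c₄ g ≈ 0#)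
    c₄≉0 (suc g) _ g<N = h-least _ (*-pos η-pos (fromℕ-pos g))
      (<-respʳ-≈ ηN≈h (*-monoˡ-< η-pos (fromℕ-mono-< g<N)))

    open QuarterTurn rotation N c₄-N s₄-N c₄≉0 public using (period-4N; non-period)

-- Sums over the powers of a rotation: vanishing, the Fejér sum, Hartley orthogonality.

module RotationSums {c ℓ₁ ℓ₂ ℓ₃} (ℝ : CompleteOrderedField c ℓ₁ ℓ₂ ℓ₃) where
  open CompleteOrderedField ℝ hiding (zero)
  open Spectral ℝ
  open IntegerCoefficients ℝ
  open Order ℝ
  open NullSequences ℝ using (0<2)
  open SequenceSums ℝ
  open Rotations ℝ
  open import Algebra.Properties.Semiring.Sum semiring using (∑-distrib-+; *-distribˡ-sum)
  open import Relation.Binary.Reasoning.Setoid setoid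

  Σ<-linear : ∀ n a f b g → Σ< n (λ k → a * f k + b * g k) ≈ a * Σ< n f + b * Σ< n g
  Σ<-linear n a f b g = trans (∑-distrib-+ {n} (λ k → a * f (toℕ k)) (λ k → b * g (toℕ k)))
    (sym (+-cong (*-distribˡ-sum {n} a (λ k → f (toℕ k))) (*-distribˡ-sum {n} b (λ k → g (toℕ k)))))

  Σ<-+ : ∀ n f g → Σ< n (λ k → f k + g k) ≈ Σ< n f + Σ< n g
  Σ<-+ n f g = ∑-distrib-+ {n} (λ k → f (toℕ k)) (λ k → g (toℕ k))

  Σ<-1 : ∀ n → Σ< n (λ _ → 1#) ≈ fromℕ n
  Σ<-1 zero    = refl
  Σ<-1 (suc n) = +-congˡ (Σ<-1 n)

  Σ<-0 : ∀ n {f} → (∀ k → f k ≈ 0#) → Σ< n f ≈ 0#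
  Σ<-0 zero    f≈0 = refl
  Σ<-0 (suc n) f≈0 = trans (+-cong (f≈0 0) (Σ<-0 n (f≈0 ∘ suc))) (+-identityˡ 0#)

  Σ<-shift : ∀ n f → f n ≈ f 0 → Σ< n (f ∘ suc) ≈ Σ< n f
  Σ<-shift n f fn≈f0 = begin
    Σ< n (f ∘ suc)                ≈⟨ solve 2 (λ x y → y := x :+ y :- x) refl (f 0) _ ⟩
    Σ< (suc n) f - f 0            ≈⟨ +-cong (Σ<-last n f) (-‿cong (sym fn≈f0)) ⟩
    Σ< n f + f n - f n            ≈⟨ solve 2 (λ x y → x :+ y :- y := x) refl _ _ ⟩
    Σ< n f                        ∎

  Σ<-reverse : ∀ n f → Σ< n f ≈ Σ< n (λ k → f (n ∸ suc k))
  Σ<-reverse zero    f = refl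
  Σ<-reverse (suc n) f = trans (Σ<-last n f) (trans (+-comm _ _) (+-congˡ (Σ<-reverse n f)))

  Σ<-truncate : ∀ {m n} f → m ℕ.≤ n → (∀ k → m ℕ.≤ k → f k ≈ 0#) → Σ< n f ≈ Σ< m f
  Σ<-truncate {m} f m≤n f≈0 with ℕₚ.m≤n⇒∃[o]m+o≡n m≤n
  ... | p , ≡.refl = trans (Σ<-split m p f)
    (trans (+-congˡ (Σ<-0 p (λ k → f≈0 (m ℕ.+ k) (ℕₚ.m≤m+n m k)))) (+-identityʳ _))

  module _ {C S} (rot : IsRotation C S) where
    open IsRotation rot

    -- X + i Y is a sum over the powers of C 1 + i S 1, so (C 1 + i S 1)(X + i Y) = X + i Y.
    module _ {N} (N-period : IsPeriod N) (C1≉1 : ¬ (C 1 ≈ 1#)) where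
      private
        X = Σ< N C
        Y = Σ< N S

        rotate-C : C 1 * X - S 1 * Y ≈ X
        rotate-C = begin
          C 1 * X - S 1 * Y           ≈⟨ solve 4 (λ a x b y → a :* x :- b :* y := a :* x :+ (:- b) :* y) refl _ _ _ _ ⟩
          C 1 * X + - S 1 * Y         ≈⟨ Σ<-linear N (C 1) C (- S 1) S ⟨
          Σ< N (λ k → C 1 * C k + - S 1 * S k)
            ≈⟨ Σ<-cong N (λ k → trans (C-+ 1 k) (solve 4 (λ a x b y → a :* x :- b :* y := a :* x :+ (:- b) :* y) refl _ _ _ _)) ⟨
          Σ< N (C ∘ suc)              ≈⟨ Σ<-shift N C (trans (proj₁ N-period) (sym C-0)) ⟩
          X                           ∎

        rotate-S : S 1 * X + C 1 * Y ≈ Y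
        rotate-S = begin
          S 1 * X + C 1 * Y           ≈⟨ Σ<-linear N (S 1) C (C 1) S ⟨
          Σ< N (λ k → S 1 * C k + C 1 * S k)
            ≈⟨ Σ<-cong N (λ k → S-+ 1 k) ⟨
          Σ< N (S ∘ suc)              ≈⟨ Σ<-shift N S (trans (proj₂ N-period) (sym S-0)) ⟩
          Y                           ∎

        -- The squared modulus of `1 - ω` for `ω = C 1 + i S 1`.
        2-2C1 : fromℕ 2 - fromℕ 2 * C 1 ≈ 1# + (C 1 * C 1 + S 1 * S 1) - fromℕ 2 * C 1
        2-2C1 = +-congʳ (trans (solve 0 (con (+ 2) := con (+ 1) :+ con (+ 1)) refl) (+-congˡ (sym (C²+S² 1))))

        -- Only the negation `C1≉1` is known, so `2 - 2 C 1` cannot be divided by. If `Z` were apart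
        -- from 0, it could be cancelled instead, giving `C 1 ≈ 1#`.
        fixed⇒0 : ∀ {Z} → (fromℕ 2 - fromℕ 2 * C 1) * Z ≈ 0# → Z ≈ 0#
        fixed⇒0 {Z} eq = ¬#0⇒≈0 λ Z#0 → C1≉1 (*-cancelˡ-# (pos⇒# 0<2) (*-cancelˡ-# Z#0 (begin
          Z * (fromℕ 2 * C 1)
            ≈⟨ solve 3 (λ t p z → z :* (t :* p) := z :* t :- (t :- t :* p) :* z) refl (fromℕ 2) (C 1) Z ⟩
          Z * fromℕ 2 - (fromℕ 2 - fromℕ 2 * C 1) * Z
            ≈⟨ +-congˡ (-‿cong eq) ⟩
          Z * fromℕ 2 - 0#
            ≈⟨ solve 1 (λ z → z :* con (+ 2) :- con (+ 0) := z :* (con (+ 2) :* con (+ 1))) refl Z ⟩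
          Z * (fromℕ 2 * 1#) ∎)))

      -- The real part of `(1 - ω)(X + i Y) = 0` after multiplication by the conjugate of `1 - ω`,
      -- which makes the coefficient real.
      Σ<-C≈0 : Σ< N C ≈ 0#
      Σ<-C≈0 = fixed⇒0 (begin
        (fromℕ 2 - fromℕ 2 * C 1) * X
          ≈⟨ *-congʳ 2-2C1 ⟩
        (1# + (C 1 * C 1 + S 1 * S 1) - fromℕ 2 * C 1) * X
          ≈⟨ solve 4 (λ p q X Y → (con (+ 1) :+ (p :* p :+ q :* q) :- con (+ 2) :* p) :* X
               := (p :* (p :* X :- q :* Y) :- p :* X) :+ (X :- (p :* X :- q :* Y)) :+ q :* (q :* X :+ p :* Y :- Y)) refl
               (C 1) (S 1) X Y ⟩
        (C 1 * (C 1 * X - S 1 * Y) - C 1 * X) + (X - (C 1 * X - S 1 * Y)) + S 1 * (S 1 * X + C 1 * Y - Y)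
          ≈⟨ +-cong (+-cong (+-congʳ (*-congˡ rotate-C)) (+-congˡ (-‿cong rotate-C))) (*-congˡ (+-congʳ rotate-S)) ⟩
        (C 1 * X - C 1 * X) + (X - X) + S 1 * (Y - Y)
          ≈⟨ solve 4 (λ p q X Y → (p :* X :- p :* X) :+ (X :- X) :+ q :* (Y :- Y) := con (+ 0)) refl (C 1) (S 1) X Y ⟩
        0# ∎)

      Σ<-S≈0 : Σ< N S ≈ 0#
      Σ<-S≈0 = fixed⇒0 (begin
        (fromℕ 2 - fromℕ 2 * C 1) * Y
          ≈⟨ *-congʳ 2-2C1 ⟩
        (1# + (C 1 * C 1 + S 1 * S 1) - fromℕ 2 * C 1) * Y
          ≈⟨ solve 4 (λ p q X Y → (con (+ 1) :+ (p :* p :+ q :* q) :- con (+ 2) :* p) :* Y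
               := (p :* (q :* X :+ p :* Y) :- p :* Y) :+ (Y :- (q :* X :+ p :* Y)) :+ q :* (X :- (p :* X :- q :* Y))) refl
               (C 1) (S 1) X Y ⟩
        (C 1 * (S 1 * X + C 1 * Y) - C 1 * Y) + (Y - (S 1 * X + C 1 * Y)) + S 1 * (X - (C 1 * X - S 1 * Y))
          ≈⟨ +-cong (+-cong (+-congʳ (*-congˡ rotate-S)) (+-congˡ (-‿cong rotate-S))) (*-congˡ (+-congˡ (-‿cong rotate-C))) ⟩
        (C 1 * Y - C 1 * Y) + (Y - Y) + S 1 * (X - X)
          ≈⟨ solve 4 (λ p q X Y → (p :* Y :- p :* Y) :+ (Y :- Y) :+ q :* (X :- X) := con (+ 0)) refl (C 1) (S 1) X Y ⟩
        0# ∎)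

    -- `y` is `- x` modulo a period. Multiplying by `C²+S²` at `x` and regrouping by the addition
    -- formulas undoes the rotation by `x` without negative indices.
    C-reflect : ∀ {x y} → IsPeriod (x ℕ.+ y) → C y ≈ C x
    C-reflect {x} {y} (Cxy , Sxy) = begin
      C y
        ≈⟨ *-identityˡ _ ⟨
      1# * C y
        ≈⟨ *-congʳ (C²+S² x) ⟨
      (C x * C x + S x * S x) * C y
        ≈⟨ solve 4 (λ c s d t → (c :* c :+ s :* s) :* d := c :* (c :* d :- s :* t) :+ s :* (s :* d :+ c :* t)) refl (C x) (S x) (C y) (S y) ⟩
      C x * (C x * C y - S x * S y) + S x * (S x * C y + C x * S y)
        ≈⟨ +-cong (*-congˡ (trans (sym (C-+ x y)) Cxy)) (*-congˡ (trans (sym (S-+ x y)) Sxy)) ⟩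
      C x * 1# + S x * 0#
        ≈⟨ solve 2 (λ x y → x :* con (+ 1) :+ y :* con (+ 0) := x) refl _ _ ⟩
      C x ∎

    S-reflect : ∀ {x y} → IsPeriod (x ℕ.+ y) → S y ≈ - S x
    S-reflect {x} {y} (Cxy , Sxy) = begin
      S y
        ≈⟨ *-identityˡ _ ⟨
      1# * S y
        ≈⟨ *-congʳ (C²+S² x) ⟨
      (C x * C x + S x * S x) * S y
        ≈⟨ solve 4 (λ c s d t → (c :* c :+ s :* s) :* t := c :* (s :* d :+ c :* t) :- s :* (c :* d :- s :* t)) refl (C x) (S x) (C y) (S y) ⟩
      C x * (S x * C y + C x * S y) - S x * (C x * C y - S x * S y)
        ≈⟨ +-cong (*-congˡ (trans (sym (S-+ x y)) Sxy)) (-‿cong (*-congˡ (trans (sym (C-+ x y)) Cxy))) ⟩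
      C x * 0# - S x * 1#
        ≈⟨ solve 2 (λ x y → x :* con (+ 0) :- y :* con (+ 1) := :- y) refl _ _ ⟩
      - S x ∎

    -- Re ((X + i Y)(C l - i S l)) for the partial sum X + i Y of the first l powers
    Σ<-C-difference : ∀ l → Σ< l (λ a → C l * C a + S l * S a) ≈ Σ< l (C ∘ suc)
    Σ<-C-difference zero    = refl
    Σ<-C-difference (suc l) = begin
      C (suc l) * C 0 + S (suc l) * S 0 + Σ< l (λ a → C (suc l) * C (suc a) + S (suc l) * S (suc a))
        ≈⟨ +-cong
             (trans (+-cong (*-congˡ C-0) (*-congˡ S-0)) (solve 2 (λ x y → x :* con (+ 1) :+ y :* con (+ 0) := x) refl _ _))
             (trans (Σ<-cong l shift) (Σ<-C-difference l)) ⟩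
      C (suc l) + Σ< l (C ∘ suc)
        ≈⟨ +-comm _ _ ⟩
      Σ< l (C ∘ suc) + C (suc l)
        ≈⟨ Σ<-last l (C ∘ suc) ⟨
      Σ< (suc l) (C ∘ suc) ∎
      where
      shift : ∀ a → C (suc l) * C (suc a) + S (suc l) * S (suc a) ≈ C l * C a + S l * S a
      shift a = begin
        C (suc l) * C (suc a) + S (suc l) * S (suc a)
          ≈⟨ +-cong (*-cong (C-+ 1 l) (C-+ 1 a)) (*-cong (S-+ 1 l) (S-+ 1 a)) ⟩
        _ ≈⟨ solve 6 (λ p q c s d t →
               (p :* c :- q :* s) :* (p :* d :- q :* t) :+ (q :* c :+ p :* s) :* (q :* d :+ p :* t)
               := (p :* p :+ q :* q) :* (c :* d :+ s :* t)) refl (C 1) (S 1) (C l) (S l) (C a) (S a) ⟩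
        (C 1 * C 1 + S 1 * S 1) * (C l * C a + S l * S a)
          ≈⟨ trans (*-congʳ (C²+S² 1)) (*-identityˡ _) ⟩
        C l * C a + S l * S a ∎

    -- Half the non-constant part of `l` times the Fejér kernel: the sum of `(l - r) C r` over
    -- `1 ≤ r ≤ l`, whose last term has weight 0.
    fejer : ℕ → Carrier
    fejer l = Σ< l (λ j → fromℕ (l ∸ suc j) * C (suc j))

    fejer-suc : ∀ l → fejer (suc l) ≈ fejer l + Σ< l (C ∘ suc)
    fejer-suc l = begin
      Σ< (suc l) (λ j → fromℕ (l ∸ j) * C (suc j))
        ≈⟨ Σ<-last l (λ j → fromℕ (l ∸ j) * C (suc j)) ⟩
      Σ< l (λ j → fromℕ (l ∸ j) * C (suc j)) + fromℕ (l ∸ l) * C (suc l)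
        ≈⟨ +-congˡ (trans (*-congʳ (reflexive (≡.cong fromℕ (ℕₚ.n∸n≡0 l)))) (zeroˡ _)) ⟩
      Σ< l (λ j → fromℕ (l ∸ j) * C (suc j)) + 0#
        ≈⟨ +-identityʳ _ ⟩
      Σ< l (λ j → fromℕ (l ∸ j) * C (suc j))
        ≈⟨ sum-cong-≋ {l} (λ j → trans (*-congʳ (reflexive (≡.cong fromℕ (ℕₚ.+-∸-assoc 1 (toℕ<n j)))))
             (solve 2 (λ x y → (con (+ 1) :+ x) :* y := x :* y :+ y) refl (fromℕ (l ∸ suc (toℕ j))) (C (suc (toℕ j))))) ⟩
      Σ< l (λ j → fromℕ (l ∸ suc j) * C (suc j) + C (suc j))
        ≈⟨ Σ<-+ l (λ j → fromℕ (l ∸ suc j) * C (suc j)) (C ∘ suc) ⟩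
      fejer l + Σ< l (C ∘ suc) ∎
      where
      open import Data.Fin.Properties using (toℕ<n)
      open import Algebra.Properties.Semiring.Sum semiring using (sum-cong-≋)

    -- Adding the power `l` contributes its modulus 1 and a cross term, which is twice the sum of
    -- `C r` for `1 ≤ r ≤ l`, the increment of `2 fejer`.
    modulus² : ∀ l → Σ< l C * Σ< l C + Σ< l S * Σ< l S ≈ fromℕ l + fromℕ 2 * fejer l
    modulus² zero    = solve 0 (con (+ 0) :* con (+ 0) :+ con (+ 0) :* con (+ 0) := con (+ 0) :+ con (+ 2) :* con (+ 0)) refl
    modulus² (suc l) = begin
      Σ< (suc l) C * Σ< (suc l) C + Σ< (suc l) S * Σ< (suc l) S
        ≈⟨ +-cong (*-cong (Σ<-last l C) (Σ<-last l C)) (*-cong (Σ<-last l S) (Σ<-last l S)) ⟩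
      (X + C l) * (X + C l) + (Y + S l) * (Y + S l)
        ≈⟨ solve 4 (λ X Y c s → (X :+ c) :* (X :+ c) :+ (Y :+ s) :* (Y :+ s)
             := X :* X :+ Y :* Y :+ con (+ 2) :* (c :* X :+ s :* Y) :+ (c :* c :+ s :* s)) refl X Y (C l) (S l) ⟩
      X * X + Y * Y + fromℕ 2 * (C l * X + S l * Y) + (C l * C l + S l * S l)
        ≈⟨ +-cong (+-cong (modulus² l) (*-congˡ (trans (sym (Σ<-linear l (C l) C (S l) S)) (Σ<-C-difference l)))) (C²+S² l) ⟩
      fromℕ l + fromℕ 2 * fejer l + fromℕ 2 * Σ< l (C ∘ suc) + 1#
        ≈⟨ solve 4 (λ n t f u → n :+ t :* f :+ t :* u :+ con (+ 1) := con (+ 1) :+ n :+ t :* (f :+ u)) refl _ (fromℕ 2) _ _ ⟩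
      fromℕ (suc l) + fromℕ 2 * (fejer l + Σ< l (C ∘ suc))
        ≈⟨ +-congˡ (*-congˡ (fejer-suc l)) ⟨
      fromℕ (suc l) + fromℕ 2 * fejer (suc l) ∎
      where
      X = Σ< l C
      Y = Σ< l S

  module Hartley {C S} (rot : IsRotation C S) {N} .{{_ : NonZero N}}
    (N-period : IsRotation.IsPeriod rot N) (C≉1 : ∀ d → ¬ (N ∣ d) → ¬ (C d ≈ 1#)) where
    open IsRotation rot

    cas : ℕ → Carrier
    cas x = C x + S x

    multiple-period : ∀ d → IsPeriod (d ℕ.* N)
    multiple-period d = period-* d N-period

    ∣⇒period : ∀ {d} → N ∣ d → IsPeriod d
    ∣⇒period (divides q ≡.refl) = multiple-period q

    -- There is no condition on `d`: if `N ∣ d` the summands vanish one by one, otherwise the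
    -- rotation sum does.
    Σ<-S-multiple : ∀ d → Σ< N (λ j → S (d ℕ.* j)) ≈ 0#
    Σ<-S-multiple d with N ∣? d
    ... | yes N∣d = Σ<-0 N (λ j → proj₂ (∣⇒period (∣m⇒∣m*n j N∣d)))
    ... | no  N∤d = Σ<-S≈0 (rotation-multiple d rot) (multiple-period d)
      (λ C1≈1 → C≉1 d N∤d (trans (reflexive (≡.cong C (≡.sym (ℕₚ.*-identityʳ d)))) C1≈1))

    Σ<-C-multiple : ∀ {d} → ¬ (N ∣ d) → Σ< N (λ j → C (d ℕ.* j)) ≈ 0#
    Σ<-C-multiple {d} N∤d = Σ<-C≈0 (rotation-multiple d rot) (multiple-period d)
      (λ C1≈1 → C≉1 d N∤d (trans (reflexive (≡.cong C (≡.sym (ℕₚ.*-identityʳ d)))) C1≈1))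

    Σ<-C-period : ∀ {d} → N ∣ d → Σ< N (λ j → C (d ℕ.* j)) ≈ fromℕ N
    Σ<-C-period N∣d = trans (Σ<-cong N (λ j → proj₁ (∣⇒period (∣m⇒∣m*n j N∣d)))) (Σ<-1 N)

    -- The identity `cas x cas y = cos (x - y) + sin (x + y)`, with `N ∸ b` for `- b`. The sine part
    -- sums to 0 for all `a` and `b`, leaving one cosine sum.
    cas*cas : ∀ a {b} → b ℕ.≤ N → ∀ j →
      cas (a ℕ.* j) * cas (b ℕ.* j) ≈ C ((a ℕ.+ (N ∸ b)) ℕ.* j) + S ((a ℕ.+ b) ℕ.* j)
    cas*cas a {b} b≤N j = sym (begin
      C ((a ℕ.+ (N ∸ b)) ℕ.* j) + S ((a ℕ.+ b) ℕ.* j)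
        ≡⟨ ≡.cong₂ (λ x y → C x + S y) (ℕₚ.*-distribʳ-+ j a (N ∸ b)) (ℕₚ.*-distribʳ-+ j a b) ⟩
      C (a ℕ.* j ℕ.+ (N ∸ b) ℕ.* j) + S (a ℕ.* j ℕ.+ b ℕ.* j)
        ≈⟨ +-cong (C-+ _ _) (S-+ _ _) ⟩
      C (a ℕ.* j) * C ((N ∸ b) ℕ.* j) - S (a ℕ.* j) * S ((N ∸ b) ℕ.* j) + (S (a ℕ.* j) * C (b ℕ.* j) + C (a ℕ.* j) * S (b ℕ.* j))
        ≈⟨ +-congʳ (+-cong (*-congˡ (C-reflect rot period)) (-‿cong (*-congˡ (S-reflect rot period)))) ⟩
      C (a ℕ.* j) * C (b ℕ.* j) - S (a ℕ.* j) * - S (b ℕ.* j) + (S (a ℕ.* j) * C (b ℕ.* j) + C (a ℕ.* j) * S (b ℕ.* j))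
        ≈⟨ solve 4 (λ c s d t → c :* d :- s :* (:- t) :+ (s :* d :+ c :* t) := (c :+ s) :* (d :+ t)) refl _ _ _ _ ⟩
      cas (a ℕ.* j) * cas (b ℕ.* j) ∎)
      where
      period : IsPeriod (b ℕ.* j ℕ.+ (N ∸ b) ℕ.* j)
      period = ≡.subst IsPeriod (≡.trans (ℕₚ.*-comm j N) (≡.trans (≡.cong (ℕ._* j) (≡.sym (ℕₚ.m+[n∸m]≡n b≤N))) (ℕₚ.*-distribʳ-+ j b (N ∸ b))))
        (multiple-period j)

    Σ<-cas*cas : ∀ a {b} → b ℕ.≤ N →
      Σ< N (λ j → cas (a ℕ.* j) * cas (b ℕ.* j)) ≈ Σ< N (λ j → C ((a ℕ.+ (N ∸ b)) ℕ.* j))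
    Σ<-cas*cas a {b} b≤N = begin
      Σ< N (λ j → cas (a ℕ.* j) * cas (b ℕ.* j))
        ≈⟨ Σ<-cong N (cas*cas a b≤N) ⟩
      Σ< N (λ j → C ((a ℕ.+ (N ∸ b)) ℕ.* j) + S ((a ℕ.+ b) ℕ.* j))
        ≈⟨ Σ<-+ N (λ j → C ((a ℕ.+ (N ∸ b)) ℕ.* j)) (λ j → S ((a ℕ.+ b) ℕ.* j)) ⟩
      Σ< N (λ j → C ((a ℕ.+ (N ∸ b)) ℕ.* j)) + Σ< N (λ j → S ((a ℕ.+ b) ℕ.* j))
        ≈⟨ +-congˡ (Σ<-S-multiple (a ℕ.+ b)) ⟩
      Σ< N (λ j → C ((a ℕ.+ (N ∸ b)) ℕ.* j)) + 0#
        ≈⟨ +-identityʳ _ ⟩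
      Σ< N (λ j → C ((a ℕ.+ (N ∸ b)) ℕ.* j)) ∎

    cas-norm : ∀ {a} → a ℕ.≤ N → Σ< N (λ j → cas (a ℕ.* j) * cas (a ℕ.* j)) ≈ fromℕ N
    cas-norm {a} a≤N = trans (Σ<-cas*cas a a≤N) (Σ<-C-period (divides 1 (≡.trans (ℕₚ.m+[n∸m]≡n a≤N) (≡.sym (ℕₚ.*-identityˡ N)))))

    -- The bounds say that `a + (N - b)` lies strictly between 0 and `2N`, where the only multiple
    -- of `N` is `N`, forcing `a = b`. In this form they fit both index ranges `1, …, N` and
    -- `0, …, N - 1`.
    cas-orthogonal : ∀ {a b} → a ≢ b → b ℕ.≤ N → 0 ℕ.< a ℕ.+ (N ∸ b) → a ℕ.< N ℕ.+ b →
                     Σ< N (λ j → cas (a ℕ.* j) * cas (b ℕ.* j)) ≈ 0#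
    cas-orthogonal {a} {b} a≢b b≤N 0<d a<N+b = trans (Σ<-cas*cas a b≤N) (Σ<-C-multiple N∤d)
      where
      d+b : a ℕ.+ (N ∸ b) ℕ.+ b ≡ a ℕ.+ N
      d+b = ≡.trans (ℕₚ.+-assoc a (N ∸ b) b) (≡.cong (a ℕ.+_) (ℕₚ.m∸n+n≡m b≤N))
      N∤d : ¬ (N ∣ a ℕ.+ (N ∸ b))
      N∤d (divides zero    d≡) = ℕₚ.<⇒≢ 0<d (≡.sym d≡)
      N∤d (divides (suc zero) d≡) = a≢b (ℕₚ.+-cancelʳ-≡ N a b (≡.trans (≡.sym d+b)
        (≡.trans (≡.cong (ℕ._+ b) (≡.trans d≡ (ℕₚ.+-identityʳ N))) (ℕₚ.+-comm N b))))
      N∤d (divides (suc (suc q)) d≡) = ℕₚ.<⇒≱ a<N+b (ℕₚ.+-cancelʳ-≤ N (N ℕ.+ b) a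
        (≡.subst₂ ℕ._≤_ (≡.trans (ℕₚ.+-assoc N N b) (≡.trans (≡.cong (N ℕ.+_) (ℕₚ.+-comm N b)) (≡.sym (ℕₚ.+-assoc N b N)))) d+b
          (ℕₚ.+-monoˡ-≤ b (≡.subst (N ℕ.+ N ℕ.≤_) (≡.sym d≡) (ℕₚ.+-monoʳ-≤ N (ℕₚ.m≤m+n N _))))))

-- Residues modulo `N`.

module ModularArithmetic (N : ℕ) .{{_ : NonZero N}} where

  toℕ-mod : ∀ x → toℕ (x mod N) ≡ x % N
  toℕ-mod x = toℕ-fromℕ< (m%n<n x N)

  %-absorbˡ : ∀ x y → (x % N ℕ.+ y) % N ≡ (x ℕ.+ y) % N
  %-absorbˡ x y = ≡.trans (%-distribˡ-+ (x % N) y N)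
    (≡.trans (≡.cong (λ t → (t ℕ.+ y % N) % N) (m%n%n≡m%n x N)) (≡.sym (%-distribˡ-+ x y N)))

  %-cancel : ∀ x y z → y ℕ.+ z ≡ N → ((x ℕ.+ y) % N ℕ.+ z) % N ≡ x % N
  %-cancel x y z y+z≡N = ≡.trans (%-absorbˡ (x ℕ.+ y) z)
    (≡.trans (≡.cong (_% N) (≡.trans (ℕₚ.+-assoc x y z) (≡.cong (x ℕ.+_) y+z≡N))) ([m+n]%n≡m%n x N))

-- The incidence matrix of the hypercycle and its action on Hartley columns.

module Incidence {c ℓ₁ ℓ₂ ℓ₃} (ℝ : CompleteOrderedField c ℓ₁ ℓ₂ ℓ₃) where
  open CompleteOrderedField ℝ hiding (zero)
  open Spectral ℝ
  open IntegerCoefficients ℝ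
  open Determinant ℝ using (Id-diag; Id-off; ∑-Id; ∑-Idˡ)
  open Order ℝ
  open SequenceSums ℝ
  open Rotations ℝ
  open RotationSums ℝ
  open import Algebra.Properties.Semiring.Sum semiring
    using (sum-cong-≋; sum-replicate-zero; *-distribˡ-sum; *-distribʳ-sum; ∑-comm)
  open import Relation.Binary.Reasoning.Setoid setoid

  indicator : Bool → Carrier
  indicator b = if b then 1# else 0#

  indicator-∧ : ∀ a b → indicator (a ∧ b) ≈ indicator a * indicator b
  indicator-∧ true  b = sym (*-identityˡ _)
  indicator-∧ false b = sym (zeroˡ _)

  indicator-idem : ∀ a → indicator a * indicator a ≈ indicator a
  indicator-idem true  = *-identityˡ _
  indicator-idem false = zeroˡ _

  fromℕ-count : ∀ {a p} {A : Set a} {P : Pred A p} (P? : Decidable P) {n} (f : Fin n → A) →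
                fromℕ (length (filter P? (tabulate f))) ≈ ∑[ t < n ] indicator (does (P? (f t)))
  fromℕ-count P? {zero}  f = refl
  fromℕ-count P? {suc n} f with does (P? (f zero))
  ... | true  = +-congˡ (fromℕ-count P? (f ∘ suc))
  ... | false = trans (fromℕ-count P? (f ∘ suc)) (sym (+-identityˡ _))

  Id-⇔ : ∀ {m n} {p q : Fin m} {r s : Fin n} → (p ≡ q → r ≡ s) → (r ≡ s → p ≡ q) → Id p q ≡ Id r s
  Id-⇔ {p = p} {q} {r} {s} to from with p ≟ᶠ q
  ... | yes p≡q = ≡.sym (≡.trans (≡.cong (λ z → Id z s) (to p≡q)) (Id-diag s))
  ... | no  p≢q = ≡.sym (Id-off (p≢q ∘ from))

  -- The degree is computed as a sum in the field; this carries the result over to its reciprocal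
  -- directly, without a return to ℕ.
  recip-cong : ∀ {a b} .{{_ : NonZero a}} .{{_ : NonZero b}} → fromℕ a ≈ fromℕ b → recip a ≈ recip b
  recip-cong {a} {b} a≈b = *-cancelˡ-# (pos⇒# (fromℕ-pos′ b)) (begin
    fromℕ b * recip a  ≈⟨ *-comm _ _ ⟩
    recip a * fromℕ b  ≈⟨ *-congˡ a≈b ⟨
    recip a * fromℕ a  ≈⟨ recip-inverse a ⟩
    1#                 ≈⟨ recip-inverse b ⟨
    recip b * fromℕ b  ≈⟨ *-comm _ _ ⟩
    fromℕ b * recip b  ∎)

  module Hypercycle (N : ℕ) .{{_ : NonZero N}} (l : ℕ) .{{_ : NonZero l}}
    (2≤l : 2 ℕ.≤ l) (2l≤N : 2 ℕ.* l ℕ.≤ N) where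
    open ModularArithmetic N
    open Hypergraph (hypercycle N l 2≤l 2l≤N) using (deg; codeg)

    l≤N : l ℕ.≤ N
    l≤N = ℕₚ.≤-trans (ℕₚ.m≤m+n l (l ℕ.+ 0)) 2l≤N

    laplacian : Matrix N
    laplacian = normalizedLaplacian (hypercycle N l 2≤l 2l≤N) (hypercycle-noIsolated N l 2≤l 2l≤N)

    incidence : Fin N → Fin N → Carrier
    incidence i t = indicator (does (i ∈? arc N l t))

    -- Since `l ≤ N`, an arc passes each vertex at most once, so at most one of the `l` deltas is 1
    -- and the sum counts membership, not multiplicity.
    incidence≈Σ : ∀ i t → incidence i t ≈ Σ< l (λ a → Id ((toℕ t ℕ.+ a) mod N) i)
    incidence≈Σ i t with i ∈? arc N l t
    ... | no i∉ = sym (trans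
      (sum-cong-≋ {l} (λ a → reflexive (Id-off (λ p≡i → i∉ (∈arc⁺ (toℕ a) (toℕ<n a)
        (≡.trans (≡.cong toℕ (≡.sym p≡i)) (toℕ-mod _)))))))
      (sum-replicate-zero l))
    ... | yes i∈ with ∈arc⁻ i∈
    ...   | k , k<l , i≡ = sym (begin
      ∑[ a < l ] Id ((toℕ t ℕ.+ toℕ a) mod N) i
        ≈⟨ sum-cong-≋ {l} (λ a → trans (reflexive (Id-⇔ (hit⇒≡ a) (≡⇒hit a))) (sym (*-identityˡ _))) ⟩
      ∑[ a < l ] (1# * Id a (fromℕ< k<l))
        ≈⟨ ∑-Id {l} (λ _ → 1#) (fromℕ< k<l) ⟩
      1# ∎)
      where
      -- Adding `N - t` undoes the start `t`, and `a < l ≤ N` is its own remainder.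
      unshift : ∀ a → a ℕ.< l → ((toℕ t ℕ.+ a) % N ℕ.+ (N ∸ toℕ t)) % N ≡ a
      unshift a a<l = ≡.trans (≡.cong (λ x → (x % N ℕ.+ (N ∸ toℕ t)) % N) (ℕₚ.+-comm (toℕ t) a))
        (≡.trans (%-cancel a (toℕ t) (N ∸ toℕ t) (ℕₚ.m+[n∸m]≡n (ℕₚ.<⇒≤ (toℕ<n t))))
          (m<n⇒m%n≡m (ℕₚ.<-≤-trans a<l l≤N)))
      hit⇒≡ : ∀ a → (toℕ t ℕ.+ toℕ a) mod N ≡ i → a ≡ fromℕ< k<l
      hit⇒≡ a p≡i = toℕ-injective (≡.trans (≡.sym (unshift (toℕ a) (toℕ<n a)))
        (≡.trans (≡.cong (λ x → (x ℕ.+ (N ∸ toℕ t)) % N) (≡.trans (≡.sym (toℕ-mod _)) (≡.trans (≡.cong toℕ p≡i) i≡)))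
          (≡.trans (unshift k k<l) (≡.sym (toℕ-fromℕ< k<l)))))
      ≡⇒hit : ∀ a → a ≡ fromℕ< k<l → (toℕ t ℕ.+ toℕ a) mod N ≡ i
      ≡⇒hit a ≡.refl = toℕ-injective (≡.trans (toℕ-mod _)
        (≡.trans (≡.cong (λ x → (toℕ t ℕ.+ x) % N) (toℕ-fromℕ< k<l)) (≡.sym i≡)))

    module _ {V : ℕ → Carrier} (V-% : ∀ x → V (x % N) ≈ V x) where

      incidenceᵀ-sum : ∀ t → ∑[ i < N ] (incidence i t * V (toℕ i)) ≈ Σ< l (λ a → V (toℕ t ℕ.+ a))
      incidenceᵀ-sum t = begin
        ∑[ i < N ] (incidence i t * V (toℕ i))
          ≈⟨ sum-cong-≋ {N} (λ i → trans (*-congʳ (incidence≈Σ i t))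
               (*-distribʳ-sum {l} (V (toℕ i)) (λ a → Id ((toℕ t ℕ.+ toℕ a) mod N) i))) ⟩
        ∑[ i < N ] ∑[ a < l ] (Id ((toℕ t ℕ.+ toℕ a) mod N) i * V (toℕ i))
          ≈⟨ ∑-comm {N} {l} (λ i a → Id ((toℕ t ℕ.+ toℕ a) mod N) i * V (toℕ i)) ⟩
        ∑[ a < l ] ∑[ i < N ] (Id ((toℕ t ℕ.+ toℕ a) mod N) i * V (toℕ i))
          ≈⟨ sum-cong-≋ {l} (λ a → trans (∑-Idˡ {N} (λ i → V (toℕ i)) ((toℕ t ℕ.+ toℕ a) mod N))
               (trans (reflexive (≡.cong V (toℕ-mod _))) (V-% (toℕ t ℕ.+ toℕ a)))) ⟩
        Σ< l (λ a → V (toℕ t ℕ.+ a)) ∎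

      -- The hyperedges through `i` are those starting at `i - b` with `b < l`; `N ∸ b` replaces
      -- `- b`.
      incidence-sum : ∀ i → ∑[ t < N ] (incidence i t * V (toℕ t)) ≈ Σ< l (λ b → V (toℕ i ℕ.+ (N ∸ b)))
      incidence-sum i = begin
        ∑[ t < N ] (incidence i t * V (toℕ t))
          ≈⟨ sum-cong-≋ {N} (λ t → trans (*-congʳ (incidence≈Σ i t))
               (*-distribʳ-sum {l} (V (toℕ t)) (λ a → Id ((toℕ t ℕ.+ toℕ a) mod N) i))) ⟩
        ∑[ t < N ] ∑[ a < l ] (Id ((toℕ t ℕ.+ toℕ a) mod N) i * V (toℕ t))
          ≈⟨ ∑-comm {N} {l} (λ t a → Id ((toℕ t ℕ.+ toℕ a) mod N) i * V (toℕ t)) ⟩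
        ∑[ a < l ] ∑[ t < N ] (Id ((toℕ t ℕ.+ toℕ a) mod N) i * V (toℕ t))
          ≈⟨ sum-cong-≋ {l} (λ a → sum-cong-≋ {N} (λ t → *-congʳ (reflexive (Id-⇔ (forth a t) (back a t))))) ⟩
        ∑[ a < l ] ∑[ t < N ] (Id ((toℕ i ℕ.+ (N ∸ toℕ a)) mod N) t * V (toℕ t))
          ≈⟨ sum-cong-≋ {l} (λ a → trans (∑-Idˡ {N} (λ t → V (toℕ t)) ((toℕ i ℕ.+ (N ∸ toℕ a)) mod N))
               (trans (reflexive (≡.cong V (toℕ-mod _))) (V-% (toℕ i ℕ.+ (N ∸ toℕ a))))) ⟩
        Σ< l (λ b → V (toℕ i ℕ.+ (N ∸ b))) ∎
        where
        a≤N : ∀ (a : Fin l) → toℕ a ℕ.≤ N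
        a≤N a = ℕₚ.≤-trans (ℕₚ.<⇒≤ (toℕ<n a)) l≤N
        forth : ∀ a t → (toℕ t ℕ.+ toℕ a) mod N ≡ i → (toℕ i ℕ.+ (N ∸ toℕ a)) mod N ≡ t
        forth a t ≡.refl = toℕ-injective (≡.trans (toℕ-mod _)
          (≡.trans (≡.cong (λ x → (x ℕ.+ (N ∸ toℕ a)) % N) (toℕ-mod _))
            (≡.trans (%-cancel (toℕ t) (toℕ a) (N ∸ toℕ a) (ℕₚ.m+[n∸m]≡n (a≤N a))) (m<n⇒m%n≡m (toℕ<n t)))))
        back : ∀ a t → (toℕ i ℕ.+ (N ∸ toℕ a)) mod N ≡ t → (toℕ t ℕ.+ toℕ a) mod N ≡ i
        back a t ≡.refl = toℕ-injective (≡.trans (toℕ-mod _)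
          (≡.trans (≡.cong (λ x → (x ℕ.+ toℕ a) % N) (toℕ-mod _))
            (≡.trans (%-cancel (toℕ i) (N ∸ toℕ a) (toℕ a) (ℕₚ.m∸n+n≡m (a≤N a))) (m<n⇒m%n≡m (toℕ<n i)))))

    deg≈Σ : ∀ i → fromℕ (deg i) ≈ ∑[ t < N ] incidence i t
    deg≈Σ i = fromℕ-count (i ∈?_) (arc N l)

    codeg≈Σ : ∀ i j → fromℕ (codeg i j) ≈ ∑[ t < N ] (incidence i t * incidence j t)
    codeg≈Σ i j = trans (fromℕ-count (λ h → (i ∈? h) ×-dec (j ∈? h)) (arc N l))
      (sum-cong-≋ {N} (λ t → indicator-∧ (does (i ∈? arc N l t)) (does (j ∈? arc N l t))))

    deg≈l : ∀ i → fromℕ (deg i) ≈ fromℕ l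
    deg≈l i = begin
      fromℕ (deg i)                            ≈⟨ deg≈Σ i ⟩
      ∑[ t < N ] incidence i t                 ≈⟨ sum-cong-≋ {N} (λ t → sym (*-identityʳ (incidence i t))) ⟩
      ∑[ t < N ] (incidence i t * 1#)          ≈⟨ incidence-sum {λ _ → 1#} (λ _ → refl) i ⟩
      Σ< l (λ _ → 1#)                          ≈⟨ Σ<-1 l ⟩
      fromℕ l                                  ∎

    deg≢0 : ∀ i → NonZero (deg i)
    deg≢0 = hypercycle-noIsolated N l 2≤l 2l≤N

    recip-deg : ∀ i → recip (deg i) {{deg≢0 i}} ≈ recip l
    recip-deg i = recip-cong {{deg≢0 i}} (deg≈l i)

    -- Off the diagonal the sign of the adjacency matrix cancels that in `Id - D⁻¹A`. On it,
    -- `1 = deg / l`, and the degree is a sum of squares because indicators are idempotent.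
    laplacian≈ : ∀ i j → laplacian i j ≈ recip l * (∑[ t < N ] (incidence i t * incidence j t))
    laplacian≈ i j with i ≟ᶠ j
    ... | yes ≡.refl = begin
      1# - 0# * recip (deg i) {{deg≢0 i}}      ≈⟨ solve 1 (λ r → con (+ 1) :- con (+ 0) :* r := con (+ 1)) refl _ ⟩
      1#                                       ≈⟨ recip-inverse l ⟨
      recip l * fromℕ l                        ≈⟨ *-congˡ (deg≈l i) ⟨
      recip l * fromℕ (deg i)                  ≈⟨ *-congˡ (deg≈Σ i) ⟩
      recip l * (∑[ t < N ] incidence i t)     ≈⟨ *-congˡ (sum-cong-≋ {N} (λ t → indicator-idem (does (i ∈? arc N l t)))) ⟨
      recip l * (∑[ t < N ] (incidence i t * incidence i t)) ∎
    ... | no _ = begin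
      0# - fromℤ (ℤ.- (+ codeg i j)) * recip (deg i) {{deg≢0 i}}
        ≈⟨ +-congˡ (-‿cong (*-cong (fromℤ-neg (+ codeg i j)) (recip-deg i))) ⟩
      0# - (- fromℕ (codeg i j)) * recip l
        ≈⟨ solve 2 (λ x r → con (+ 0) :- (:- x) :* r := r :* x) refl _ _ ⟩
      recip l * fromℕ (codeg i j)
        ≈⟨ *-congˡ (codeg≈Σ i j) ⟩
      recip l * (∑[ t < N ] (incidence i t * incidence j t)) ∎
      where import Data.Integer.Base as ℤ

    laplacian-sym : ∀ i j → laplacian i j ≈ laplacian j i
    laplacian-sym i j = trans (laplacian≈ i j) (trans (*-congˡ (sum-cong-≋ {N} (λ t → *-comm _ _))) (sym (laplacian≈ j i)))

    module _ {C S} (rot : IsRotation C S) (N-period : IsRotation.IsPeriod rot N) where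
      open IsRotation rot
      private
        V V′ : ℕ → Carrier
        V x  = C x + S x
        V′ x = C x - S x
        X = Σ< l C
        Y = Σ< l S

      periodic-% : ∀ {f : ℕ → Carrier} → (∀ q x → f (q ℕ.* N ℕ.+ x) ≈ f x) → ∀ x → f (x % N) ≈ f x
      periodic-% {f} f-period x = trans (sym (f-period (x / N) (x % N)))
        (reflexive (≡.cong f (≡.trans (ℕₚ.+-comm (x / N ℕ.* N) (x % N)) (≡.sym (m≡m%n+[m/n]*n x N)))))

      C-qN : ∀ q x → C (q ℕ.* N ℕ.+ x) ≈ C x
      C-qN q = C-period (period-* q N-period)

      S-qN : ∀ q x → S (q ℕ.* N ℕ.+ x) ≈ S x
      S-qN q = S-period (period-* q N-period)

      V-qN : ∀ q x → V (q ℕ.* N ℕ.+ x) ≈ V x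
      V-qN q x = +-cong (C-qN q x) (S-qN q x)

      -- `Bᵀ V`, as a function on all of ℕ so that its periodicity can be stated and a second
      -- incidence sum applied.
      W : ℕ → Carrier
      W t = Σ< l (λ a → V (t ℕ.+ a))

      W-qN : ∀ q x → W (q ℕ.* N ℕ.+ x) ≈ W x
      W-qN q x = Σ<-cong l (λ a → trans (reflexive (≡.cong V (ℕₚ.+-assoc (q ℕ.* N) x a))) (V-qN q (x ℕ.+ a)))

      -- The dependence on `b` is isolated in `C b` and `S b`, so that summing over `b < l` produces
      -- `X` and `Y` a second time.
      W-reflected : ∀ i {b} → b ℕ.≤ N →
        W (i ℕ.+ (N ∸ b)) ≈ (V i * X + V′ i * Y) * C b + (V i * Y - V′ i * X) * S b
      W-reflected i {b} b≤N = begin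
        Σ< l (λ a → V (i ℕ.+ (N ∸ b) ℕ.+ a))
          ≈⟨ Σ<-cong l expand ⟩
        Σ< l (λ a → (V i * C b - V′ i * S b) * C a + (V i * S b + V′ i * C b) * S a)
          ≈⟨ Σ<-linear l _ C _ S ⟩
        (V i * C b - V′ i * S b) * X + (V i * S b + V′ i * C b) * Y
          ≈⟨ solve 6 (λ v w c s X Y → (v :* c :- w :* s) :* X :+ (v :* s :+ w :* c) :* Y
               := (v :* X :+ w :* Y) :* c :+ (v :* Y :- w :* X) :* s) refl (V i) (V′ i) (C b) (S b) X Y ⟩
        (V i * X + V′ i * Y) * C b + (V i * Y - V′ i * X) * S b ∎
        where
        period : IsPeriod (b ℕ.+ (N ∸ b))
        period = ≡.subst IsPeriod (≡.sym (ℕₚ.m+[n∸m]≡n b≤N)) N-period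
        expand : ∀ a → V (i ℕ.+ (N ∸ b) ℕ.+ a) ≈ (V i * C b - V′ i * S b) * C a + (V i * S b + V′ i * C b) * S a
        expand a = begin
          C (i ℕ.+ (N ∸ b) ℕ.+ a) + S (i ℕ.+ (N ∸ b) ℕ.+ a)
            ≈⟨ +-cong (C-+ _ _) (S-+ _ _) ⟩
          C (i ℕ.+ (N ∸ b)) * C a - S (i ℕ.+ (N ∸ b)) * S a + (S (i ℕ.+ (N ∸ b)) * C a + C (i ℕ.+ (N ∸ b)) * S a)
            ≈⟨ solve 4 (λ c s d t → c :* d :- s :* t :+ (s :* d :+ c :* t) := (c :+ s) :* d :+ (c :- s) :* t) refl _ _ _ _ ⟩
          (C (i ℕ.+ (N ∸ b)) + S (i ℕ.+ (N ∸ b))) * C a + (C (i ℕ.+ (N ∸ b)) - S (i ℕ.+ (N ∸ b))) * S a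
            ≈⟨ +-cong (*-congʳ (+-cong cb sb)) (*-congʳ (+-cong cb (-‿cong sb))) ⟩
          (C i * C b + S i * S b + (S i * C b - C i * S b)) * C a + (C i * C b + S i * S b - (S i * C b - C i * S b)) * S a
            ≈⟨ solve 6 (λ c s d t x y →
                 (c :* d :+ s :* t :+ (s :* d :- c :* t)) :* x :+ (c :* d :+ s :* t :- (s :* d :- c :* t)) :* y
                 := ((c :+ s) :* d :- (c :- s) :* t) :* x :+ ((c :+ s) :* t :+ (c :- s) :* d) :* y) refl
                 (C i) (S i) (C b) (S b) (C a) (S a) ⟩
          (V i * C b - V′ i * S b) * C a + (V i * S b + V′ i * C b) * S a ∎
          where
          cb : C (i ℕ.+ (N ∸ b)) ≈ C i * C b + S i * S b
          cb = trans (C-+ i (N ∸ b)) (trans (+-cong (*-congˡ (C-reflect rot period)) (-‿cong (*-congˡ (S-reflect rot period))))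
            (solve 4 (λ c s d t → c :* d :- s :* (:- t) := c :* d :+ s :* t) refl (C i) (S i) (C b) (S b)))
          sb : S (i ℕ.+ (N ∸ b)) ≈ S i * C b - C i * S b
          sb = trans (S-+ i (N ∸ b)) (trans (+-cong (*-congˡ (C-reflect rot period)) (*-congˡ (S-reflect rot period)))
            (solve 4 (λ c s d t → s :* d :+ c :* (:- t) := s :* d :- c :* t) refl (C i) (S i) (C b) (S b)))

      -- The contributions `v′ Y X` and `- v′ X Y` of the reflected column cancel, leaving `v` times
      -- `X² + Y²`.
      laplacian-cas : ∀ i → ∑[ j < N ] (laplacian i j * V (toℕ j)) ≈ (X * X + Y * Y) * recip l * V (toℕ i)
      laplacian-cas i = begin
        ∑[ j < N ] (laplacian i j * V (toℕ j))
          ≈⟨ sum-cong-≋ {N} (λ j → trans (*-congʳ (laplacian≈ i j)) (*-assoc (recip l) _ _)) ⟩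
        ∑[ j < N ] (recip l * ((∑[ t < N ] (incidence i t * incidence j t)) * V (toℕ j)))
          ≈⟨ *-distribˡ-sum {N} (recip l) (λ j → (∑[ t < N ] (incidence i t * incidence j t)) * V (toℕ j)) ⟨
        recip l * (∑[ j < N ] ((∑[ t < N ] (incidence i t * incidence j t)) * V (toℕ j)))
          ≈⟨ *-congˡ (sum-cong-≋ {N} (λ j → trans (*-distribʳ-sum {N} (V (toℕ j)) (λ t → incidence i t * incidence j t))
               (sum-cong-≋ {N} (λ t → *-assoc (incidence i t) (incidence j t) (V (toℕ j)))))) ⟩
        recip l * (∑[ j < N ] ∑[ t < N ] (incidence i t * (incidence j t * V (toℕ j))))
          ≈⟨ *-congˡ (∑-comm {N} {N} (λ j t → incidence i t * (incidence j t * V (toℕ j)))) ⟩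
        recip l * (∑[ t < N ] ∑[ j < N ] (incidence i t * (incidence j t * V (toℕ j))))
          ≈⟨ *-congˡ (sum-cong-≋ {N} (λ t → trans (sym (*-distribˡ-sum {N} (incidence i t) (λ j → incidence j t * V (toℕ j))))
               (*-congˡ (incidenceᵀ-sum (periodic-% V-qN) t)))) ⟩
        recip l * (∑[ t < N ] (incidence i t * W (toℕ t)))
          ≈⟨ *-congˡ (incidence-sum (periodic-% W-qN) i) ⟩
        recip l * Σ< l (λ b → W (toℕ i ℕ.+ (N ∸ b)))
          ≈⟨ *-congˡ (sum-cong-≋ {l} (λ b → W-reflected (toℕ i) (ℕₚ.≤-trans (ℕₚ.<⇒≤ (toℕ<n b)) l≤N))) ⟩
        recip l * Σ< l (λ b → (v * X + v′ * Y) * C b + (v * Y - v′ * X) * S b)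
          ≈⟨ *-congˡ (Σ<-linear l (v * X + v′ * Y) C (v * Y - v′ * X) S) ⟩
        recip l * ((v * X + v′ * Y) * X + (v * Y - v′ * X) * Y)
          ≈⟨ solve 5 (λ r v w X Y → r :* ((v :* X :+ w :* Y) :* X :+ (v :* Y :- w :* X) :* Y) := (X :* X :+ Y :* Y) :* r :* v) refl
               (recip l) v v′ X Y ⟩
        (X * X + Y * Y) * recip l * v ∎
        where
        v  = V (toℕ i)
        v′ = V′ (toℕ i)

-- The weights `m(r)` as two mirrored Fejér sums.

module CosineKernel {c ℓ₁ ℓ₂ ℓ₃} (ℝ : CompleteOrderedField c ℓ₁ ℓ₂ ℓ₃) where
  open CompleteOrderedField ℝ hiding (zero)
  open Spectral ℝ
  open IntegerCoefficients ℝ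
  open SequenceSums ℝ
  open Rotations ℝ
  open RotationSums ℝ
  open import Algebra.Properties.Semiring.Sum semiring using (sum-cong-≋)
  open import Relation.Binary.Reasoning.Setoid setoid

  fromℤ-∸ : ∀ {m n} → n ℕ.≤ m → fromℤ (+ m ℤ.- + n) ≈ fromℕ (m ∸ n)
  fromℤ-∸ {m} {n} n≤m = reflexive (≡.cong fromℤ (≡.trans (ℤₚ.m-n≡m⊖n m n) (ℤₚ.⊖-≥ n≤m)))

  module _ (l : ℕ) where

    -- Truncated subtraction gives 0 from `l` on. The value at 0 is 0 and not `l`, because `r = N`
    -- reflects to 0 and `m(N) = 0`.
    weight : ℕ → Carrier
    weight zero    = 0#
    weight (suc j) = fromℕ (l ∸ suc j)

    weight-≥ : ∀ j → l ℕ.≤ j → weight j ≈ 0#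
    weight-≥ zero    _   = refl
    weight-≥ (suc j) l≤j = reflexive (≡.cong fromℕ (ℕₚ.m≤n⇒m∸n≡0 l≤j))

    -- The ranges are disjoint, so at most one branch contributes, and each weight is 0 where its
    -- branch fails; the nested choice is therefore a sum.
    weights : ∀ r k → (suc r ℕ.< l → l ℕ.≤ k) →
      fromℤ (if does ((0 ℕₚ.<? suc r) ×-dec (suc r ℕₚ.<? l)) then + l ℤ.- + suc r else
             if does ((0 ℕₚ.<? k) ×-dec (k ℕₚ.<? l)) then + l ℤ.- + k else
             + 0) ≈ weight (suc r) + weight k
    weights r k disjoint with suc r ℕₚ.<? l
    weights r k       disjoint | yes r<l rewrite dec-true (suc r ℕₚ.<? l) r<l = trans (fromℤ-∸ (ℕₚ.<⇒≤ r<l))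
      (sym (trans (+-congˡ (weight-≥ k (disjoint r<l))) (+-identityʳ _)))
    weights r zero    disjoint | no r≮l rewrite dec-false (suc r ℕₚ.<? l) r≮l = sym (trans (+-identityʳ _) (weight-≥ (suc r) (ℕₚ.≮⇒≥ r≮l)))
    weights r (suc k) disjoint | no r≮l rewrite dec-false (suc r ℕₚ.<? l) r≮l with suc k ℕₚ.<? l
    ... | yes k<l rewrite dec-true (suc k ℕₚ.<? l) k<l = trans (fromℤ-∸ (ℕₚ.<⇒≤ k<l)) (sym (trans (+-congʳ (weight-≥ (suc r) (ℕₚ.≮⇒≥ r≮l))) (+-identityˡ _)))
    ... | no  k≮l rewrite dec-false (suc k ℕₚ.<? l) k≮l = sym (trans (+-cong (weight-≥ (suc r) (ℕₚ.≮⇒≥ r≮l)) (weight-≥ (suc k) (ℕₚ.≮⇒≥ k≮l))) (+-identityˡ 0#))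

    module _ {C S} (rot : IsRotation C S) where

      Σ<-weight-suc : ∀ {N} → l ℕ.≤ N → Σ< N (λ k → weight (suc k) * C (suc k)) ≈ fejer rot l
      Σ<-weight-suc l≤N = Σ<-truncate (λ k → weight (suc k) * C (suc k)) l≤N
        (λ k l≤k → trans (*-congʳ (weight-≥ (suc k) (ℕₚ.m≤n⇒m≤1+n l≤k))) (zeroˡ _))

      Σ<-weight : ∀ {N} → l ℕ.< N → Σ< N (λ k → weight k * C k) ≈ fejer rot l
      Σ<-weight {suc N} (ℕ.s≤s l≤N) = trans (+-cong (zeroˡ (C 0)) (Σ<-weight-suc l≤N)) (+-identityˡ _)

      -- The terms weighted by `N - r` are folded back by `r ↦ N - r`, under which `C` is invariant;
      -- both halves become the same Fejér sum.
      Σ-m : ∀ {N} → IsRotation.IsPeriod rot N → 2 ℕ.≤ l → 2 ℕ.* l ℕ.≤ N →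
            ∑[ k < N ] (fromℤ (m N l (suc k)) * C (toℕ (suc k))) ≈ fromℕ 2 * fejer rot l
      Σ-m {N} N-period 2≤l 2l≤N = begin
        ∑[ k < N ] (fromℤ (m N l (suc k)) * C (suc (toℕ k)))
          ≈⟨ sum-cong-≋ {N} (λ k → trans (*-congʳ (weights (toℕ k) (N ∸ suc (toℕ k)) (disjoint (toℕ k)))) (reflect k)) ⟩
        Σ< N (λ k → weight (suc k) * C (suc k) + weight (N ∸ suc k) * C (N ∸ suc k))
          ≈⟨ Σ<-+ N (λ k → weight (suc k) * C (suc k)) (λ k → weight (N ∸ suc k) * C (N ∸ suc k)) ⟩
        Σ< N (λ k → weight (suc k) * C (suc k)) + Σ< N (λ k → weight (N ∸ suc k) * C (N ∸ suc k))
          ≈⟨ +-cong (Σ<-weight-suc (ℕₚ.<⇒≤ l<N)) (trans (sym (Σ<-reverse N (λ k → weight k * C k))) (Σ<-weight l<N)) ⟩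
        fejer rot l + fejer rot l
          ≈⟨ solve 1 (λ x → x :+ x := con (+ 2) :* x) refl _ ⟩
        fromℕ 2 * fejer rot l ∎
        where
        l+l≤N : l ℕ.+ l ℕ.≤ N
        l+l≤N = ≡.subst (ℕ._≤ N) (≡.cong (l ℕ.+_) (ℕₚ.+-identityʳ l)) 2l≤N
        l<N : l ℕ.< N
        l<N = ℕₚ.<-≤-trans (ℕₚ.m<m+n l (ℕₚ.<-≤-trans (ℕ.s≤s ℕ.z≤n) 2≤l)) l+l≤N
        disjoint : ∀ r → suc r ℕ.< l → l ℕ.≤ N ∸ suc r
        disjoint r r<l = ℕₚ.m+n≤o⇒m≤o∸n l (ℕₚ.≤-trans (ℕₚ.+-monoʳ-≤ l (ℕₚ.<⇒≤ r<l)) l+l≤N)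
        reflect : ∀ k → (weight (suc (toℕ k)) + weight (N ∸ suc (toℕ k))) * C (suc (toℕ k))
                        ≈ weight (suc (toℕ k)) * C (suc (toℕ k)) + weight (N ∸ suc (toℕ k)) * C (N ∸ suc (toℕ k))
        reflect k = trans (distribʳ _ _ _) (+-congˡ (*-congˡ (C-reflect rot
          (≡.subst (IsRotation.IsPeriod rot) (≡.sym (ℕₚ.m∸n+n≡m (toℕ<n k))) N-period))))

-- Diagonalisation of the Laplacian by the Hartley matrix.

module HypercycleSpectrum {c ℓ₁ ℓ₂ ℓ₃} (ℝ : CompleteOrderedField c ℓ₁ ℓ₂ ℓ₃)
  (cos : CompleteOrderedField.Carrier ℝ → CompleteOrderedField.Carrier ℝ)
  (isCos : Spectral.IsCos ℝ cos)
  (π : CompleteOrderedField.Carrier ℝ) (isPi : Spectral.IsPi ℝ cos π)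
  (N : ℕ) .{{_ : NonZero N}} (l : ℕ) (2≤l : 2 ℕ.≤ l) (2l≤N : 2 ℕ.* l ℕ.≤ N) where
  open CompleteOrderedField ℝ hiding (zero)
  open Spectral ℝ
  open IntegerCoefficients ℝ
  open Determinant ℝ
  open Order ℝ
  open SequenceSums ℝ
  open Rotations ℝ
  open RotationSums ℝ
  open CosineKernel ℝ
  open Cosine ℝ cos isCos using (cos-cong)
  open Trigonometry ℝ cos isCos π isPi
  open RootsOfUnity N
  open import Algebra.Properties.Semiring.Sum semiring
    using (sum-cong-≋; *-distribˡ-sum; *-distribʳ-sum; ∑-comm)
  open import Algebra.Properties.CommutativeMonoid.Sum *-commutativeMonoid
    using () renaming (sum-cong-≋ to product-cong)
  open import Relation.Binary.Reasoning.Setoid setoid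

  private instance
    l≢0 : NonZero l
    l≢0 = ℕ.>-nonZero (ℕₚ.<⇒≤ 2≤l)

  open Incidence.Hypercycle ℝ N l 2≤l 2l≤N

  rotation₄ : IsRotation (λ k → c₄ (4 ℕ.* k)) (λ k → s₄ (4 ℕ.* k))
  rotation₄ = rotation-multiple 4 rotation

  open Hartley rotation₄ {N} period-4N non-period

  -- Vertices run over `0, …, N - 1` but frequencies over `1, …, N`, to match the indexing of the
  -- eigenvalues. So indexed, the matrix is not symmetric in general, and `gram` and `gramᵀ` are
  -- separate statements.
  hartley : Matrix N
  hartley j k = cas (suc (toℕ k) ℕ.* toℕ j)

  spectrum : Fin N → Carrier
  spectrum k = hypercycleEigenvalue cos π N l (toℕ (suc k))

  spectrum≈ : ∀ k → let rot = rotation-multiple (suc (toℕ k)) rotation₄ in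
    spectrum k ≈ (fromℕ l + fromℕ 2 * fejer rot l) * recip l
  spectrum≈ k = begin
    1# + (∑[ r < N ] (fromℤ (m N l (suc r)) * cos (angle (toℕ (suc r))))) * recip l
      ≈⟨ +-congˡ (*-congʳ (trans (sum-cong-≋ {N} (λ r → *-congˡ (cos-cong (angle≈ (toℕ (suc r))))))
           (Σ-m l rot (multiple-period i) 2≤l 2l≤N))) ⟩
    1# + fromℕ 2 * fejer rot l * recip l
      ≈⟨ +-congʳ (recip-inverse l) ⟨
    recip l * fromℕ l + fromℕ 2 * fejer rot l * recip l
      ≈⟨ solve 3 (λ r n x → r :* n :+ x :* r := (n :+ x) :* r) refl _ _ _ ⟩
    (fromℕ l + fromℕ 2 * fejer rot l) * recip l ∎
    where
    i   = suc (toℕ k)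
    rot = rotation-multiple i rotation₄
    angle : ℕ → Carrier
    angle r = fromℕ 2 * π * fromℕ i * fromℕ r * recip N
    -- As `2π = 4h`, the angle `2πir/N` consists of `4ir` steps of size `h/N`.
    angle≈ : ∀ r → angle r ≈ η * fromℕ (4 ℕ.* (i ℕ.* r))
    angle≈ r = begin
      fromℕ 2 * π * fromℕ i * fromℕ r * recip N
        ≈⟨ *-congʳ (*-congʳ (*-congʳ (*-congˡ 2h))) ⟨
      fromℕ 2 * (fromℕ 2 * h) * fromℕ i * fromℕ r * recip N
        ≈⟨ solve 4 (λ h i r q → con (+ 2) :* (con (+ 2) :* h) :* i :* r :* q := h :* q :* (con (+ 4) :* (i :* r))) refl
             h (fromℕ i) (fromℕ r) (recip N) ⟩
      h * recip N * (fromℕ 4 * (fromℕ i * fromℕ r))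
        ≈⟨ *-congˡ (trans (fromℕ-* 4 (i ℕ.* r)) (*-congˡ (fromℕ-* i r))) ⟨
      η * fromℕ (4 ℕ.* (i ℕ.* r)) ∎

  laplacian-hartley : ∀ i k → ∑[ j < N ] (laplacian i j * hartley j k) ≈ spectrum k * hartley i k
  laplacian-hartley i k = trans
    (laplacian-cas (rotation-multiple (suc (toℕ k)) rotation₄) (multiple-period (suc (toℕ k))) i)
    (*-congʳ (trans (*-congʳ (modulus² (rotation-multiple (suc (toℕ k)) rotation₄) l)) (sym (spectrum≈ k))))

  gram : ∀ i k → ∑[ j < N ] (hartley j i * hartley j k) ≈ fromℕ N * Id i k
  gram i k with i ≟ᶠ k
  ... | yes ≡.refl = trans (cas-norm (toℕ<n i)) (sym (*-identityʳ _))
  ... | no  i≢k    = trans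
    (cas-orthogonal (i≢k ∘ toℕ-injective ∘ ℕₚ.suc-injective) (toℕ<n k) (ℕ.s≤s ℕ.z≤n)
      (ℕₚ.≤-<-trans (toℕ<n i) (ℕₚ.m<m+n N (ℕ.s≤s ℕ.z≤n))))
    (sym (zeroʳ _))

  gramᵀ : ∀ i k → ∑[ j < N ] (hartley i j * hartley k j) ≈ fromℕ N * Id i k
  gramᵀ i k = begin
    Σ< N (λ j → cas (suc j ℕ.* toℕ i) * cas (suc j ℕ.* toℕ k))
      -- Periodicity moves the frequencies `1, …, N` to `0, …, N - 1`, after which frequency and
      -- position can exchange roles.
      ≈⟨ Σ<-shift N (λ j → cas (j ℕ.* toℕ i) * cas (j ℕ.* toℕ k)) (*-cong (cas-N* (toℕ i)) (cas-N* (toℕ k))) ⟩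
    Σ< N (λ j → cas (j ℕ.* toℕ i) * cas (j ℕ.* toℕ k))
      ≈⟨ Σ<-cong N (λ j → reflexive (≡.cong₂ (λ x y → cas x * cas y) (ℕₚ.*-comm j (toℕ i)) (ℕₚ.*-comm j (toℕ k)))) ⟩
    Σ< N (λ j → cas (toℕ i ℕ.* j) * cas (toℕ k ℕ.* j))
      ≈⟨ orthogonal ⟩
    fromℕ N * Id i k ∎
    where
    cas-N* : ∀ x → cas (N ℕ.* x) ≈ cas 0
    cas-N* x = let C≈1 , S≈0 = IsRotation.period-* rotation₄ x period-4N in
      trans (reflexive (≡.cong cas (ℕₚ.*-comm N x)))
        (+-cong (trans C≈1 (sym (IsRotation.C-0 rotation₄))) (trans S≈0 (sym (IsRotation.S-0 rotation₄))))
    orthogonal : Σ< N (λ j → cas (toℕ i ℕ.* j) * cas (toℕ k ℕ.* j)) ≈ fromℕ N * Id i k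
    orthogonal with i ≟ᶠ k
    ... | yes ≡.refl = trans (cas-norm (ℕₚ.<⇒≤ (toℕ<n i))) (sym (*-identityʳ _))
    ... | no  i≢k    = trans
      (cas-orthogonal (i≢k ∘ toℕ-injective) (ℕₚ.<⇒≤ (toℕ<n k))
        (ℕₚ.<-≤-trans (ℕₚ.m<n⇒0<n∸m (toℕ<n k)) (ℕₚ.m≤n+m _ (toℕ i)))
        (ℕₚ.<-≤-trans (toℕ<n i) (ℕₚ.m≤m+n N (toℕ k))))
      (sym (zeroʳ _))

  N#0 : fromℕ N # 0#
  N#0 = pos⇒# (fromℕ-pos′ N)

  *-#⇒#ʳ : ∀ {x y} → x * y # 0# → y # 0#
  *-#⇒#ʳ {x} {y} xy#0 = let r , rxy≈1 = #⇒inverse xy#0 in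
    inverse⇒# (r * x) (trans (*-assoc _ _ _) rxy≈1)

  -- Cotransitivity with `y` as third point: either `x + y # y`, which amounts to `x # 0#`, or
  -- `y # 0#`.
  +-#⇒# : ∀ {x y} → x + y # 0# → x # 0# ⊎ y # 0#
  +-#⇒# {x} {y} x+y#0 with #-cotrans x+y#0 y
  ... | inj₂ y#0   = inj₂ y#0
  ... | inj₁ x+y#y = let r , r[x+y-y]≈1 , _ = #⇒invertible x+y#y in
    inj₁ (inverse⇒# r (trans (*-congˡ (solve 2 (λ x y → x := x :+ y :- y) refl x y)) r[x+y-y]≈1))

  -- This delivers an actual index, which goes on to name the eigenvalue; refuting that all terms
  -- vanish would not.
  ∑-#⇒# : ∀ n {f : Fin n → Carrier} → ∑[ k < n ] f k # 0# → ∃[ k ] f k # 0#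
  ∑-#⇒# zero    0#0 = contradiction 0#0 (≈0⇒¬#0 refl)
  ∑-#⇒# (suc n) f#0 with +-#⇒# f#0
  ... | inj₁ f₀#0 = zero , f₀#0
  ... | inj₂ ∑#0  = let k , fk#0 = ∑-#⇒# n ∑#0 in suc k , fk#0

  spectrum⇒eigenvalue : ∀ {μ} → ∃[ k ] μ ≈ spectrum k → IsEigenvalue laplacian μ
  spectrum⇒eigenvalue (k , μ≈) =
      (λ j → hartley j k)
    -- Every column has the entry `cas 0 = 1` at vertex 0.
    , (fromℕ< 0<N , #-congʳ (sym at-0) 1#0)
    , λ i → trans (laplacian-hartley i k) (*-congʳ (sym μ≈))
    where
    0<N : 0 ℕ.< N
    0<N = ℕ.>-nonZero⁻¹ N
    at-0 : hartley (fromℕ< 0<N) k ≈ 1#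
    at-0 = trans (reflexive (≡.cong cas (≡.trans (≡.cong (suc (toℕ k) ℕ.*_) (toℕ-fromℕ< 0<N)) (ℕₚ.*-zeroʳ (toℕ k)))))
      (trans (+-cong (IsRotation.C-0 rotation₄) (IsRotation.S-0 rotation₄)) (+-identityʳ 1#))

  module _ {μ : Carrier} (v : Fin N → Carrier) (Lv≈μv : ∀ i → ∑[ j < N ] (laplacian i j * v j) ≈ μ * v i) where

    coefficient : Fin N → Carrier
    coefficient k = ∑[ j < N ] (hartley j k * v j)

    inversion : ∀ i → ∑[ k < N ] (hartley i k * coefficient k) ≈ fromℕ N * v i
    inversion i = begin
      ∑[ k < N ] (hartley i k * coefficient k)
        ≈⟨ sum-cong-≋ {N} (λ k → trans (*-distribˡ-sum {N} (hartley i k) (λ j → hartley j k * v j))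
             (sum-cong-≋ {N} (λ j → sym (*-assoc (hartley i k) (hartley j k) (v j))))) ⟩
      ∑[ k < N ] ∑[ j < N ] (hartley i k * hartley j k * v j)
        ≈⟨ ∑-comm {N} {N} (λ k j → hartley i k * hartley j k * v j) ⟩
      ∑[ j < N ] ∑[ k < N ] (hartley i k * hartley j k * v j)
        ≈⟨ sum-cong-≋ {N} (λ j → trans (sym (*-distribʳ-sum {N} (v j) (λ k → hartley i k * hartley j k)))
             (trans (*-congʳ (gramᵀ i j)) (*-assoc _ _ _))) ⟩
      ∑[ j < N ] (fromℕ N * (Id i j * v j))
        ≈⟨ *-distribˡ-sum {N} (fromℕ N) (λ j → Id i j * v j) ⟨
      fromℕ N * (∑[ j < N ] (Id i j * v j))
        ≈⟨ *-congˡ (∑-Idˡ v i) ⟩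
      fromℕ N * v i ∎

    -- The eigenvector equation is paired with the `k`-th column, and symmetry moves the Laplacian
    -- across to that column.
    coefficient-eigen : ∀ k → coefficient k * μ ≈ coefficient k * spectrum k
    coefficient-eigen k = begin
      coefficient k * μ
        ≈⟨ *-distribʳ-sum {N} μ (λ i → hartley i k * v i) ⟩
      ∑[ i < N ] (hartley i k * v i * μ)
        ≈⟨ sum-cong-≋ {N} (λ i → trans (solve 3 (λ h v m → h :* v :* m := h :* (m :* v)) refl (hartley i k) (v i) μ)
             (trans (*-congˡ (sym (Lv≈μv i))) (*-distribˡ-sum {N} (hartley i k) (λ j → laplacian i j * v j)))) ⟩
      ∑[ i < N ] ∑[ j < N ] (hartley i k * (laplacian i j * v j))
        ≈⟨ ∑-comm {N} {N} (λ i j → hartley i k * (laplacian i j * v j)) ⟩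
      ∑[ j < N ] ∑[ i < N ] (hartley i k * (laplacian i j * v j))
        ≈⟨ sum-cong-≋ {N} (λ j → trans
             (sum-cong-≋ {N} (λ i → trans (*-congˡ (*-congʳ (laplacian-sym i j)))
               (solve 3 (λ h a v → h :* (a :* v) := a :* h :* v) refl (hartley i k) (laplacian j i) (v j))))
             (trans (sym (*-distribʳ-sum {N} (v j) (λ i → laplacian j i * hartley i k))) (*-congʳ (laplacian-hartley j k)))) ⟩
      ∑[ j < N ] (spectrum k * hartley j k * v j)
        ≈⟨ sum-cong-≋ {N} (λ j → solve 3 (λ s h v → s :* h :* v := h :* v :* s) refl (spectrum k) (hartley j k) (v j)) ⟩
      ∑[ j < N ] (hartley j k * v j * spectrum k)
        ≈⟨ *-distribʳ-sum {N} (spectrum k) (λ j → hartley j k * v j) ⟨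
      coefficient k * spectrum k ∎

    eigenvector⇒spectrum : ∀ i → v i # 0# → ∃[ k ] μ ≈ spectrum k
    eigenvector⇒spectrum i vi#0 =
      let k , hc#0 = ∑-#⇒# N (#-congʳ (sym (inversion i)) (x#0y#0→xy#0 N#0 vi#0))
      in k , *-cancelˡ-# (*-#⇒#ʳ hc#0) (coefficient-eigen k)

  -- The determinants of `Hᵀ` and `H` multiply to `N^N`, and a factor of an invertible element is
  -- invertible.
  det-hartley#0 : det hartley # 0#
  det-hartley#0 = *-#⇒#ʳ (#-congʳ (sym (begin
    det (λ k j → hartley j k) * det hartley
      ≈⟨ det-⊗ (λ k j → hartley j k) hartley ⟨
    det ((λ k j → hartley j k) ⊗ hartley)
      ≈⟨ det-cong {N} gram ⟩
    det {N} (λ i k → fromℕ N * Id i k)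
      ≈⟨ det-diagonal {N} (λ i k → fromℕ N * Id i k) (λ i≢k → trans (*-congˡ (reflexive (Id-off i≢k))) (zeroʳ _)) ⟩
    product {N} (λ i → fromℕ N * Id i i)
      ≈⟨ product-cong {N} (λ i → trans (*-congˡ (reflexive (Id-diag i))) (*-identityʳ _)) ⟩
    product {N} (λ _ → fromℕ N) ∎)) (product-#0 N))
    where
    product-#0 : ∀ n → product {n} (λ _ → fromℕ N) # 0#
    product-#0 zero    = 1#0
    product-#0 (suc n) = x#0y#0→xy#0 N#0 (product-#0 n)

  -- For `A = x Id - L` the eigenvector relations read `A H = H D` with `D` diagonal; `det H`
  -- cancels because it is apart from 0.
  charPoly : ∀ x → det (λ i j → x * Id i j - laplacian i j) ≈ product (λ i → x - spectrum i)
  charPoly x = *-cancelˡ-# det-hartley#0 (begin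
    det hartley * det A
      ≈⟨ *-comm _ _ ⟩
    det A * det hartley
      ≈⟨ det-⊗ A hartley ⟨
    det (A ⊗ hartley)
      ≈⟨ det-cong {N} A⊗H≈H⊗D ⟩
    det (hartley ⊗ D)
      ≈⟨ det-⊗ hartley D ⟩
    det hartley * det D
      ≈⟨ *-congˡ (trans
           (det-diagonal D (λ i≢k → trans (*-congˡ (reflexive (Id-off i≢k))) (zeroʳ _)))
           (product-cong {N} (λ i → trans (*-congˡ (reflexive (Id-diag i))) (*-identityʳ _)))) ⟩
    det hartley * product (λ i → x - spectrum i) ∎)
    where
    A D : Matrix N
    A i j = x * Id i j - laplacian i j
    D i k = (x - spectrum i) * Id i k

    A⊗H≈H⊗D : ∀ i k → (A ⊗ hartley) i k ≈ (hartley ⊗ D) i k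
    A⊗H≈H⊗D i k = begin
      ∑[ j < N ] ((x * Id i j - laplacian i j) * hartley j k)
        ≈⟨ sum-cong-≋ {N} (λ j → solve 4 (λ x e a h → (x :* e :- a) :* h := x :* (e :* h) :+ (:- con (+ 1)) :* (a :* h)) refl
             x (Id i j) (laplacian i j) (hartley j k)) ⟩
      ∑[ j < N ] (x * (Id i j * hartley j k) + - 1# * (laplacian i j * hartley j k))
        ≈⟨ trans (∑-distrib-+ {N} (λ j → x * (Id i j * hartley j k)) (λ j → - 1# * (laplacian i j * hartley j k)))
             (sym (+-cong (*-distribˡ-sum {N} x (λ j → Id i j * hartley j k)) (*-distribˡ-sum {N} (- 1#) (λ j → laplacian i j * hartley j k)))) ⟩
      x * (∑[ j < N ] (Id i j * hartley j k)) + - 1# * (∑[ j < N ] (laplacian i j * hartley j k))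
        ≈⟨ +-cong (*-congˡ (∑-Idˡ (λ j → hartley j k) i)) (*-congˡ (laplacian-hartley i k)) ⟩
      x * hartley i k + - 1# * (spectrum k * hartley i k)
        ≈⟨ solve 3 (λ x h s → x :* h :+ (:- con (+ 1)) :* (s :* h) := h :* (x :- s)) refl x (hartley i k) (spectrum k) ⟩
      hartley i k * (x - spectrum k)
        ≈⟨ ∑-Id (λ j → hartley i j * (x - spectrum j)) k ⟨
      ∑[ j < N ] (hartley i j * (x - spectrum j) * Id j k)
        ≈⟨ sum-cong-≋ {N} (λ j → *-assoc (hartley i j) (x - spectrum j) (Id j k)) ⟩
      ∑[ j < N ] (hartley i j * ((x - spectrum j) * Id j k)) ∎
      where open import Algebra.Properties.Semiring.Sum semiring using (∑-distrib-+)

open import Data.Nat.Base using (_≤_; _*_; >-nonZero)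
open import Data.Nat.Properties using (<⇒≤)

mainTheorem10 :
  ∀ {c ℓ₁ ℓ₂ ℓ₃} (ℝ : CompleteOrderedField c ℓ₁ ℓ₂ ℓ₃) →
  let open CompleteOrderedField ℝ using (Carrier)
      open Spectral ℝ in
  (cos : Carrier → Carrier) → IsCos cos →
  (π : Carrier) → IsPi cos π →
  (N : ℕ) .{{_ : NonZero N}} (l : ℕ) (2≤l : 2 ≤ l) (2l≤N : 2 * l ≤ N) →
  HasEigenvalues
    (normalizedLaplacian (hypercycle N l 2≤l 2l≤N) (hypercycle-noIsolated N l 2≤l 2l≤N))
    (λ (i : Fin N) → hypercycleEigenvalue cos π N l {{>-nonZero (<⇒≤ 2≤l)}} (toℕ (suc i)))
mainTheorem10 ℝ cos isCos π isPi N l 2≤l 2l≤N = record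
  { eigenvalue⇔ = λ μ → mk⇔
      (λ (v , (i , vi#0) , Lv≈μv) → eigenvector⇒spectrum v Lv≈μv i vi#0)
      spectrum⇒eigenvalue
  ; charPoly    = charPoly
  }
  where open HypercycleSpectrum ℝ cos isCos π isPi N l 2≤l 2l≤N
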